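{- Let $R$ be a commutative unital ring. For every integer $n\geq 2$, the standard identity of degree $4n-2$ is a polynomial identity of both $M_nE^2$ and $M_nE^3$.
   Context: $E^m=R\langle v_1,\dots,v_m\rangle/(v_i^2,\ v_iv_j+v_jv_i \mid 1\le i,j\le m)$ is the $m$-generated Grassmann algebra over $R$, and $M_nE^m$ is the ring of $n\times n$ matrices over $E^m$. The standard polynomial of degree $k$ is $s_k(x_1,\dots,x_k)=\sum_{\pi\in\mathfrak{S}_k}\mathrm{sgn}(\pi)x_{\pi(1)}\cdots x_{\pi(k)}$; it is a polynomial identity if it vanishes for all substitutions of elements of the algebra. -}

module Defs where

open import Level using (Level; _⊔_; 0ℓ)
open import Algebra.Bundles using (CommutativeRing; Ring)
import Algebra.Properties.Semiring.Exp as SemiringExp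
import Algebra.Properties.Semiring.Sum as SemiringSum
open import Data.Bool.Base using (if_then_else_)
open import Data.Fin.Base using (Fin; zero; suc; punchIn)
open import Data.Fin.Permutation as Perm using (Permutation′; _⟨$⟩ʳ_; insert; remove; insert-remove)
open import Data.Fin.Properties using (_<?_; _≟_; punchIn-injective)
open import Data.List.Base using (List; []; _∷_; map; foldr; length; filter; allFin; cartesianProduct; cartesianProductWith)
open import Data.List.Membership.Propositional.Properties using (∈-allFin)
import Data.List.Membership.Setoid as SetoidMembership
open import Data.List.Membership.Setoid.Properties using (∈-cartesianProductWith⁺; ∈-resp-≈)
open import Data.List.Relation.Unary.All using ([])
open import Data.List.Relation.Unary.AllPairs using ([]; _∷_)
open import Data.List.Relation.Unary.Any using (here)
import Data.List.Relation.Unary.Unique.Setoid as SetoidUnique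
import Data.List.Relation.Unary.Unique.Setoid.Properties as SetoidUniqueₚ
import Data.List.Relation.Unary.Unique.Propositional.Properties as Uniqueₚ
open import Data.Nat.Base using (ℕ; zero; suc)
open import Data.Product.Base using (_×_; _,_)
open import Data.Vec.Functional using (Vector)
import Data.Vec.Functional as Vector
open import Relation.Binary.Bundles using (Setoid)
open import Relation.Binary.PropositionalEquality as ≡ using (_≡_)
open import Relation.Nullary.Decidable using (does; _×-dec_)

private
  variable
    c ℓ x s : Level

module _ (R : CommutativeRing c ℓ) where
  private module R = CommutativeRing R

  infixl 6 _⊕_
  infixl 7 _⊗_

  -- Noncommutative polynomial expressions with coefficients in R;
  -- R⟨X⟩/(S) is this type modulo Equal S.
  data Expr (X : Set x) : Set (c ⊔ x) where
    ι   : R.Carrier → Expr X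
    var : X → Expr X
    _⊕_ : Expr X → Expr X → Expr X
    _⊗_ : Expr X → Expr X → Expr X
    ⊖_  : Expr X → Expr X

  -- The least congruence for which expressions form a unital associative
  -- R-algebra and every member of S is 0.
  data Equal {X : Set x} (S : Expr X → Set s) : Expr X → Expr X → Set (c ⊔ ℓ ⊔ x ⊔ s) where
    refl       : ∀ {a} → Equal S a a
    sym        : ∀ {a b} → Equal S a b → Equal S b a
    trans      : ∀ {a b d} → Equal S a b → Equal S b d → Equal S a d
    ⊕-cong     : ∀ {a a′ b b′} → Equal S a a′ → Equal S b b′ → Equal S (a ⊕ b) (a′ ⊕ b′)
    ⊗-cong     : ∀ {a a′ b b′} → Equal S a a′ → Equal S b b′ → Equal S (a ⊗ b) (a′ ⊗ b′)
    ⊖-cong     : ∀ {a a′} → Equal S a a′ → Equal S (⊖ a) (⊖ a′)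
    ⊕-assoc    : ∀ a b d → Equal S ((a ⊕ b) ⊕ d) (a ⊕ (b ⊕ d))
    ⊕-comm     : ∀ a b → Equal S (a ⊕ b) (b ⊕ a)
    ⊕-identity : ∀ a → Equal S (ι R.0# ⊕ a) a
    ⊖-inverse  : ∀ a → Equal S ((⊖ a) ⊕ a) (ι R.0#)
    ⊗-assoc    : ∀ a b d → Equal S ((a ⊗ b) ⊗ d) (a ⊗ (b ⊗ d))
    ⊗-identity : ∀ a → Equal S (ι R.1# ⊗ a) a
    distribˡ   : ∀ a b d → Equal S (a ⊗ (b ⊕ d)) ((a ⊗ b) ⊕ (a ⊗ d))
    distribʳ   : ∀ a b d → Equal S ((b ⊕ d) ⊗ a) ((b ⊗ a) ⊕ (d ⊗ a))
    ι-cong     : ∀ {p q} → p R.≈ q → Equal S (ι p) (ι q)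
    ι-+        : ∀ p q → Equal S (ι (p R.+ q)) (ι p ⊕ ι q)
    ι-*        : ∀ p q → Equal S (ι (p R.* q)) (ι p ⊗ ι q)
    ι-central  : ∀ p a → Equal S (ι p ⊗ a) (a ⊗ ι p)
    relator    : ∀ {a} → S a → Equal S a (ι R.0#)

  presentedRing : (X : Set x) (S : Expr X → Set s) → Ring (c ⊔ x) (c ⊔ ℓ ⊔ x ⊔ s)
  presentedRing X S = record
    { Carrier = Expr X
    ; _≈_     = Equal S
    ; _+_     = _⊕_
    ; _*_     = _⊗_
    ; -_      = ⊖_
    ; 0#      = ι R.0#
    ; 1#      = ι R.1#
    ; isRing  = record
      { +-isAbelianGroup = record
        { isGroup = record
          { isMonoid = record
            { isSemigroup = record
              { isMagma = record
                { isEquivalence = record { refl = refl ; sym = sym ; trans = trans }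
                ; ∙-cong = ⊕-cong
                }
              ; assoc = ⊕-assoc
              }
            ; identity = ⊕-identity , λ a → trans (⊕-comm a _) (⊕-identity a)
            }
          ; inverse = ⊖-inverse , λ a → trans (⊕-comm a _) (⊖-inverse a)
          ; ⁻¹-cong = ⊖-cong
          }
        ; comm = ⊕-comm
        }
      ; *-cong     = ⊗-cong
      ; *-assoc    = ⊗-assoc
      ; *-identity = ⊗-identity , λ a → trans (sym (ι-central _ a)) (⊗-identity a)
      ; distrib    = distribˡ , distribʳ
      }
    }

  data GrassmannRelator (m : ℕ) : Expr (Fin m) → Set c where
    square : ∀ i → GrassmannRelator m (var i ⊗ var i)
    anti   : ∀ i j → GrassmannRelator m ((var i ⊗ var j) ⊕ (var j ⊗ var i))

  Grassmann : ℕ → Ring c (c ⊔ ℓ)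
  Grassmann m = presentedRing (Fin m) (GrassmannRelator m)

module _ (n : ℕ) (A : Ring c ℓ) where
  private module A = Ring A
  open SemiringSum A.semiring
    using (sum; sum-syntax; sum-cong-≋; ∑-comm; ∑-distrib-+; sum-replicate-zero; *-distribˡ-sum; *-distribʳ-sum)

  Matrix : Set c
  Matrix = Fin n → Fin n → A.Carrier

  matMul : Matrix → Matrix → Matrix
  matMul M N i j = ∑[ k < n ] (M i k A.* N k j)

  identityMatrix : Matrix
  identityMatrix i j = if does (i ≟ j) then A.1# else A.0#

  private
    δ : ∀ {k} → Fin k → Fin k → A.Carrier
    δ i j = if does (i ≟ j) then A.1# else A.0#

    sum-zero : ∀ {k} (f : Vector A.Carrier k) → (∀ i → f i A.≈ A.0#) → sum f A.≈ A.0#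
    sum-zero {k} f h = A.trans (sum-cong-≋ h) (sum-replicate-zero k)

    sum-δˡ : ∀ {k} (i : Fin k) f → sum (λ j → δ i j A.* f j) A.≈ f i
    sum-δˡ zero    f = A.trans (A.+-cong (A.*-identityˡ _) (sum-zero (λ j → A.0# A.* f (suc j)) λ j → A.zeroˡ (f (suc j)))) (A.+-identityʳ _)
    sum-δˡ (suc i) f = A.trans (A.+-cong (A.zeroˡ _) (sum-δˡ i (λ j → f (suc j)))) (A.+-identityˡ _)

    sum-δʳ : ∀ {k} (i : Fin k) f → sum (λ j → f j A.* δ j i) A.≈ f i
    sum-δʳ zero    f = A.trans (A.+-cong (A.*-identityʳ _) (sum-zero (λ j → f (suc j) A.* A.0#) λ j → A.zeroʳ (f (suc j)))) (A.+-identityʳ _)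
    sum-δʳ (suc i) f = A.trans (A.+-cong (A.zeroʳ _) (sum-δʳ i (λ j → f (suc j)))) (A.+-identityˡ _)

    matMul-assoc : ∀ M N P i j → matMul (matMul M N) P i j A.≈ matMul M (matMul N P) i j
    matMul-assoc M N P i j = begin
      ∑[ k < n ] ((∑[ l < n ] (M i l A.* N l k)) A.* P k j)
        ≈⟨ sum-cong-≋ (λ k → *-distribʳ-sum (P k j) (λ l → M i l A.* N l k)) ⟩
      ∑[ k < n ] ∑[ l < n ] ((M i l A.* N l k) A.* P k j)
        ≈⟨ ∑-comm (λ k l → (M i l A.* N l k) A.* P k j) ⟩
      ∑[ l < n ] ∑[ k < n ] ((M i l A.* N l k) A.* P k j)
        ≈⟨ sum-cong-≋ (λ l → sum-cong-≋ (λ k → A.*-assoc (M i l) (N l k) (P k j))) ⟩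
      ∑[ l < n ] ∑[ k < n ] (M i l A.* (N l k A.* P k j))
        ≈⟨ sum-cong-≋ (λ l → *-distribˡ-sum (M i l) (λ k → N l k A.* P k j)) ⟨
      ∑[ l < n ] (M i l A.* (∑[ k < n ] (N l k A.* P k j))) ∎
      where open import Relation.Binary.Reasoning.Setoid A.setoid

  matrixRing : Ring c ℓ
  matrixRing = record
    { Carrier = Matrix
    ; _≈_     = λ M N → ∀ i j → M i j A.≈ N i j
    ; _+_     = λ M N i j → M i j A.+ N i j
    ; _*_     = matMul
    ; -_      = λ M i j → A.- M i j
    ; 0#      = λ _ _ → A.0#
    ; 1#      = identityMatrix
    ; isRing  = record
      { +-isAbelianGroup = record
        { isGroup = record
          { isMonoid = record
            { isSemigroup = record
              { isMagma = record
                { isEquivalence = record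
                  { refl  = λ _ _ → A.refl
                  ; sym   = λ p i j → A.sym (p i j)
                  ; trans = λ p q i j → A.trans (p i j) (q i j)
                  }
                ; ∙-cong = λ p q i j → A.+-cong (p i j) (q i j)
                }
              ; assoc = λ _ _ _ _ _ → A.+-assoc _ _ _
              }
            ; identity = (λ _ _ _ → A.+-identityˡ _) , (λ _ _ _ → A.+-identityʳ _)
            }
          ; inverse = (λ _ _ _ → A.-‿inverseˡ _) , (λ _ _ _ → A.-‿inverseʳ _)
          ; ⁻¹-cong = λ p i j → A.-‿cong (p i j)
          }
        ; comm = λ _ _ _ _ → A.+-comm _ _
        }
      ; *-cong     = λ p q i j → sum-cong-≋ (λ k → A.*-cong (p i k) (q k j))
      ; *-assoc    = matMul-assoc
      ; *-identity = (λ M i j → sum-δˡ i (λ k → M k j)) , (λ M i j → sum-δʳ j (M i))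
      ; distrib    = (λ M N P i j → A.trans (sum-cong-≋ (λ k → A.distribˡ (M i k) (N k j) (P k j)))
                                            (∑-distrib-+ (λ k → M i k A.* N k j) (λ k → M i k A.* P k j)))
                   , (λ M N P i j → A.trans (sum-cong-≋ (λ k → A.distribʳ (M k j) (N i k) (P i k)))
                                            (∑-distrib-+ (λ k → N i k A.* M k j) (λ k → P i k A.* M k j)))
      }
    }

permutationSetoid : ℕ → Setoid 0ℓ 0ℓ
permutationSetoid k = record
  { Carrier       = Permutation′ k
  ; _≈_           = Perm._≈_
  ; isEquivalence = record
    { refl  = λ _ → ≡.refl
    ; sym   = λ p i → ≡.sym (p i)
    ; trans = λ p q i → ≡.trans (p i) (q i)
    }
  }

-- All elements of 𝔖ₖ, each exactly once (permutations-complete and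
-- permutations-unique): choose the image of 0, then a bijection between
-- the remaining points.
permutations : ∀ k → List (Permutation′ k)
permutations zero    = Perm.id ∷ []
permutations (suc k) = cartesianProductWith (insert zero) (allFin (suc k)) (permutations k)

private
  insert-cong : ∀ {k} {i j : Fin (suc k)} {π ρ : Permutation′ k} → i ≡ j → π Perm.≈ ρ →
                insert zero i π Perm.≈ insert zero j ρ
  insert-cong i≡j π≈ρ zero = i≡j
  insert-cong {π = π} {ρ} ≡.refl π≈ρ (suc l) = ≡.cong (punchIn _) (π≈ρ l)

  insert-injective : ∀ {k} {i j : Fin (suc k)} {π ρ : Permutation′ k} →
                     insert zero i π Perm.≈ insert zero j ρ → i ≡ j × π Perm.≈ ρ
  insert-injective {i = i} {π = π} {ρ} p with p zero
  ... | ≡.refl = ≡.refl , λ l → punchIn-injective i (π ⟨$⟩ʳ l) (ρ ⟨$⟩ʳ l) (p (suc l))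

permutations-complete : ∀ {k} (π : Permutation′ k) →
                        SetoidMembership._∈_ (permutationSetoid k) π (permutations k)
permutations-complete {zero}  π = here λ ()
permutations-complete {suc k} π =
  ∈-resp-≈ (permutationSetoid (suc k)) {x = insert zero (π ⟨$⟩ʳ zero) (remove zero π)} {y = π} (insert-remove zero π)
    (∈-cartesianProductWith⁺ (≡.setoid _) (permutationSetoid k) (permutationSetoid (suc k))
      {f = insert zero}
      (λ {_} {_} {π} {ρ} → insert-cong {π = π} {ρ}) (∈-allFin (π ⟨$⟩ʳ zero)) (permutations-complete (remove zero π)))

permutations-unique : ∀ k → SetoidUnique.Unique (permutationSetoid k) (permutations k)
permutations-unique zero    = [] ∷ []
permutations-unique (suc k) =
  SetoidUniqueₚ.cartesianProductWith⁺ (≡.setoid _) (permutationSetoid k) (permutationSetoid (suc k))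
    (insert zero) (λ {_} {_} {π} {ρ} → insert-injective {π = π} {ρ})
    (Uniqueₚ.allFin⁺ (suc k)) (permutations-unique k)

inversions : ∀ {k} → Permutation′ k → ℕ
inversions {k} π =
  length (filter (λ (i , j) → (i <? j) ×-dec ((π ⟨$⟩ʳ j) <? (π ⟨$⟩ʳ i)))
                 (cartesianProduct (allFin k) (allFin k)))

module _ (A : Ring c ℓ) where
  open Ring A
  open SemiringExp semiring using (_^_)

  -- sgn π as an element of A.
  sgn : ∀ {k} → Permutation′ k → Carrier
  sgn π = (- 1#) ^ inversions π

  product : ∀ {k} → Vector Carrier k → Carrier
  product = Vector.foldr _*_ 1#

  standard : ∀ k → Vector Carrier k → Carrier
  standard k x = foldr _+_ 0# (map (λ π → sgn π * product (λ i → x (π ⟨$⟩ʳ i))) (permutations k))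

  IsPolynomialIdentity : ∀ {k} → (Vector Carrier k → Carrier) → Set (c ⊔ ℓ)
  IsPolynomialIdentity {k} f = (x : Vector Carrier k) → f x ≈ 0#

  StandardIdentity : ℕ → Set (c ⊔ ℓ)
  StandardIdentity k = IsPolynomialIdentity (standard k)

{-# OPTIONS --safe #-}
module Submission where

-- By multilinearity it suffices to substitute matrix units times even (central) or odd Grassmann
-- elements. A product of four odd elements is zero, so at most three substituted matrices are odd,
-- and everything reduces to identities of integer matrices, where one may divide by integers.
--
-- Give the even substitutions anticommuting coefficients and let X be their sum; A = X² then has
-- commuting entries and tr Aᵖ = 0 for p ≥ 1, whence Aⁿ = 0 (Amitsur–Levitzki, after Rosset).
-- With y and z in place of the odd substitutions, the case of two odd elements follows from
-- ∑ (-1)ʲ Xⁱ y Xʲ z Xᵏ = 0 over i + j + k = 4n - 4. Linearising X²ⁿ = 0 gives, over i + j = 2n - 1,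
-- ∑ (-1)ⁱ Xⁱ y Xʲ = 0 for y with even entries and ∑ Xⁱ y Xʲ = 0 for y with odd entries; comparing
-- y with X y, also ∑ Aⁱ y Aʲ = 0 over i + j = n. These relations, applied to y, to z and to y Xʲ z,
-- show that n - 1 times the terms with all exponents even and n times the other terms vanish.
-- For three odd elements, the sign of a permutation of {1,2,3} is the sum of the signs of the
-- relative orders of 1-2, 2-3 and 3-1, which reduces this case to the previous one.

open import Defs using (Expr; Equal; Grassmann; GrassmannRelator; Matrix; StandardIdentity; identityMatrix; inversions; matrixRing; permutations; product; sgn; standard)
open import Level using (_⊔_; 0ℓ)
open import Algebra.Bundles using (CommutativeRing; Ring)
import Algebra.Properties.Ring as RingProperties
import Algebra.Properties.Semiring.Exp as SemiringExp
import Algebra.Properties.Semiring.Mult as SemiringMult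
import Algebra.Properties.Semiring.Sum as SemiringSum
open import Data.Bool.Base using (Bool; true; false; if_then_else_)
open import Data.Empty using (⊥)
open import Data.Fin.Base as Fin using (Fin; zero; suc; punchIn; toℕ)
import Data.Fin.Permutation as Perm
open import Data.Fin.Permutation using (Permutation′; _⟨$⟩ʳ_)
import Data.Fin.Properties as Finₚ
open import Data.Fin.Properties using (_≟_; pigeonhole)
open import Data.Integer.Base as ℤ using (ℤ; +_; -[1+_])
import Data.Integer.Properties as ℤₚ
open import Data.List.Base using (List; []; _∷_; _++_; cartesianProduct; cartesianProductWith; filter; foldr; length; map; replicate; tabulate)
import Data.List.Properties as Listₚ
open import Data.List.Relation.Binary.Permutation.Propositional using (_↭_; ↭-prep; ↭-refl; ↭-sym; ↭-trans)
open import Data.List.Relation.Binary.Permutation.Propositional.Properties using (map⁺; shift)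
open import Data.List.Relation.Unary.All as All using (All; []; _∷_)
import Data.List.Relation.Unary.All.Properties as Allₚ
open import Data.Nat.Base as ℕ using (ℕ; zero; suc; s≤s; z≤n)
import Data.Nat.Properties as ℕₚ
open import Data.Nat.Solver using (module +-*-Solver)
open import Data.Product.Base using (Σ; _×_; _,_; proj₁; proj₂)
open import Data.Sum.Base using (inj₁; inj₂)
open import Data.Unit.Base using (⊤; tt)
open import Data.Vec.Base using (Vec; lookup)
open import Data.Vec.Functional using (Vector)
open import Function.Base using (_∘_)
import Relation.Binary.Reflection as Reflection
open import Relation.Binary.PropositionalEquality as ≡ using (_≡_; _≢_)
open import Relation.Nullary.Decidable using (Dec; yes; no; does; _×-dec_)
open import Relation.Nullary.Negation using (contradiction)
open import Relation.Unary using (Decidable; Pred)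

-- The argument divides by 2, by n, by n - 1 and by n!, which is impossible in R. Hence the
-- Grassmann coefficients are pulled out of the words first, and the remaining series have integer
-- values. Since two marks can cut the 4n - 4 copies of X into three powers all below 2n, X^(2n) = 0
-- alone does not settle two odd elements; its linearisations are required. Nilpotency of A from
-- vanishing traces is an exterior algebra computation: contract the product of n forms from the
-- vector A ψ with one further ψ_o. The product has n + 1 factors linear in n anticommuting
-- variables, so the result is zero; evaluated by the Leibniz rule it is (-1)^n n! times the entry o
-- of A^n ψ. This is proved for every odd matrix, and so applies to X + ε y with ε odd and y even;
-- its coefficient at ε is the linearisation. An odd y is first made even by a second odd ε′, which
-- accounts for the different sign in the rule for odd y. Division by n - 1 explains the bound n ≥
-- 2: for n = 1 the degree would be 2, and s_2(v_1, v_2) = 2 v_1 v_2.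

-- Identities valid in every ring.

module RingLemmas {a ℓ} (A : Ring a ℓ) where
  open Ring A
  open RingProperties A
  open import Relation.Binary.Reasoning.Setoid setoid

  +-interchange : ∀ w x y z → (w + x) + (y + z) ≈ (w + y) + (x + z)
  +-interchange w x y z = begin
    (w + x) + (y + z) ≈⟨ +-assoc w x (y + z) ⟩
    w + (x + (y + z)) ≈⟨ +-congˡ (+-assoc x y z) ⟨
    w + ((x + y) + z) ≈⟨ +-congˡ (+-congʳ (+-comm x y)) ⟩
    w + ((y + x) + z) ≈⟨ +-congˡ (+-assoc y x z) ⟩
    w + (y + (x + z)) ≈⟨ +-assoc w y (x + z) ⟨
    (w + y) + (x + z) ∎

  neg-* : ∀ x y → (- x) * y ≈ - (x * y)
  neg-* x y = sym (-‿distribˡ-* x y)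

  *-neg : ∀ x y → x * (- y) ≈ - (x * y)
  *-neg x y = sym (-‿distribʳ-* x y)

  neg-*-neg : ∀ x y → (- x) * (- y) ≈ x * y
  neg-*-neg x y = trans (neg-* x (- y)) (trans (-‿cong (*-neg x y)) (-‿involutive (x * y)))

  neg-+ : ∀ x y → - (x + y) ≈ - x + - y
  neg-+ x y = sym (-‿+-comm x y)

  x-y+y≈x : ∀ x y → (x - y) + y ≈ x
  x-y+y≈x x y = trans (+-assoc x (- y) y) (trans (+-congˡ (-‿inverseˡ y)) (+-identityʳ x))

  x-y≈0⇒x≈y : ∀ {x y} → x - y ≈ 0# → x ≈ y
  x-y≈0⇒x≈y {x} {y} e = trans (sym (x-y+y≈x x y)) (trans (+-congʳ e) (+-identityˡ y))

  x+y≈0⇒x≈-y : ∀ {x y} → x + y ≈ 0# → x ≈ - y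
  x+y≈0⇒x≈-y {x} {y} = +-inverseˡ-unique x y

-- Series in anticommuting letters.

-- The signed shuffle algebra: series evaluated at words, where the letters behave as anticommuting
-- variables and ∂ x is the left derivative. If X is supported on words of length one, then Xᵏ at the
-- word x₁ ⋯ xₖ is the standard polynomial of degree k in the values X(x₁), …, X(xₖ).
module Shuffle {a ℓ} (A : Ring a ℓ) {v} (V : Set v) where
  private
    module A = Ring A
    module Aᵣ = RingLemmas A
  open RingProperties A using (-‿involutive; -0#≈0#; -‿+-comm)
  open import Relation.Binary.Reasoning.Setoid A.setoid

  Series : Set (a ⊔ v)
  Series = List V → A.Carrier

  infix 4 _≐_
  _≐_ : Series → Series → Set (ℓ ⊔ v)
  f ≐ g = ∀ L → f L A.≈ g L

  ∂ : V → Series → Series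
  ∂ x f L = f (x ∷ L)

  -- The grading automorphism, (-1)^l on words of length l: it is the effect on a series of moving
  -- an anticommuting letter past it.
  σ : Series → Series
  σ f []      = f []
  σ f (x ∷ L) = A.- σ (∂ x f) L

  infixl 6 _⊞_
  infixl 7 _⊛_
  _⊞_ : Series → Series → Series
  (f ⊞ g) L = f L A.+ g L

  ⊟_ : Series → Series
  (⊟ f) L = A.- f L

  -- The recursion is the skew Leibniz rule for `∂ x`. Unfolded, it is the signed sum over all ways
  -- to split a word into two complementary subwords.
  _⊛_ : Series → Series → Series
  (f ⊛ g) []      = f [] A.* g []
  (f ⊛ g) (x ∷ L) = (∂ x f ⊛ g) L A.+ (σ f ⊛ ∂ x g) L

  𝟘 : Series
  𝟘 _ = A.0#

  const : A.Carrier → Series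
  const c []      = c
  const c (_ ∷ _) = A.0#

  single : (V → A.Carrier) → Series
  single c []      = A.0#
  single c (x ∷ L) = const (c x) L

  σ-cong : ∀ {f g} → f ≐ g → σ f ≐ σ g
  σ-cong p []      = p []
  σ-cong p (x ∷ L) = A.-‿cong (σ-cong (λ M → p (x ∷ M)) L)

  ⊛-cong : ∀ {f f′ g g′} → f ≐ f′ → g ≐ g′ → f ⊛ g ≐ f′ ⊛ g′
  ⊛-cong p q []      = A.*-cong (p []) (q [])
  ⊛-cong p q (x ∷ L) = A.+-cong (⊛-cong (λ M → p (x ∷ M)) q L)
                                (⊛-cong (σ-cong p) (λ M → q (x ∷ M)) L)

  σ-⊞ : ∀ f g → σ (f ⊞ g) ≐ σ f ⊞ σ g
  σ-⊞ f g []      = A.refl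
  σ-⊞ f g (x ∷ L) = A.trans (A.-‿cong (σ-⊞ (∂ x f) (∂ x g) L)) (Aᵣ.neg-+ _ _)

  σ-⊟ : ∀ f → σ (⊟ f) ≐ ⊟ σ f
  σ-⊟ f []      = A.refl
  σ-⊟ f (x ∷ L) = A.-‿cong (σ-⊟ (∂ x f) L)

  σ-involutive : ∀ f → σ (σ f) ≐ f
  σ-involutive f []      = A.refl
  σ-involutive f (x ∷ L) = begin
    A.- σ (⊟ σ (∂ x f)) L       ≈⟨ A.-‿cong (σ-⊟ (σ (∂ x f)) L) ⟩
    A.- (A.- σ (σ (∂ x f)) L)   ≈⟨ -‿involutive _ ⟩
    σ (σ (∂ x f)) L             ≈⟨ σ-involutive (∂ x f) L ⟩
    f (x ∷ L)                   ∎

  ⊛-distribˡ : ∀ f g h → f ⊛ (g ⊞ h) ≐ (f ⊛ g) ⊞ (f ⊛ h)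
  ⊛-distribˡ f g h []      = A.distribˡ _ _ _
  ⊛-distribˡ f g h (x ∷ L) =
    A.trans (A.+-cong (⊛-distribˡ (∂ x f) g h L) (⊛-distribˡ (σ f) (∂ x g) (∂ x h) L))
            (Aᵣ.+-interchange _ _ _ _)

  ⊛-distribʳ : ∀ f g h → (g ⊞ h) ⊛ f ≐ (g ⊛ f) ⊞ (h ⊛ f)
  ⊛-distribʳ f g h []      = A.distribʳ _ _ _
  ⊛-distribʳ f g h (x ∷ L) =
    A.trans (A.+-cong (⊛-distribʳ f (∂ x g) (∂ x h) L)
                      (A.trans (⊛-cong (σ-⊞ g h) (λ _ → A.refl) L) (⊛-distribʳ (∂ x f) (σ g) (σ h) L)))
            (Aᵣ.+-interchange _ _ _ _)

  ⊟-⊛ : ∀ f g → (⊟ f) ⊛ g ≐ ⊟ (f ⊛ g)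
  ⊟-⊛ f g []      = Aᵣ.neg-* _ _
  ⊟-⊛ f g (x ∷ L) = begin
    ((⊟ ∂ x f) ⊛ g) L A.+ (σ (⊟ f) ⊛ ∂ x g) L      ≈⟨ A.+-cong (⊟-⊛ (∂ x f) g L) (⊛-cong (σ-⊟ f) (λ _ → A.refl) L) ⟩
    A.- (∂ x f ⊛ g) L A.+ ((⊟ σ f) ⊛ ∂ x g) L      ≈⟨ A.+-congˡ (⊟-⊛ (σ f) (∂ x g) L) ⟩
    A.- (∂ x f ⊛ g) L A.+ A.- (σ f ⊛ ∂ x g) L      ≈⟨ -‿+-comm _ _ ⟩
    A.- ((∂ x f ⊛ g) L A.+ (σ f ⊛ ∂ x g) L)        ∎

  ⊛-⊟ : ∀ f g → f ⊛ (⊟ g) ≐ ⊟ (f ⊛ g)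
  ⊛-⊟ f g []      = Aᵣ.*-neg _ _
  ⊛-⊟ f g (x ∷ L) = A.trans (A.+-cong (⊛-⊟ (∂ x f) g L) (⊛-⊟ (σ f) (∂ x g) L)) (-‿+-comm _ _)

  σ-⊛ : ∀ f g → σ (f ⊛ g) ≐ σ f ⊛ σ g
  σ-⊛ f g []      = A.refl
  σ-⊛ f g (x ∷ L) = begin
    A.- σ ((∂ x f ⊛ g) ⊞ (σ f ⊛ ∂ x g)) L
      ≈⟨ A.-‿cong (σ-⊞ (∂ x f ⊛ g) (σ f ⊛ ∂ x g) L) ⟩
    A.- (σ (∂ x f ⊛ g) L A.+ σ (σ f ⊛ ∂ x g) L)
      ≈⟨ A.-‿cong (A.+-cong (σ-⊛ (∂ x f) g L) (σ-⊛ (σ f) (∂ x g) L)) ⟩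
    A.- ((σ (∂ x f) ⊛ σ g) L A.+ (σ (σ f) ⊛ σ (∂ x g)) L)
      ≈⟨ Aᵣ.neg-+ _ _ ⟩
    A.- (σ (∂ x f) ⊛ σ g) L A.+ A.- (σ (σ f) ⊛ σ (∂ x g)) L
      ≈⟨ A.+-cong (⊟-⊛ (σ (∂ x f)) (σ g) L) (⊛-⊟ (σ (σ f)) (σ (∂ x g)) L) ⟨
    ((⊟ σ (∂ x f)) ⊛ σ g) L A.+ (σ (σ f) ⊛ (⊟ σ (∂ x g))) L ∎

  ⊛-assoc : ∀ f g h → (f ⊛ g) ⊛ h ≐ f ⊛ (g ⊛ h)
  ⊛-assoc f g h []      = A.*-assoc _ _ _
  ⊛-assoc f g h (x ∷ L) = begin
    (((∂ x f ⊛ g) ⊞ (σ f ⊛ ∂ x g)) ⊛ h) L A.+ (σ (f ⊛ g) ⊛ ∂ x h) L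
      ≈⟨ A.+-cong (⊛-distribʳ h (∂ x f ⊛ g) (σ f ⊛ ∂ x g) L) (⊛-cong (σ-⊛ f g) (λ _ → A.refl) L) ⟩
    (((∂ x f ⊛ g) ⊛ h) L A.+ ((σ f ⊛ ∂ x g) ⊛ h) L) A.+ ((σ f ⊛ σ g) ⊛ ∂ x h) L
      ≈⟨ A.+-cong (A.+-cong (⊛-assoc (∂ x f) g h L) (⊛-assoc (σ f) (∂ x g) h L)) (⊛-assoc (σ f) (σ g) (∂ x h) L) ⟩
    ((∂ x f ⊛ (g ⊛ h)) L A.+ (σ f ⊛ (∂ x g ⊛ h)) L) A.+ (σ f ⊛ (σ g ⊛ ∂ x h)) L
      ≈⟨ A.+-assoc _ _ _ ⟩
    (∂ x f ⊛ (g ⊛ h)) L A.+ ((σ f ⊛ (∂ x g ⊛ h)) L A.+ (σ f ⊛ (σ g ⊛ ∂ x h)) L)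
      ≈⟨ A.+-congˡ (⊛-distribˡ (σ f) (∂ x g ⊛ h) (σ g ⊛ ∂ x h) L) ⟨
    (∂ x f ⊛ (g ⊛ h)) L A.+ (σ f ⊛ ((∂ x g ⊛ h) ⊞ (σ g ⊛ ∂ x h))) L ∎

  𝟘-⊛ : ∀ f → 𝟘 ⊛ f ≐ 𝟘
  σ-𝟘 : σ 𝟘 ≐ 𝟘
  σ-𝟘 []      = A.refl
  σ-𝟘 (x ∷ L) = A.trans (A.-‿cong (σ-𝟘 L)) -0#≈0#
  𝟘-⊛ f []      = A.zeroˡ _
  𝟘-⊛ f (x ∷ L) = begin
    (𝟘 ⊛ f) L A.+ (σ 𝟘 ⊛ ∂ x f) L ≈⟨ A.+-cong (𝟘-⊛ f L) (⊛-cong σ-𝟘 (λ _ → A.refl) L) ⟩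
    A.0# A.+ (𝟘 ⊛ ∂ x f) L        ≈⟨ A.+-identityˡ _ ⟩
    (𝟘 ⊛ ∂ x f) L                 ≈⟨ 𝟘-⊛ (∂ x f) L ⟩
    A.0#                          ∎

  ⊛-𝟘 : ∀ f → f ⊛ 𝟘 ≐ 𝟘
  ⊛-𝟘 f []      = A.zeroʳ _
  ⊛-𝟘 f (x ∷ L) = A.trans (A.+-cong (⊛-𝟘 (∂ x f) L) (⊛-𝟘 (σ f) L)) (A.+-identityˡ _)

  σ-const : ∀ c → σ (const c) ≐ const c
  σ-const c []      = A.refl
  σ-const c (x ∷ L) = A.trans (A.-‿cong (σ-𝟘 L)) -0#≈0#

  const-⊛ : ∀ c f L → (const c ⊛ f) L A.≈ c A.* f L
  const-⊛ c f []      = A.refl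
  const-⊛ c f (x ∷ L) = begin
    (𝟘 ⊛ f) L A.+ (σ (const c) ⊛ ∂ x f) L ≈⟨ A.+-cong (𝟘-⊛ f L) (⊛-cong (σ-const c) (λ _ → A.refl) L) ⟩
    A.0# A.+ (const c ⊛ ∂ x f) L          ≈⟨ A.+-identityˡ _ ⟩
    (const c ⊛ ∂ x f) L                   ≈⟨ const-⊛ c (∂ x f) L ⟩
    c A.* f (x ∷ L)                       ∎

  ⊛-const : ∀ c f L → (f ⊛ const c) L A.≈ f L A.* c
  ⊛-const c f []      = A.refl
  ⊛-const c f (x ∷ L) = begin
    (∂ x f ⊛ const c) L A.+ (σ f ⊛ 𝟘) L ≈⟨ A.+-cong (⊛-const c (∂ x f) L) (⊛-𝟘 (σ f) L) ⟩
    f (x ∷ L) A.* c A.+ A.0#            ≈⟨ A.+-identityʳ _ ⟩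
    f (x ∷ L) A.* c                     ∎

  σ-single : ∀ c → σ (single c) ≐ ⊟ single c
  σ-single c []      = A.sym -0#≈0#
  σ-single c (x ∷ L) = A.-‿cong (σ-const (c x) L)

  ring : Ring (a ⊔ v) (ℓ ⊔ v)
  ring = record
    { Carrier = Series
    ; _≈_     = _≐_
    ; _+_     = _⊞_
    ; _*_     = _⊛_
    ; -_      = ⊟_
    ; 0#      = 𝟘
    ; 1#      = const A.1#
    ; isRing  = record
      { +-isAbelianGroup = record
        { isGroup = record
          { isMonoid = record
            { isSemigroup = record
              { isMagma = record
                { isEquivalence = record
                  { refl  = λ _ → A.refl
                  ; sym   = λ p L → A.sym (p L)
                  ; trans = λ p q L → A.trans (p L) (q L)
                  }
                ; ∙-cong = λ p q L → A.+-cong (p L) (q L)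
                }
              ; assoc = λ _ _ _ _ → A.+-assoc _ _ _
              }
            ; identity = (λ _ _ → A.+-identityˡ _) , (λ _ _ → A.+-identityʳ _)
            }
          ; inverse = (λ _ _ → A.-‿inverseˡ _) , (λ _ _ → A.-‿inverseʳ _)
          ; ⁻¹-cong = λ p L → A.-‿cong (p L)
          }
        ; comm = λ _ _ _ → A.+-comm _ _
        }
      ; *-cong     = ⊛-cong
      ; *-assoc    = ⊛-assoc
      ; *-identity = (λ f L → A.trans (const-⊛ A.1# f L) (A.*-identityˡ _))
                   , (λ f L → A.trans (⊛-const A.1# f L) (A.*-identityʳ _))
      ; distrib    = ⊛-distribˡ , ⊛-distribʳ
      }
    }

-- The central image of the integers in a ring.

module IntegerImage {a ℓ} (A : Ring a ℓ) where
  open Ring A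
  open RingProperties A
  open RingLemmas A
  open SemiringMult semiring using (×-homo-+) renaming (_×_ to _×ₙ_)
  open import Relation.Binary.Reasoning.Setoid setoid

  fromℤ : ℤ → Carrier
  fromℤ (+ n)    = n ×ₙ 1#
  fromℤ -[1+ n ] = - (suc n ×ₙ 1#)

  fromℤ-⊖ : ∀ m n → fromℤ (m ℤ.⊖ n) ≈ m ×ₙ 1# - n ×ₙ 1#
  fromℤ-⊖ m       zero    = sym (trans (+-congˡ -0#≈0#) (+-identityʳ _))
  fromℤ-⊖ zero    (suc n) = sym (+-identityˡ _)
  fromℤ-⊖ (suc m) (suc n) = begin
    fromℤ (suc m ℤ.⊖ suc n)                     ≡⟨ ≡.cong fromℤ (ℤₚ.[1+m]⊖[1+n]≡m⊖n m n) ⟩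
    fromℤ (m ℤ.⊖ n)                             ≈⟨ fromℤ-⊖ m n ⟩
    m ×ₙ 1# - n ×ₙ 1#                           ≈⟨ +-identityˡ _ ⟨
    0# + (m ×ₙ 1# - n ×ₙ 1#)                    ≈⟨ +-congʳ (-‿inverseʳ 1#) ⟨
    (1# - 1#) + (m ×ₙ 1# - n ×ₙ 1#)             ≈⟨ +-interchange _ _ _ _ ⟩
    (1# + m ×ₙ 1#) + (- 1# + - (n ×ₙ 1#))       ≈⟨ +-congˡ (-‿+-comm _ _) ⟩
    (1# + m ×ₙ 1#) - (1# + n ×ₙ 1#)             ∎

  fromℤ-neg : ∀ i → fromℤ (ℤ.- i) ≈ - fromℤ i
  fromℤ-neg (+ zero)  = sym -0#≈0#
  fromℤ-neg (+ suc n) = refl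
  fromℤ-neg -[1+ n ]  = sym (-‿involutive _)

  fromℤ-+ : ∀ i j → fromℤ (i ℤ.+ j) ≈ fromℤ i + fromℤ j
  fromℤ-+ (+ m)    (+ n)    = ×-homo-+ 1# m n
  fromℤ-+ (+ m)    -[1+ n ] = fromℤ-⊖ m (suc n)
  fromℤ-+ -[1+ m ] (+ n)    = trans (fromℤ-⊖ n (suc m)) (+-comm _ _)
  fromℤ-+ -[1+ m ] -[1+ n ] = begin
    - (suc (suc (m ℕ.+ n)) ×ₙ 1#)       ≈⟨ -‿cong (+-congˡ (×-homo-+ 1# (suc m) n)) ⟩
    - (1# + (suc m ×ₙ 1# + n ×ₙ 1#))    ≈⟨ -‿cong (+-assoc _ _ _) ⟨
    - ((1# + suc m ×ₙ 1#) + n ×ₙ 1#)    ≈⟨ -‿cong (+-congʳ (+-comm _ _)) ⟩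
    - ((suc m ×ₙ 1# + 1#) + n ×ₙ 1#)    ≈⟨ -‿cong (+-assoc _ _ _) ⟩
    - (suc m ×ₙ 1# + suc n ×ₙ 1#)       ≈⟨ neg-+ _ _ ⟩
    - (suc m ×ₙ 1#) - suc n ×ₙ 1#       ∎

  fromℤ-pos-* : ∀ m j → fromℤ (+ m ℤ.* j) ≈ fromℤ (+ m) * fromℤ j
  fromℤ-pos-* zero    j = trans (reflexive (≡.cong fromℤ (ℤₚ.*-zeroˡ j))) (sym (zeroˡ _))
  fromℤ-pos-* (suc m) j = begin
    fromℤ (+ suc m ℤ.* j)                 ≡⟨ ≡.cong fromℤ (ℤₚ.suc-* (+ m) j) ⟩
    fromℤ (j ℤ.+ + m ℤ.* j)               ≈⟨ fromℤ-+ j (+ m ℤ.* j) ⟩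
    fromℤ j + fromℤ (+ m ℤ.* j)           ≈⟨ +-cong (sym (*-identityˡ _)) (fromℤ-pos-* m j) ⟩
    1# * fromℤ j + (m ×ₙ 1#) * fromℤ j    ≈⟨ distribʳ _ _ _ ⟨
    (1# + m ×ₙ 1#) * fromℤ j              ∎

  fromℤ-* : ∀ i j → fromℤ (i ℤ.* j) ≈ fromℤ i * fromℤ j
  fromℤ-* (+ m)    j = fromℤ-pos-* m j
  fromℤ-* -[1+ m ] j = begin
    fromℤ (ℤ.- (+ suc m) ℤ.* j)           ≡⟨ ≡.cong fromℤ (ℤₚ.neg-distribˡ-* (+ suc m) j) ⟨
    fromℤ (ℤ.- (+ suc m ℤ.* j))           ≈⟨ fromℤ-neg (+ suc m ℤ.* j) ⟩
    - fromℤ (+ suc m ℤ.* j)               ≈⟨ -‿cong (fromℤ-pos-* (suc m) j) ⟩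
    - (fromℤ (+ suc m) * fromℤ j)         ≈⟨ -‿distribˡ-* _ _ ⟩
    - (suc m ×ₙ 1#) * fromℤ j             ∎

  ×1-central : ∀ n x → (n ×ₙ 1#) * x ≈ x * (n ×ₙ 1#)
  ×1-central zero    x = trans (zeroˡ x) (sym (zeroʳ x))
  ×1-central (suc n) x = begin
    (1# + n ×ₙ 1#) * x        ≈⟨ distribʳ _ _ _ ⟩
    1# * x + (n ×ₙ 1#) * x    ≈⟨ +-cong (trans (*-identityˡ x) (sym (*-identityʳ x))) (×1-central n x) ⟩
    x * 1# + x * (n ×ₙ 1#)    ≈⟨ distribˡ _ _ _ ⟨
    x * (1# + n ×ₙ 1#)        ∎

  fromℤ-central : ∀ i x → fromℤ i * x ≈ x * fromℤ i
  fromℤ-central (+ n)    x = ×1-central n x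
  fromℤ-central -[1+ n ] x = trans (neg-* _ _) (trans (-‿cong (×1-central (suc n) x)) (sym (*-neg _ _)))

  fromℤ-1 : fromℤ (+ 1) ≈ 1#
  fromℤ-1 = +-identityʳ 1#

-- A solver for identities in noncommutative rings.

-- Normal forms are lists of distinct words with integer coefficients; the order on
-- words only serves to make them canonical and plays no role in the soundness proof.
module RingSolver {a ℓ} (A : Ring a ℓ) where
  open Ring A
  open RingProperties A
  open RingLemmas A
  open IntegerImage A
  open import Relation.Binary.Reasoning.Setoid setoid

  infixl 6 _:+_ _:-_
  infixl 7 _:*_
  data Poly (k : ℕ) : Set where
    var        : Fin k → Poly k
    :0 :1      : Poly k
    _:+_ _:*_  : Poly k → Poly k → Poly k
    :-_        : Poly k → Poly k

  _:-_ : ∀ {k} → Poly k → Poly k → Poly k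
  p :- q = p :+ (:- q)

  ⟦_⟧ : ∀ {k} → Poly k → Vec Carrier k → Carrier
  ⟦ var i ⟧ ρ  = lookup ρ i
  ⟦ :0 ⟧ ρ     = 0#
  ⟦ :1 ⟧ ρ     = 1#
  ⟦ p :+ q ⟧ ρ = ⟦ p ⟧ ρ + ⟦ q ⟧ ρ
  ⟦ p :* q ⟧ ρ = ⟦ p ⟧ ρ * ⟦ q ⟧ ρ
  ⟦ :- p ⟧ ρ   = - ⟦ p ⟧ ρ

  Word : ℕ → Set
  Word k = List (Fin k)

  Normal : ℕ → Set
  Normal k = List (ℤ × Word k)

  module _ {k : ℕ} where

    _<ʷ_ : Word k → Word k → Bool
    _       <ʷ []      = false
    []      <ʷ (_ ∷ _) = true
    (i ∷ u) <ʷ (j ∷ w) = if does (i Finₚ.<? j) then true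
                         else if does (j Finₚ.<? i) then false else (u <ʷ w)

    -- A term whose coefficient becomes zero is deleted, for otherwise equal polynomials could have
    -- different normal forms.
    insert : ℤ → Word k → Normal k → Normal k
    insert c u [] = (c , u) ∷ []
    insert c u ((d , w) ∷ N) with Listₚ.≡-dec Finₚ._≟_ u w
    ... | yes _ with (c ℤ.+ d) ℤₚ.≟ (+ 0)
    ...   | yes _ = N
    ...   | no _  = (c ℤ.+ d , w) ∷ N
    insert c u ((d , w) ∷ N) | no _ = if u <ʷ w then (c , u) ∷ (d , w) ∷ N else (d , w) ∷ insert c u N

    merge : Normal k → Normal k → Normal k
    merge []            N = N
    merge ((c , u) ∷ M) N = insert c u (merge M N)

    timesTerm : ℤ → Word k → Normal k → Normal k
    timesTerm c u []            = []
    timesTerm c u ((d , w) ∷ N) = insert (c ℤ.* d) (u ++ w) (timesTerm c u N)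

    times : Normal k → Normal k → Normal k
    times []            N = []
    times ((c , u) ∷ M) N = merge (timesTerm c u N) (times M N)

    normalise : Poly k → Normal k
    normalise (var i)  = (+ 1 , i ∷ []) ∷ []
    normalise :0       = []
    normalise :1       = (+ 1 , []) ∷ []
    normalise (p :+ q) = merge (normalise p) (normalise q)
    normalise (p :* q) = times (normalise p) (normalise q)
    normalise (:- p)   = timesTerm (ℤ.- (+ 1)) [] (normalise p)

    module _ (ρ : Vec Carrier k) where

      ⟦_⟧ʷ : Word k → Carrier
      ⟦ [] ⟧ʷ    = 1#
      ⟦ i ∷ u ⟧ʷ = lookup ρ i * ⟦ u ⟧ʷ

      ⟦_⟧ⁿ : Normal k → Carrier
      ⟦ [] ⟧ⁿ          = 0#
      ⟦ (c , u) ∷ N ⟧ⁿ = fromℤ c * ⟦ u ⟧ʷ + ⟦ N ⟧ⁿ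

      ⟦++⟧ : ∀ u w → ⟦ u ++ w ⟧ʷ ≈ ⟦ u ⟧ʷ * ⟦ w ⟧ʷ
      ⟦++⟧ []      w = sym (*-identityˡ _)
      ⟦++⟧ (i ∷ u) w = trans (*-congˡ (⟦++⟧ u w)) (sym (*-assoc _ _ _))

      insert-correct : ∀ c u N → ⟦ insert c u N ⟧ⁿ ≈ fromℤ c * ⟦ u ⟧ʷ + ⟦ N ⟧ⁿ
      insert-correct c u [] = refl
      insert-correct c u ((d , w) ∷ N) with Listₚ.≡-dec Finₚ._≟_ u w
      ... | yes ≡.refl with (c ℤ.+ d) ℤₚ.≟ (+ 0)
      ...   | yes c+d≡0 = sym (begin
        fromℤ c * ⟦ u ⟧ʷ + (fromℤ d * ⟦ u ⟧ʷ + ⟦ N ⟧ⁿ)   ≈⟨ +-assoc _ _ _ ⟨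
        (fromℤ c * ⟦ u ⟧ʷ + fromℤ d * ⟦ u ⟧ʷ) + ⟦ N ⟧ⁿ   ≈⟨ +-congʳ (distribʳ _ _ _) ⟨
        (fromℤ c + fromℤ d) * ⟦ u ⟧ʷ + ⟦ N ⟧ⁿ            ≈⟨ +-congʳ (*-congʳ (fromℤ-+ c d)) ⟨
        fromℤ (c ℤ.+ d) * ⟦ u ⟧ʷ + ⟦ N ⟧ⁿ                ≡⟨ ≡.cong (λ e → fromℤ e * ⟦ u ⟧ʷ + ⟦ N ⟧ⁿ) c+d≡0 ⟩
        0# * ⟦ u ⟧ʷ + ⟦ N ⟧ⁿ                             ≈⟨ +-congʳ (zeroˡ _) ⟩
        0# + ⟦ N ⟧ⁿ                                      ≈⟨ +-identityˡ _ ⟩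
        ⟦ N ⟧ⁿ                                           ∎)
      ...   | no _ = begin
        fromℤ (c ℤ.+ d) * ⟦ u ⟧ʷ + ⟦ N ⟧ⁿ                ≈⟨ +-congʳ (*-congʳ (fromℤ-+ c d)) ⟩
        (fromℤ c + fromℤ d) * ⟦ u ⟧ʷ + ⟦ N ⟧ⁿ            ≈⟨ +-congʳ (distribʳ _ _ _) ⟩
        (fromℤ c * ⟦ u ⟧ʷ + fromℤ d * ⟦ u ⟧ʷ) + ⟦ N ⟧ⁿ   ≈⟨ +-assoc _ _ _ ⟩
        fromℤ c * ⟦ u ⟧ʷ + (fromℤ d * ⟦ u ⟧ʷ + ⟦ N ⟧ⁿ)   ∎
      insert-correct c u ((d , w) ∷ N) | no _ with u <ʷ w
      ... | true  = refl
      ... | false = begin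
        fromℤ d * ⟦ w ⟧ʷ + ⟦ insert c u N ⟧ⁿ             ≈⟨ +-congˡ (insert-correct c u N) ⟩
        fromℤ d * ⟦ w ⟧ʷ + (fromℤ c * ⟦ u ⟧ʷ + ⟦ N ⟧ⁿ)   ≈⟨ +-assoc _ _ _ ⟨
        (fromℤ d * ⟦ w ⟧ʷ + fromℤ c * ⟦ u ⟧ʷ) + ⟦ N ⟧ⁿ   ≈⟨ +-congʳ (+-comm _ _) ⟩
        (fromℤ c * ⟦ u ⟧ʷ + fromℤ d * ⟦ w ⟧ʷ) + ⟦ N ⟧ⁿ   ≈⟨ +-assoc _ _ _ ⟩
        fromℤ c * ⟦ u ⟧ʷ + (fromℤ d * ⟦ w ⟧ʷ + ⟦ N ⟧ⁿ)   ∎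

      merge-correct : ∀ M N → ⟦ merge M N ⟧ⁿ ≈ ⟦ M ⟧ⁿ + ⟦ N ⟧ⁿ
      merge-correct []            N = sym (+-identityˡ _)
      merge-correct ((c , u) ∷ M) N = begin
        ⟦ insert c u (merge M N) ⟧ⁿ             ≈⟨ insert-correct c u (merge M N) ⟩
        fromℤ c * ⟦ u ⟧ʷ + ⟦ merge M N ⟧ⁿ       ≈⟨ +-congˡ (merge-correct M N) ⟩
        fromℤ c * ⟦ u ⟧ʷ + (⟦ M ⟧ⁿ + ⟦ N ⟧ⁿ)    ≈⟨ +-assoc _ _ _ ⟨
        fromℤ c * ⟦ u ⟧ʷ + ⟦ M ⟧ⁿ + ⟦ N ⟧ⁿ      ∎

      timesTerm-correct : ∀ c u N → ⟦ timesTerm c u N ⟧ⁿ ≈ (fromℤ c * ⟦ u ⟧ʷ) * ⟦ N ⟧ⁿ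
      timesTerm-correct c u []            = sym (zeroʳ _)
      timesTerm-correct c u ((d , w) ∷ N) = begin
        ⟦ insert (c ℤ.* d) (u ++ w) (timesTerm c u N) ⟧ⁿ
          ≈⟨ insert-correct (c ℤ.* d) (u ++ w) (timesTerm c u N) ⟩
        fromℤ (c ℤ.* d) * ⟦ u ++ w ⟧ʷ + ⟦ timesTerm c u N ⟧ⁿ
          ≈⟨ +-cong (*-cong (fromℤ-* c d) (⟦++⟧ u w)) (timesTerm-correct c u N) ⟩
        (fromℤ c * fromℤ d) * (⟦ u ⟧ʷ * ⟦ w ⟧ʷ) + (fromℤ c * ⟦ u ⟧ʷ) * ⟦ N ⟧ⁿ
          ≈⟨ +-congʳ (trans (*-assoc _ _ _) (*-congˡ (trans (sym (*-assoc _ _ _)) (*-congʳ (fromℤ-central d ⟦ u ⟧ʷ))))) ⟩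
        fromℤ c * ((⟦ u ⟧ʷ * fromℤ d) * ⟦ w ⟧ʷ) + (fromℤ c * ⟦ u ⟧ʷ) * ⟦ N ⟧ⁿ
          ≈⟨ +-congʳ (trans (*-congˡ (*-assoc _ _ _)) (sym (*-assoc _ _ _))) ⟩
        (fromℤ c * ⟦ u ⟧ʷ) * (fromℤ d * ⟦ w ⟧ʷ) + (fromℤ c * ⟦ u ⟧ʷ) * ⟦ N ⟧ⁿ
          ≈⟨ distribˡ _ _ _ ⟨
        (fromℤ c * ⟦ u ⟧ʷ) * (fromℤ d * ⟦ w ⟧ʷ + ⟦ N ⟧ⁿ) ∎

      times-correct : ∀ M N → ⟦ times M N ⟧ⁿ ≈ ⟦ M ⟧ⁿ * ⟦ N ⟧ⁿ
      times-correct []            N = sym (zeroˡ _)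
      times-correct ((c , u) ∷ M) N = begin
        ⟦ merge (timesTerm c u N) (times M N) ⟧ⁿ          ≈⟨ merge-correct (timesTerm c u N) (times M N) ⟩
        ⟦ timesTerm c u N ⟧ⁿ + ⟦ times M N ⟧ⁿ             ≈⟨ +-cong (timesTerm-correct c u N) (times-correct M N) ⟩
        (fromℤ c * ⟦ u ⟧ʷ) * ⟦ N ⟧ⁿ + ⟦ M ⟧ⁿ * ⟦ N ⟧ⁿ     ≈⟨ distribʳ _ _ _ ⟨
        (fromℤ c * ⟦ u ⟧ʷ + ⟦ M ⟧ⁿ) * ⟦ N ⟧ⁿ              ∎

      correct : ∀ p → ⟦ normalise p ⟧ⁿ ≈ ⟦ p ⟧ ρ
      correct (var i)  = trans (+-identityʳ _) (trans (*-congʳ fromℤ-1) (trans (*-identityˡ _) (*-identityʳ _)))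
      correct :0       = refl
      correct :1       = trans (+-identityʳ _) (trans (*-identityʳ _) fromℤ-1)
      correct (p :+ q) = trans (merge-correct (normalise p) (normalise q)) (+-cong (correct p) (correct q))
      correct (p :* q) = trans (times-correct (normalise p) (normalise q)) (*-cong (correct p) (correct q))
      correct (:- p)   = begin
        ⟦ timesTerm (ℤ.- (+ 1)) [] (normalise p) ⟧ⁿ    ≈⟨ timesTerm-correct (ℤ.- (+ 1)) [] (normalise p) ⟩
        (- (1# + 0#) * 1#) * ⟦ normalise p ⟧ⁿ          ≈⟨ *-cong (trans (*-identityʳ _) (-‿cong (+-identityʳ _))) (correct p) ⟩
        - 1# * ⟦ p ⟧ ρ                                 ≈⟨ -1*x≈-x _ ⟩
        - ⟦ p ⟧ ρ                                      ∎

  ⟦_⇓⟧ : ∀ {k} → Poly k → Vec Carrier k → Carrier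
  ⟦ p ⇓⟧ ρ = ⟦_⟧ⁿ ρ (normalise p)

  open Reflection setoid var ⟦_⟧ ⟦_⇓⟧ (λ p ρ → correct ρ p) public using (solve) renaming (_⊜_ to _:=_)

-- Sums of products with one or two elements placed between powers of a nilpotent element.

module Sandwich {a ℓ} (B : Ring a ℓ) (A : Ring.Carrier B) where
  open Ring B
  open RingProperties B
  open RingLemmas B
  open RingSolver B
  open SemiringExp semiring
  open SemiringMult semiring using (×-congʳ; ×-comm-*) renaming (_×_ to _×ₙ_)
  open import Relation.Binary.Reasoning.Setoid setoid

  Commutes : Carrier → Carrier → Set ℓ
  Commutes x y = x * y ≈ y * x

  ^-commutes : ∀ {x y} → Commutes x y → ∀ k → Commutes x (y ^ k)
  ^-commutes {x} {y} xy zero    = trans (*-identityʳ x) (sym (*-identityˡ x))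
  ^-commutes {x} {y} xy (suc k) = begin
    x * (y * y ^ k)   ≈⟨ *-assoc x y _ ⟨
    (x * y) * y ^ k   ≈⟨ *-congʳ xy ⟩
    (y * x) * y ^ k   ≈⟨ *-assoc y x _ ⟩
    y * (x * y ^ k)   ≈⟨ *-congˡ (^-commutes xy k) ⟩
    y * (y ^ k * x)   ≈⟨ *-assoc y _ x ⟨
    (y * y ^ k) * x   ∎

  ^-sucʳ : ∀ k → A ^ suc k ≈ A ^ k * A
  ^-sucʳ k = ^-commutes refl k

  -- sand₁ k z = ∑_{i+j=k} Aⁱ z Aʲ
  sand₁ : ℕ → Carrier → Carrier
  sand₁ zero    z = z
  sand₁ (suc k) z = A * sand₁ k z + z * A ^ suc k

  -- sand₂ m y z = ∑_{i+j+k=m} Aⁱ y Aʲ z Aᵏ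
  sand₂ : ℕ → Carrier → Carrier → Carrier
  sand₂ zero    y z = y * z
  sand₂ (suc m) y z = A * sand₂ m y z + y * sand₁ (suc m) z

  sand₁-cong : ∀ k {z z′} → z ≈ z′ → sand₁ k z ≈ sand₁ k z′
  sand₁-cong zero    e = e
  sand₁-cong (suc k) e = +-cong (*-congˡ (sand₁-cong k e)) (*-congʳ e)

  sand₁-+ : ∀ k z z′ → sand₁ k (z + z′) ≈ sand₁ k z + sand₁ k z′
  sand₁-+ zero    z z′ = refl
  sand₁-+ (suc k) z z′ = begin
    A * sand₁ k (z + z′) + (z + z′) * A ^ suc k
      ≈⟨ +-congʳ (*-congˡ (sand₁-+ k z z′)) ⟩
    A * (sand₁ k z + sand₁ k z′) + (z + z′) * A ^ suc k
      ≈⟨ solve 6 (λ α u v x y p → α :* (u :+ v) :+ (x :+ y) :* p := α :* u :+ x :* p :+ (α :* v :+ y :* p))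
           refl A _ _ z z′ _ ⟩
    (A * sand₁ k z + z * A ^ suc k) + (A * sand₁ k z′ + z′ * A ^ suc k) ∎

  sand₁-neg : ∀ k z → sand₁ k (- z) ≈ - sand₁ k z
  sand₁-neg zero    z = refl
  sand₁-neg (suc k) z = begin
    A * sand₁ k (- z) + (- z) * A ^ suc k   ≈⟨ +-congʳ (*-congˡ (sand₁-neg k z)) ⟩
    A * (- sand₁ k z) + (- z) * A ^ suc k   ≈⟨ solve 4 (λ α s z p → α :* (:- s) :+ (:- z) :* p := :- (α :* s :+ z :* p)) refl A _ z _ ⟩
    - (A * sand₁ k z + z * A ^ suc k)       ∎

  sand₁-*ˡ : ∀ {u} → Commutes u A → ∀ k z → sand₁ k (u * z) ≈ u * sand₁ k z
  sand₁-*ˡ     uA zero    z = refl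
  sand₁-*ˡ {u} uA (suc k) z = begin
    A * sand₁ k (u * z) + (u * z) * A ^ suc k
      ≈⟨ +-congʳ (trans (*-congˡ (sand₁-*ˡ uA k z)) (trans (sym (*-assoc _ _ _)) (trans (*-congʳ (sym uA)) (*-assoc _ _ _)))) ⟩
    u * (A * sand₁ k z) + (u * z) * A ^ suc k
      ≈⟨ solve 4 (λ u s z p → u :* s :+ (u :* z) :* p := u :* (s :+ z :* p)) refl u _ z _ ⟩
    u * (A * sand₁ k z + z * A ^ suc k) ∎

  sand₁-*ʳ : ∀ {u} → Commutes u A → ∀ k z → sand₁ k (z * u) ≈ sand₁ k z * u
  sand₁-*ʳ     uA zero    z = refl
  sand₁-*ʳ {u} uA (suc k) z = begin
    A * sand₁ k (z * u) + (z * u) * A ^ suc k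
      ≈⟨ +-cong (*-congˡ (sand₁-*ʳ uA k z)) (trans (*-assoc _ _ _) (*-congˡ (^-commutes uA (suc k)))) ⟩
    A * (sand₁ k z * u) + z * (A ^ suc k * u)
      ≈⟨ solve 5 (λ α s u z p → α :* (s :* u) :+ z :* (p :* u) := (α :* s :+ z :* p) :* u) refl A _ u z _ ⟩
    (A * sand₁ k z + z * A ^ suc k) * u ∎

  sand₁-sucʳ : ∀ k z → sand₁ (suc k) z ≈ sand₁ k z * A + A ^ suc k * z
  sand₁-sucʳ zero    z = solve 2 (λ α z → α :* z :+ z :* (α :* :1) := z :* α :+ (α :* :1) :* z) refl A z
  sand₁-sucʳ (suc k) z = begin
    A * sand₁ (suc k) z + z * A ^ suc (suc k)
      ≈⟨ +-cong (*-congˡ (sand₁-sucʳ k z)) (*-congˡ (^-sucʳ (suc k))) ⟩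
    A * (sand₁ k z * A + A ^ suc k * z) + z * (A ^ suc k * A)
      ≈⟨ solve 4 (λ α s p z → α :* (s :* α :+ p :* z) :+ z :* (p :* α) := (α :* s :+ z :* p) :* α :+ (α :* p) :* z)
           refl A _ _ z ⟩
    sand₁ (suc k) z * A + A ^ suc (suc k) * z ∎

  sand₂-sucʳ : ∀ m y z → sand₂ (suc m) y z ≈ sand₂ m y z * A + sand₁ (suc m) y * z
  sand₂-sucʳ zero    y z = solve 3 (λ α y z → α :* (y :* z) :+ y :* (α :* z :+ z :* (α :* :1)) :=
                                              (y :* z) :* α :+ (α :* y :+ y :* (α :* :1)) :* z) refl A y z
  sand₂-sucʳ (suc m) y z = begin
    A * sand₂ (suc m) y z + y * sand₁ (suc (suc m)) z
      ≈⟨ +-cong (*-congˡ (sand₂-sucʳ m y z)) (*-congˡ (sand₁-sucʳ (suc m) z)) ⟩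
    A * (sand₂ m y z * A + sand₁ (suc m) y * z) + y * (sand₁ (suc m) z * A + A ^ suc (suc m) * z)
      ≈⟨ solve 7 (λ α g s y t p z → α :* (g :* α :+ s :* z) :+ y :* (t :* α :+ p :* z) :=
                                    (α :* g :+ y :* t) :* α :+ (α :* s :+ y :* p) :* z)
           refl A _ _ y _ _ z ⟩
    sand₂ (suc m) y z * A + sand₁ (suc (suc m)) y * z ∎

  -- A case distinction on the middle exponent: if it is zero, y and z are adjacent; otherwise one A
  -- of the middle is absorbed into y.
  sand₂-middle : ∀ m y z → sand₂ (suc m) y z ≈ sand₁ (suc m) (y * z) + sand₂ m (y * A) z
  sand₂-middle zero    y z = solve 3 (λ α y z → α :* (y :* z) :+ y :* (α :* z :+ z :* (α :* :1)) :=
                                                (α :* (y :* z) :+ (y :* z) :* (α :* :1)) :+ (y :* α) :* z) refl A y z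
  sand₂-middle (suc m) y z = begin
    A * sand₂ (suc m) y z + y * (A * sand₁ (suc m) z + z * A ^ suc (suc m))
      ≈⟨ +-congʳ (*-congˡ (sand₂-middle m y z)) ⟩
    A * (sand₁ (suc m) (y * z) + sand₂ m (y * A) z) + y * (A * sand₁ (suc m) z + z * A ^ suc (suc m))
      ≈⟨ solve 7 (λ α s g y t z p → α :* (s :+ g) :+ y :* (α :* t :+ z :* p) :=
                                    (α :* s :+ (y :* z) :* p) :+ (α :* g :+ (y :* α) :* t))
           refl A _ _ y _ z _ ⟩
    sand₁ (suc (suc m)) (y * z) + sand₂ (suc m) (y * A) z ∎

  module Vanishing (k : ℕ) (A^≈0 : A ^ suc (suc k) ≈ 0#) where
    private
      K : ℕ
      K = suc k

    -- The form in which the linearised nilpotency enters, with `K` = n - 1. Both conditions follow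
    -- from the exchange rules for even and for odd z, and they imply the relation of degree n.
    record Good (z : Carrier) : Set ℓ where
      field
        killˡ : A * sand₁ K z ≈ 0#
        killʳ : sand₁ K z * A ≈ 0#
    open Good

    good-+ : ∀ {y z} → Good y → Good z → Good (y + z)
    good-+ {y} {z} p q .killˡ = begin
      A * sand₁ K (y + z)               ≈⟨ *-congˡ (sand₁-+ K y z) ⟩
      A * (sand₁ K y + sand₁ K z)       ≈⟨ distribˡ _ _ _ ⟩
      A * sand₁ K y + A * sand₁ K z     ≈⟨ +-cong (killˡ p) (killˡ q) ⟩
      0# + 0#                           ≈⟨ +-identityˡ 0# ⟩
      0#                                ∎
    good-+ {y} {z} p q .killʳ = begin
      sand₁ K (y + z) * A               ≈⟨ *-congʳ (sand₁-+ K y z) ⟩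
      (sand₁ K y + sand₁ K z) * A       ≈⟨ distribʳ _ _ _ ⟩
      sand₁ K y * A + sand₁ K z * A     ≈⟨ +-cong (killʳ p) (killʳ q) ⟩
      0# + 0#                           ≈⟨ +-identityˡ 0# ⟩
      0#                                ∎

    good-A* : ∀ {z} → Good z → Good (A * z)
    good-A* {z} p .killˡ = trans (*-congˡ (trans (sand₁-*ˡ refl K z) (killˡ p))) (zeroʳ A)
    good-A* {z} p .killʳ = trans (*-congʳ (trans (sand₁-*ˡ refl K z) (killˡ p))) (zeroˡ A)

    good-*A^ : ∀ {z} → Good z → ∀ j → Good (z * A ^ suc j)
    good-*A^ {z} p j .killˡ = begin
      A * sand₁ K (z * A ^ suc j)   ≈⟨ *-congˡ (sand₁-*ʳ (sym (^-commutes refl (suc j))) K z) ⟩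
      A * (sand₁ K z * A ^ suc j)   ≈⟨ *-assoc _ _ _ ⟨
      (A * sand₁ K z) * A ^ suc j   ≈⟨ *-congʳ (killˡ p) ⟩
      0# * A ^ suc j                ≈⟨ zeroˡ _ ⟩
      0#                            ∎
    good-*A^ {z} p j .killʳ = begin
      sand₁ K (z * A ^ suc j) * A   ≈⟨ *-congʳ (sand₁-*ʳ (sym (^-commutes refl (suc j))) K z) ⟩
      (sand₁ K z * A ^ suc j) * A   ≈⟨ *-congʳ (*-assoc _ _ _) ⟨
      ((sand₁ K z * A) * A ^ j) * A ≈⟨ *-congʳ (*-congʳ (killʳ p)) ⟩
      (0# * A ^ j) * A              ≈⟨ *-congʳ (zeroˡ _) ⟩
      0# * A                        ≈⟨ zeroˡ A ⟩
      0#                            ∎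

    good-sand₁ : ∀ {z} → Good z → ∀ j → Good (sand₁ j z)
    good-sand₁ p zero    = p
    good-sand₁ p (suc j) = good-+ (good-A* (good-sand₁ p j)) (good-*A^ p j)

    -- Each term of the inner sum begins or ends with an A. This factor can be pulled out of the
    -- outer sum, which it annihilates.
    sand₁-K-sand₁ : ∀ {z} → Good z → ∀ j → sand₁ K (sand₁ (suc j) z) ≈ 0#
    sand₁-K-sand₁ {z} p j = begin
      sand₁ K (A * sand₁ j z + z * A ^ suc j)
        ≈⟨ sand₁-+ K _ _ ⟩
      sand₁ K (A * sand₁ j z) + sand₁ K (z * A ^ suc j)
        ≈⟨ +-cong (sand₁-*ˡ refl K _) (sand₁-*ʳ (sym (^-commutes refl (suc j))) K z) ⟩
      A * sand₁ K (sand₁ j z) + sand₁ K z * (A * A ^ j)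
        ≈⟨ +-cong (killˡ (good-sand₁ p j)) (trans (sym (*-assoc _ _ _)) (trans (*-congʳ (killʳ p)) (zeroˡ _))) ⟩
      0# + 0#
        ≈⟨ +-identityˡ 0# ⟩
      0# ∎

    sand₁-large : ∀ {z} → Good z → ∀ j → sand₁ (j ℕ.+ suc K) z ≈ 0#
    sand₁-large {z} p zero    = begin
      A * sand₁ K z + z * A ^ suc K   ≈⟨ +-cong (killˡ p) (trans (*-congˡ A^≈0) (zeroʳ z)) ⟩
      0# + 0#                         ≈⟨ +-identityˡ 0# ⟩
      0#                              ∎
    sand₁-large {z} p (suc j) = begin
      A * sand₁ (j ℕ.+ suc K) z + z * A ^ suc (j ℕ.+ suc K)
        ≈⟨ +-cong (trans (*-congˡ (sand₁-large p j)) (zeroʳ A)) (*-congˡ A^-large) ⟩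
      0# + z * 0#
        ≈⟨ trans (+-identityˡ _) (zeroʳ z) ⟩
      0# ∎
      where
      A^-large : A ^ (suc j ℕ.+ suc K) ≈ 0#
      A^-large = trans (^-homo-* A (suc j) (suc K)) (trans (*-congˡ A^≈0) (zeroʳ _))

    module _ {y z : Carrier} (gy : Good y) (gz : Good z)
             (gyz : ∀ j → Good ((y * A ^ j) * z)) where
      private
        b₁ b₂ : Carrier
        b₁ = sand₁ K y * z
        b₂ = y * sand₁ K z

      -- Peel by the middle exponent: terms with some A outside y ⋯ z are killed by the outer sum,
      -- so only the term with all of A^k in the middle survives. In the induction y becomes u = y
      -- A^i.
      sand₂-K-middle : sand₁ K (sand₂ k y z) ≈ sand₁ K ((y * A ^ k) * z)
      sand₂-K-middle = go k y (λ j → gyz j)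
        where
        go : ∀ m u → (∀ j → Good ((u * A ^ j) * z)) → sand₁ K (sand₂ m u z) ≈ sand₁ K ((u * A ^ m) * z)
        go zero    u g = sand₁-cong K (*-congʳ (sym (*-identityʳ u)))
        go (suc m) u g = begin
          sand₁ K (sand₂ (suc m) u z)
            ≈⟨ sand₁-cong K (sand₂-middle m u z) ⟩
          sand₁ K (sand₁ (suc m) (u * z) + sand₂ m (u * A) z)
            ≈⟨ sand₁-+ K _ _ ⟩
          sand₁ K (sand₁ (suc m) (u * z)) + sand₁ K (sand₂ m (u * A) z)
            ≈⟨ +-cong (sand₁-cong K (sand₁-cong (suc m) (*-congʳ (sym (*-identityʳ u))))) (go m (u * A) g′) ⟩
          sand₁ K (sand₁ (suc m) ((u * 1#) * z)) + sand₁ K (((u * A) * A ^ m) * z)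
            ≈⟨ +-congʳ (sand₁-K-sand₁ (g 0) m) ⟩
          0# + sand₁ K (((u * A) * A ^ m) * z)
            ≈⟨ +-identityˡ _ ⟩
          sand₁ K (((u * A) * A ^ m) * z)
            ≈⟨ sand₁-cong K (*-congʳ (*-assoc _ _ _)) ⟩
          sand₁ K ((u * A ^ suc m) * z) ∎
          where
          g′ : ∀ j → Good (((u * A) * A ^ j) * z)
          g′ j .killˡ = trans (*-congˡ (sand₁-cong K (*-congʳ (*-assoc _ _ _)))) (killˡ (g (suc j)))
          g′ j .killʳ = trans (*-congʳ (sand₁-cong K (*-congʳ (*-assoc _ _ _)))) (killʳ (g (suc j)))

      -- The remainder in the recursion of `sand₂` is y times a sandwich sum of degree at least n,
      -- hence zero.
      A-sand₂ : ∀ j → sand₂ (j ℕ.+ suc K) y z ≈ A * sand₂ (j ℕ.+ K) y z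
      A-sand₂ j rewrite ℕₚ.+-suc j K =
        trans (+-congˡ (trans (*-congˡ (trans (reflexive (≡.cong (λ i → sand₁ i z) (≡.sym (ℕₚ.+-suc j K)))) (sand₁-large gz j)))
                              (zeroʳ y)))
              (+-identityʳ _)

      A^-sand₂ : ∀ j → sand₂ (j ℕ.+ K) y z ≈ A ^ j * sand₂ K y z
      A^-sand₂ zero    = sym (*-identityˡ _)
      A^-sand₂ (suc j) = begin
        sand₂ (suc j ℕ.+ K) y z      ≡⟨ ≡.cong (λ i → sand₂ i y z) (≡.sym (ℕₚ.+-suc j K)) ⟩
        sand₂ (j ℕ.+ suc K) y z      ≈⟨ A-sand₂ j ⟩
        A * sand₂ (j ℕ.+ K) y z      ≈⟨ *-congˡ (A^-sand₂ j) ⟩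
        A * (A ^ j * sand₂ K y z)    ≈⟨ *-assoc _ _ _ ⟨
        A ^ suc j * sand₂ K y z      ∎

      -- Splitting off the first or the last A from `sand₂ (suc K) y z` leaves a vanishing remainder
      -- on either side.
      sand₂-commutes : Commutes (sand₂ K y z) A
      sand₂-commutes = begin
        sand₂ K y z * A                            ≈⟨ +-identityʳ _ ⟨
        sand₂ K y z * A + 0#                       ≈⟨ +-congˡ (trans (*-congʳ (sand₁-large gy 0)) (zeroˡ z)) ⟨
        sand₂ K y z * A + sand₁ (suc K) y * z      ≈⟨ sand₂-sucʳ K y z ⟨
        sand₂ (suc K) y z                          ≈⟨ A-sand₂ 0 ⟩
        A * sand₂ K y z                            ∎

      -- With g = sand₂ k y z and h = sand₂ K y z one has A g = h - b₂ and g A = h - b₁, while h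
      -- commutes with A; so each of the summands Aⁱ g Aʲ is Aʲ⁺ⁱ⁻¹ h, up to b₁ and b₂ at the ends.
      sand₁-sand₂ : ∀ j → sand₁ (suc j) (sand₂ k y z) ≈
                    suc (suc j) ×ₙ (A ^ j * sand₂ K y z) - A ^ j * b₂ - b₁ * A ^ j
      sand₁-sand₂ zero    = begin
        A * g + g * (A * 1#)
          ≈⟨ +-congˡ (*-congˡ (*-identityʳ A)) ⟩
        A * g + g * A
          ≈⟨ solve 4 (λ l b₂ r b₁ → l :+ r := (l :+ b₂) :+ ((r :+ b₁) :+ :0) :- :1 :* b₂ :- b₁ :* :1) refl (A * g) b₂ (g * A) b₁ ⟩
        (A * g + b₂) + ((g * A + b₁) + 0#) - 1# * b₂ - b₁ * 1#
          ≈⟨ +-congʳ (+-congʳ (+-cong (sym (*-identityˡ _)) (+-congʳ (trans (sym (sand₂-sucʳ k y z)) (sym (*-identityˡ _)))))) ⟩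
        2 ×ₙ (1# * h) - 1# * b₂ - b₁ * 1# ∎
        where
        g = sand₂ k y z
        h = sand₂ K y z
      sand₁-sand₂ (suc j) = begin
        A * sand₁ (suc j) g + g * (A * A ^ suc j)
          ≈⟨ +-cong (*-congˡ (sand₁-sand₂ j)) (sym (*-assoc _ _ _)) ⟩
        A * (suc (suc j) ×ₙ (A ^ j * h) - A ^ j * b₂ - b₁ * A ^ j) + (g * A) * A ^ suc j
          ≈⟨ solve 7 (λ α p b₂ b₁ m g q →
                α :* (m :- p :* b₂ :- b₁ :* p) :+ g :* q :=
                ((g :+ b₁) :* q :+ α :* m) :- (α :* p) :* b₂ :- b₁ :* q :- (α :* b₁) :* p)
               refl A (A ^ j) b₂ b₁ (suc (suc j) ×ₙ (A ^ j * h)) (g * A) (A ^ suc j) ⟩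
        ((g * A + b₁) * A ^ suc j + A * (suc (suc j) ×ₙ (A ^ j * h))) - A ^ suc j * b₂ - b₁ * A ^ suc j - (A * b₁) * A ^ j
          ≈⟨ +-cong (+-congʳ (+-congʳ (+-cong hA (trans (×-comm-* (suc (suc j)) A _) (×-congʳ (suc (suc j)) (sym (*-assoc _ _ _)))))))
                    (trans (-‿cong Ab₁) -0#≈0#) ⟩
        (A ^ suc j * h + suc (suc j) ×ₙ (A ^ suc j * h)) - A ^ suc j * b₂ - b₁ * A ^ suc j + 0#
          ≈⟨ +-identityʳ _ ⟩
        suc (suc (suc j)) ×ₙ (A ^ suc j * h) - A ^ suc j * b₂ - b₁ * A ^ suc j ∎
        where
        g = sand₂ k y z
        h = sand₂ K y z
        hA : (g * A + b₁) * A ^ suc j ≈ A ^ suc j * h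
        hA = trans (*-congʳ (sym (sand₂-sucʳ k y z))) (^-commutes sand₂-commutes (suc j))
        Ab₁ : (A * b₁) * A ^ j ≈ 0#
        Ab₁ = trans (*-congʳ (trans (sym (*-assoc _ _ _)) (trans (*-congʳ (killˡ gy)) (zeroˡ z)))) (zeroˡ _)

      -- `sand₁-sand₂` at j = k, solved for its leading term, whose coefficient k + 2 is n. The
      -- degree k + K = 2n - 3 is that of the terms of `alt₂` with two odd exponents, where two
      -- further X's are attached to y and z.
      sand₂-odd : suc K ×ₙ sand₂ (k ℕ.+ K) y z ≈
                  sand₁ K ((y * A ^ k) * z) + A ^ k * b₂ + b₁ * A ^ k
      sand₂-odd = begin
        suc K ×ₙ sand₂ (k ℕ.+ K) y z
          ≈⟨ ×-congʳ (suc K) (A^-sand₂ k) ⟩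
        suc K ×ₙ (A ^ k * sand₂ K y z)
          ≈⟨ solve 3 (λ m u v → m := (m :- u :- v) :+ u :+ v) refl _ (A ^ k * b₂) (b₁ * A ^ k) ⟩
        (suc K ×ₙ (A ^ k * sand₂ K y z) - A ^ k * b₂ - b₁ * A ^ k) + A ^ k * b₂ + b₁ * A ^ k
          ≈⟨ +-congʳ (+-congʳ (trans (sym (sand₁-sand₂ k)) sand₂-K-middle)) ⟩
        sand₁ K ((y * A ^ k) * z) + A ^ k * b₂ + b₁ * A ^ k ∎

      -- Multiplying `sand₂-odd` by A leaves only A^K b₂, which turns out to be the sum itself. So n
      -- copies of the sum equal one copy, and n - 1 = `K` copies vanish.
      sand₂-even : K ×ₙ sand₂ (K ℕ.+ K) y z ≈ 0#
      sand₂-even = +-cancelˡ (sand₂ (K ℕ.+ K) y z) _ _ (begin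
        suc K ×ₙ sand₂ (K ℕ.+ K) y z
          ≡⟨ ≡.cong (λ i → suc K ×ₙ sand₂ i y z) (≡.sym (ℕₚ.+-suc k K)) ⟩
        suc K ×ₙ sand₂ (k ℕ.+ suc K) y z
          ≈⟨ ×-congʳ (suc K) (A-sand₂ k) ⟩
        suc K ×ₙ (A * sand₂ (k ℕ.+ K) y z)
          ≈⟨ ×-comm-* (suc K) A _ ⟨
        A * (suc K ×ₙ sand₂ (k ℕ.+ K) y z)
          ≈⟨ *-congˡ sand₂-odd ⟩
        A * (sand₁ K ((y * A ^ k) * z) + A ^ k * b₂ + b₁ * A ^ k)
          ≈⟨ solve 6 (λ α s p b₂ c z → α :* (s :+ p :* b₂ :+ (c :* z) :* p) :=
                                       α :* s :+ (α :* p) :* b₂ :+ (α :* c) :* (z :* p))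
               refl A _ (A ^ k) b₂ (sand₁ K y) z ⟩
        A * sand₁ K ((y * A ^ k) * z) + A ^ K * b₂ + (A * sand₁ K y) * (z * A ^ k)
          ≈⟨ +-cong (+-congʳ (killˡ (gyz k))) (trans (*-congʳ (killˡ gy)) (zeroˡ _)) ⟩
        0# + A ^ K * b₂ + 0#
          ≈⟨ solve 1 (λ x → :0 :+ x :+ :0 := x) refl _ ⟩
        A ^ K * b₂
          ≈⟨ solve 1 (λ x → x := :0 :+ x) refl _ ⟩
        0# + A ^ K * b₂
          -- The zero is read as A^K (A g) with g = `sand₂ k y z`, because A g + b₂ is
          -- `sand₂ K y z`.
          ≈⟨ +-congʳ (trans (sym (*-assoc _ _ _)) (trans (*-congʳ (trans (sym (^-sucʳ K)) A^≈0)) (zeroˡ _))) ⟨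
        A ^ K * (A * sand₂ k y z) + A ^ K * b₂
          ≈⟨ distribˡ _ _ _ ⟨
        A ^ K * sand₂ K y z
          ≈⟨ A^-sand₂ K ⟨
        sand₂ (K ℕ.+ K) y z
          ≈⟨ +-identityʳ _ ⟨
        sand₂ (K ℕ.+ K) y z + 0# ∎)

-- Alternating sums with marked letters, and their reduction to the square of X.

double : ℕ → ℕ
double zero    = zero
double (suc m) = suc (suc (double m))

-- altᵢ are the sums of the words in X with i marked letters, in the given order, where a word
-- is signed by the parity of moving the marked letters to the front past the (odd) X's:
-- alt₁ k y = ∑_{i+j=k} (-1)ⁱ Xⁱ y Xʲ and alt₂ m y z = ∑_{i+j+k=m} (-1)ʲ Xⁱ y Xʲ z Xᵏ.
module Alternating {a ℓ} (B : Ring a ℓ) (X : Ring.Carrier B) where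
  open Ring B
  open SemiringExp semiring using (_^_)

  alt₁ : ℕ → Carrier → Carrier
  alt₁ zero    y = y
  alt₁ (suc k) y = y * X ^ suc k - X * alt₁ k y

  alt₂ : ℕ → Carrier → Carrier → Carrier
  alt₂ zero    y z = y * z
  alt₂ (suc m) y z = X * alt₂ m y z + y * alt₁ (suc m) z

  alt₃ : ℕ → Carrier → Carrier → Carrier → Carrier
  alt₃ zero    x y z = x * (y * z)
  alt₃ (suc m) x y z = x * alt₂ (suc m) y z - X * alt₃ m x y z

module AlternatingSandwich {a ℓ} (B : Ring a ℓ) (X : Ring.Carrier B) where
  open Ring B
  open RingProperties B
  open RingLemmas B
  open RingSolver B
  open SemiringExp semiring
  open Alternating B X
  open Sandwich B (X * X)
  open import Relation.Binary.Reasoning.Setoid setoid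

  A : Carrier
  A = X * X

  X-A : Commutes X A
  X-A = sym (*-assoc X X X)

  ^-double : ∀ m → X ^ double m ≈ A ^ m
  ^-double zero    = refl
  ^-double (suc m) = trans (*-congˡ (*-congˡ (^-double m))) (sym (*-assoc _ _ _))

  -- Sort the exponents by parity: in odd total degree exactly one is odd, in even total degree both
  -- or none. The spare X's are attached to y. Each formula yields the next case of the other.
  alt₁-odd  : ∀ m y → alt₁ (suc (double m)) y ≈ sand₁ m (y * X) - sand₁ m (X * y)
  alt₁-even : ∀ m y → alt₁ (double (suc m)) y ≈ sand₁ (suc m) y - sand₁ m ((X * y) * X)

  alt₁-odd zero    y = +-congʳ (*-congˡ (*-identityʳ X))
  alt₁-odd (suc m) y = begin
    y * (X * X ^ double (suc m)) - X * alt₁ (double (suc m)) y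
      ≈⟨ +-cong (*-congˡ (*-congˡ (^-double (suc m)))) (-‿cong (*-congˡ (alt₁-even m y))) ⟩
    y * (X * A ^ suc m) - X * (sand₁ (suc m) y - sand₁ m ((X * y) * X))
      ≈⟨ solve 5 (λ y x p s t → y :* (x :* p) :- x :* (s :- t) := x :* t :+ (y :* x) :* p :- x :* s) refl y X _ _ _ ⟩
    X * sand₁ m ((X * y) * X) + (y * X) * A ^ suc m - X * sand₁ (suc m) y
      ≈⟨ +-cong (+-congʳ step) (-‿cong (sym (sand₁-*ˡ X-A (suc m) y))) ⟩
    sand₁ (suc m) (y * X) - sand₁ (suc m) (X * y) ∎
    where
    step : X * sand₁ m ((X * y) * X) ≈ A * sand₁ m (y * X)
    step = begin
      X * sand₁ m ((X * y) * X)   ≈⟨ *-congˡ (sand₁-cong m (*-assoc X y X)) ⟩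
      X * sand₁ m (X * (y * X))   ≈⟨ *-congˡ (sand₁-*ˡ X-A m (y * X)) ⟩
      X * (X * sand₁ m (y * X))   ≈⟨ *-assoc _ _ _ ⟨
      A * sand₁ m (y * X)         ∎

  alt₁-even m y = begin
    y * X ^ double (suc m) - X * alt₁ (suc (double m)) y
      ≈⟨ +-cong (*-congˡ (^-double (suc m))) (-‿cong (*-congˡ (alt₁-odd m y))) ⟩
    y * A ^ suc m - X * (sand₁ m (y * X) - sand₁ m (X * y))
      ≈⟨ +-congˡ (-‿cong (*-congˡ (+-congˡ (-‿cong (sand₁-*ˡ X-A m y))))) ⟩
    y * A ^ suc m - X * (sand₁ m (y * X) - X * sand₁ m y)
      ≈⟨ solve 4 (λ x q s t → q :- x :* (s :- x :* t) := ((x :* x) :* t :+ q) :- x :* s) refl X _ _ _ ⟩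
    sand₁ (suc m) y - X * sand₁ m (y * X)
      ≈⟨ +-congˡ (-‿cong (trans (sym (sand₁-*ˡ X-A m (y * X))) (sand₁-cong m (sym (*-assoc X y X))))) ⟩
    sand₁ (suc m) y - sand₁ m ((X * y) * X) ∎

  -- Either all three exponents are even or exactly two are odd, and the sign is that of the middle
  -- one. A spare X in the middle can be attached to either mark, since X commutes with X².
  alt₂-even : ∀ m y z → alt₂ (double (suc m)) y z ≈
              sand₂ (suc m) y z + (sand₂ m (X * y) (z * X) - sand₂ m (X * y) (X * z) - sand₂ m (y * X) (z * X))
  alt₂-even zero    y z =
    solve 3 (λ x y z → x :* (x :* (y :* z) :+ y :* (z :* (x :* :1) :- x :* z))
                         :+ y :* (z :* (x :* (x :* :1)) :- x :* (z :* (x :* :1) :- x :* z)) :=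
                       ((x :* x) :* (y :* z) :+ y :* ((x :* x) :* z :+ z :* ((x :* x) :* :1)))
                         :+ ((x :* y) :* (z :* x) :- (x :* y) :* (x :* z) :- (y :* x) :* (z :* x))) refl X y z
  alt₂-even (suc m) y z = begin
    X * (X * alt₂ (double (suc m)) y z + y * alt₁ (suc (double (suc m))) z) + y * alt₁ (double (suc (suc m))) z
      ≈⟨ +-cong (*-congˡ (+-cong (*-congˡ (alt₂-even m y z)) (*-congˡ (alt₁-odd (suc m) z)))) (*-congˡ (alt₁-even (suc m) z)) ⟩
    X * (X * (g₀ + (g₁ - g₂ - g₃)) + y * (sand₁ (suc m) (z * X) - sand₁ (suc m) (X * z)))
      + y * (sand₁ (suc (suc m)) z - sand₁ (suc m) ((X * z) * X))
      ≈⟨ +-congˡ (*-congˡ (+-congˡ (-‿cong (trans (sand₁-cong (suc m) (*-assoc X z X)) (sand₁-*ˡ X-A (suc m) (z * X)))))) ⟩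
    X * (X * (g₀ + (g₁ - g₂ - g₃)) + y * (sand₁ (suc m) (z * X) - sand₁ (suc m) (X * z)))
      + y * (sand₁ (suc (suc m)) z - X * sand₁ (suc m) (z * X))
      ≈⟨ solve 9 (λ x y g₀ g₁ g₂ g₃ s t u →
            x :* (x :* (g₀ :+ (g₁ :- g₂ :- g₃)) :+ y :* (s :- t)) :+ y :* (u :- x :* s) :=
            ((x :* x) :* g₀ :+ y :* u) :+
            (((x :* x) :* g₁ :+ (x :* y) :* s) :- ((x :* x) :* g₂ :+ (x :* y) :* t) :- ((x :* x) :* g₃ :+ (y :* x) :* s)))
           refl X y g₀ g₁ g₂ g₃ (sand₁ (suc m) (z * X)) (sand₁ (suc m) (X * z)) (sand₁ (suc (suc m)) z) ⟩
    sand₂ (suc (suc m)) y z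
      + (sand₂ (suc m) (X * y) (z * X) - sand₂ (suc m) (X * y) (X * z) - sand₂ (suc m) (y * X) (z * X)) ∎
    where
    g₀ = sand₂ (suc m) y z
    g₁ = sand₂ m (X * y) (z * X)
    g₂ = sand₂ m (X * y) (X * z)
    g₃ = sand₂ m (y * X) (z * X)

-- Vanishing of the alternating sum with two marks in degree 4n - 4.

module MarkedPairVanishing {a ℓ} (B : Ring a ℓ) (X : Ring.Carrier B) (k : ℕ) where
  open Ring B
  open RingProperties B
  open RingLemmas B
  open RingSolver B
  open SemiringExp semiring
  open SemiringMult semiring using (×-congʳ; ×-assoc-*) renaming (_×_ to _×ₙ_)
  open Alternating B X
  open AlternatingSandwich B X
  open Sandwich B (X * X)
  open import Relation.Binary.Reasoning.Setoid setoid

  private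
    K : ℕ
    K = suc k

  -- `Even` and `Odd` abstract from the parity of matrix entries; in the application they also
  -- include independence of the auxiliary letters. The two exchange rules are the linearisations of
  -- X^(2n) = 0.
  record Hypotheses {e} (Even Odd : Carrier → Set e) : Set (a ⊔ ℓ ⊔ e) where
    field
      torsionFree   : ∀ m {x} → suc m ×ₙ x ≈ 0# → x ≈ 0#
      even-1        : Even 1#
      even-even     : ∀ {x y} → Even x → Even y → Even (x * y)
      even-odd      : ∀ {x y} → Even x → Odd y → Odd (x * y)
      odd-even      : ∀ {x y} → Odd x → Even y → Odd (x * y)
      odd-odd       : ∀ {x y} → Odd x → Odd y → Even (x * y)
      odd-X         : Odd X
      A^≈0          : A ^ suc K ≈ 0#
      even-exchange : ∀ {y} → Even y → sand₁ K (y * X) ≈ sand₁ K (X * y)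
      odd-exchange  : ∀ {y} → Odd y → sand₁ K (y * X) ≈ - sand₁ K (X * y)

  module _ {e} {Even Odd : Carrier → Set e} (H : Hypotheses Even Odd) where
    open Hypotheses H
    open Vanishing k A^≈0
    open Good

    x≈-x⇒x≈0 : ∀ {x} → x ≈ - x → x ≈ 0#
    x≈-x⇒x≈0 {x} e = torsionFree 1 (begin
      x + (x + 0#)   ≈⟨ +-cong e (+-identityʳ x) ⟩
      - x + x        ≈⟨ -‿inverseˡ x ⟩
      0#             ∎)

    sand₁-XyX : ∀ y → sand₁ K ((X * y) * X) ≈ sand₁ K (X * y) * X
    sand₁-XyX y = sand₁-*ʳ X-A K (X * y)

    -- The even rule for y and then the odd rule for `y * X` lead back to the same element with one
    -- change of sign, and 2 can be cancelled.
    even-XyX : ∀ {y} → Even y → sand₁ K ((X * y) * X) ≈ 0#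
    even-XyX {y} ey = x≈-x⇒x≈0 (begin
      sand₁ K ((X * y) * X)       ≈⟨ sand₁-XyX y ⟩
      sand₁ K (X * y) * X         ≈⟨ *-congʳ (even-exchange ey) ⟨
      sand₁ K (y * X) * X         ≈⟨ sand₁-*ʳ X-A K (y * X) ⟨
      sand₁ K ((y * X) * X)       ≈⟨ odd-exchange (even-odd ey odd-X) ⟩
      - sand₁ K (X * (y * X))     ≈⟨ -‿cong (sand₁-cong K (sym (*-assoc X y X))) ⟩
      - sand₁ K ((X * y) * X)     ∎)

    odd-XyX : ∀ {y} → Odd y → sand₁ K ((X * y) * X) ≈ 0#
    odd-XyX {y} o = x≈-x⇒x≈0 (begin
      sand₁ K ((X * y) * X)       ≈⟨ sand₁-cong K (*-assoc X y X) ⟩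
      sand₁ K (X * (y * X))       ≈⟨ even-exchange (odd-odd o odd-X) ⟨
      sand₁ K ((y * X) * X)       ≈⟨ sand₁-*ʳ X-A K (y * X) ⟩
      sand₁ K (y * X) * X         ≈⟨ *-congʳ (odd-exchange o) ⟩
      - sand₁ K (X * y) * X       ≈⟨ neg-* _ _ ⟩
      - (sand₁ K (X * y) * X)     ≈⟨ -‿cong (sand₁-XyX y) ⟨
      - sand₁ K ((X * y) * X)     ∎)

    even-good : ∀ {y} → Even y → Good y
    even-good {y} ey = record { killˡ = kl ; killʳ = kr }
      where
      kr : sand₁ K y * A ≈ 0#
      kr = begin
        sand₁ K y * (X * X)              ≈⟨ *-assoc _ _ _ ⟨
        (sand₁ K y * X) * X              ≈⟨ *-congʳ (sand₁-*ʳ X-A K y) ⟨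
        sand₁ K (y * X) * X              ≈⟨ *-congʳ (even-exchange ey) ⟩
        sand₁ K (X * y) * X              ≈⟨ sand₁-XyX y ⟨
        sand₁ K ((X * y) * X)            ≈⟨ even-XyX ey ⟩
        0#                               ∎
      kl : A * sand₁ K y ≈ 0#
      kl = begin
        (X * X) * sand₁ K y              ≈⟨ *-assoc _ _ _ ⟩
        X * (X * sand₁ K y)              ≈⟨ *-congˡ (sand₁-*ˡ X-A K y) ⟨
        X * sand₁ K (X * y)              ≈⟨ *-congˡ (even-exchange ey) ⟨
        X * sand₁ K (y * X)              ≈⟨ sand₁-*ˡ X-A K (y * X) ⟨
        sand₁ K (X * (y * X))            ≈⟨ sand₁-cong K (*-assoc X y X) ⟨
        sand₁ K ((X * y) * X)            ≈⟨ even-XyX ey ⟩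
        0#                               ∎

    odd-good : ∀ {y} → Odd y → Good y
    odd-good {y} o = record { killˡ = kl ; killʳ = kr }
      where
      kr : sand₁ K y * A ≈ 0#
      kr = begin
        sand₁ K y * (X * X)              ≈⟨ *-assoc _ _ _ ⟨
        (sand₁ K y * X) * X              ≈⟨ *-congʳ (sand₁-*ʳ X-A K y) ⟨
        sand₁ K (y * X) * X              ≈⟨ *-congʳ (odd-exchange o) ⟩
        - sand₁ K (X * y) * X            ≈⟨ neg-* _ _ ⟩
        - (sand₁ K (X * y) * X)          ≈⟨ -‿cong (sand₁-XyX y) ⟨
        - sand₁ K ((X * y) * X)          ≈⟨ -‿cong (odd-XyX o) ⟩
        - 0#                             ≈⟨ -0#≈0# ⟩
        0#                               ∎
      kl : A * sand₁ K y ≈ 0#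
      kl = begin
        (X * X) * sand₁ K y              ≈⟨ *-assoc _ _ _ ⟩
        X * (X * sand₁ K y)              ≈⟨ *-congˡ (sand₁-*ˡ X-A K y) ⟨
        X * sand₁ K (X * y)              ≈⟨ *-congˡ (-‿involutive _) ⟨
        X * (- - sand₁ K (X * y))        ≈⟨ *-congˡ (-‿cong (odd-exchange o)) ⟨
        X * (- sand₁ K (y * X))          ≈⟨ *-neg _ _ ⟩
        - (X * sand₁ K (y * X))          ≈⟨ -‿cong (sand₁-*ˡ X-A K (y * X)) ⟨
        - sand₁ K (X * (y * X))          ≈⟨ -‿cong (sand₁-cong K (*-assoc X y X)) ⟨
        - sand₁ K ((X * y) * X)          ≈⟨ -‿cong (odd-XyX o) ⟩
        - 0#                             ≈⟨ -0#≈0# ⟩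
        0#                               ∎

    even-A^ : ∀ j → Even (A ^ j)
    even-A^ zero    = even-1
    even-A^ (suc j) = even-even (odd-odd odd-X odd-X) (even-A^ j)

    module _ {y z : Carrier} (ey : Even y) (ez : Even z) where
      private
        g₁ g₂ g₃ : Carrier
        g₁ = sand₂ (k ℕ.+ K) (X * y) (z * X)
        g₂ = sand₂ (k ℕ.+ K) (X * y) (X * z)
        g₃ = sand₂ (k ℕ.+ K) (y * X) (z * X)
        Xy = odd-even odd-X ey
        yX = even-odd ey odd-X
        Xz = odd-even odd-X ez
        zX = even-odd ez odd-X

      -- Each of the three applications of `sand₂-odd` loses one of its three terms to `even-XyX`:
      -- the first for `g₁`, the last for `g₂`, the middle one for `g₃`. What remains cancels in
      -- pairs in `odd-part`.
      g₁-value : suc K ×ₙ g₁ ≈ A ^ k * ((X * y) * sand₁ K (X * z)) + (sand₁ K (X * y) * (z * X)) * A ^ k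
      g₁-value = begin
        suc K ×ₙ g₁
          ≈⟨ sand₂-odd (odd-good Xy) (odd-good zX) (λ j → even-good (odd-odd (odd-even Xy (even-A^ j)) zX)) ⟩
        sand₁ K (((X * y) * A ^ k) * (z * X)) + A ^ k * ((X * y) * sand₁ K (z * X)) + (sand₁ K (X * y) * (z * X)) * A ^ k
          ≈⟨ +-congʳ (+-cong first (*-congˡ (*-congˡ (even-exchange ez)))) ⟩
        0# + A ^ k * ((X * y) * sand₁ K (X * z)) + (sand₁ K (X * y) * (z * X)) * A ^ k
          ≈⟨ +-congʳ (+-identityˡ _) ⟩
        A ^ k * ((X * y) * sand₁ K (X * z)) + (sand₁ K (X * y) * (z * X)) * A ^ k ∎
        where
        first : sand₁ K (((X * y) * A ^ k) * (z * X)) ≈ 0#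
        first = trans (sand₁-cong K (solve 4 (λ x y p z → ((x :* y) :* p) :* (z :* x) := (x :* ((y :* p) :* z)) :* x) refl X y (A ^ k) z))
                      (even-XyX (even-even (even-even ey (even-A^ k)) ez))

      g₂-value : suc K ×ₙ g₂ ≈ sand₁ K (X * ((y * A ^ k) * (X * z))) + A ^ k * ((X * y) * sand₁ K (X * z))
      g₂-value = begin
        suc K ×ₙ g₂
          ≈⟨ sand₂-odd (odd-good Xy) (odd-good Xz) (λ j → even-good (odd-odd (odd-even Xy (even-A^ j)) Xz)) ⟩
        sand₁ K (((X * y) * A ^ k) * (X * z)) + A ^ k * ((X * y) * sand₁ K (X * z)) + (sand₁ K (X * y) * (X * z)) * A ^ k
          ≈⟨ +-cong (+-congʳ (sand₁-cong K (trans (*-congʳ (*-assoc X y _)) (*-assoc X _ _)))) last ⟩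
        sand₁ K (X * ((y * A ^ k) * (X * z))) + A ^ k * ((X * y) * sand₁ K (X * z)) + 0#
          ≈⟨ +-identityʳ _ ⟩
        sand₁ K (X * ((y * A ^ k) * (X * z))) + A ^ k * ((X * y) * sand₁ K (X * z)) ∎
        where
        last : (sand₁ K (X * y) * (X * z)) * A ^ k ≈ 0#
        last = begin
          (sand₁ K (X * y) * (X * z)) * A ^ k   ≈⟨ *-congʳ (*-assoc _ _ _) ⟨
          ((sand₁ K (X * y) * X) * z) * A ^ k   ≈⟨ *-congʳ (*-congʳ (sand₁-XyX y)) ⟨
          (sand₁ K ((X * y) * X) * z) * A ^ k   ≈⟨ *-congʳ (*-congʳ (even-XyX ey)) ⟩
          (0# * z) * A ^ k                      ≈⟨ *-congʳ (zeroˡ z) ⟩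
          0# * A ^ k                            ≈⟨ zeroˡ _ ⟩
          0#                                    ∎

      g₃-value : suc K ×ₙ g₃ ≈ sand₁ K (((y * A ^ k) * (X * z)) * X) + (sand₁ K (X * y) * (z * X)) * A ^ k
      g₃-value = begin
        suc K ×ₙ g₃
          ≈⟨ sand₂-odd (odd-good yX) (odd-good zX) (λ j → even-good (odd-odd (odd-even yX (even-A^ j)) zX)) ⟩
        sand₁ K (((y * X) * A ^ k) * (z * X)) + A ^ k * ((y * X) * sand₁ K (z * X)) + (sand₁ K (y * X) * (z * X)) * A ^ k
          ≈⟨ +-cong (+-cong first middle) (*-congʳ (*-congʳ (even-exchange ey))) ⟩
        sand₁ K (((y * A ^ k) * (X * z)) * X) + 0# + (sand₁ K (X * y) * (z * X)) * A ^ k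
          ≈⟨ +-congʳ (+-identityʳ _) ⟩
        sand₁ K (((y * A ^ k) * (X * z)) * X) + (sand₁ K (X * y) * (z * X)) * A ^ k ∎
        where
        first : sand₁ K (((y * X) * A ^ k) * (z * X)) ≈ sand₁ K (((y * A ^ k) * (X * z)) * X)
        first = sand₁-cong K (begin
          ((y * X) * A ^ k) * (z * X)   ≈⟨ *-congʳ (trans (*-assoc _ _ _) (*-congˡ (^-commutes X-A k))) ⟩
          (y * (A ^ k * X)) * (z * X)   ≈⟨ solve 4 (λ y p x z → (y :* (p :* x)) :* (z :* x) := ((y :* p) :* (x :* z)) :* x) refl y (A ^ k) X z ⟩
          ((y * A ^ k) * (X * z)) * X   ∎)
        middle : A ^ k * ((y * X) * sand₁ K (z * X)) ≈ 0#
        middle = begin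
          A ^ k * ((y * X) * sand₁ K (z * X))   ≈⟨ *-congˡ (*-assoc _ _ _) ⟩
          A ^ k * (y * (X * sand₁ K (z * X)))   ≈⟨ *-congˡ (*-congˡ (sand₁-*ˡ X-A K (z * X))) ⟨
          A ^ k * (y * sand₁ K (X * (z * X)))   ≈⟨ *-congˡ (*-congˡ (trans (sand₁-cong K (sym (*-assoc X z X))) (even-XyX ez))) ⟩
          A ^ k * (y * 0#)                      ≈⟨ *-congˡ (zeroʳ y) ⟩
          A ^ k * 0#                            ≈⟨ zeroʳ _ ⟩
          0#                                    ∎

      odd-part : g₁ - g₂ - g₃ ≈ 0#
      odd-part = torsionFree K (begin
        suc K ×ₙ (g₁ - g₂ - g₃)
          ≈⟨ ×-*1 _ ⟩
        n * (g₁ - g₂ - g₃)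
          ≈⟨ solve 4 (λ n u v w → n :* (u :- v :- w) := n :* u :- n :* v :- n :* w) refl n g₁ g₂ g₃ ⟩
        n * g₁ - n * g₂ - n * g₃
          ≈⟨ +-cong (+-cong (trans (sym (×-*1 g₁)) g₁-value) (-‿cong (trans (sym (×-*1 g₂)) g₂-value)))
                    (-‿cong (trans (sym (×-*1 g₃)) g₃-value)) ⟩
        (p + q) - (sand₁ K (X * w) + p) - (sand₁ K (w * X) + q)
          ≈⟨ +-congˡ (-‿cong (+-congʳ (odd-exchange (even-odd (even-even ey (even-A^ k)) Xz)))) ⟩
        (p + q) - (sand₁ K (X * w) + p) - (- sand₁ K (X * w) + q)
          ≈⟨ solve 3 (λ p q s → (p :+ q) :- (s :+ p) :- (:- s :+ q) := :0) refl p q _ ⟩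
        0# ∎)
        where
        n = suc K ×ₙ 1#
        p = A ^ k * ((X * y) * sand₁ K (X * z))
        q = (sand₁ K (X * y) * (z * X)) * A ^ k
        w = (y * A ^ k) * (X * z)
        ×-*1 : ∀ x → suc K ×ₙ x ≈ n * x
        ×-*1 x = trans (×-congʳ (suc K) (sym (*-identityˡ x))) (sym (×-assoc-* (suc K) 1# x))

      -- The degree is 4 K = 4n - 4. The part with even exponents is divided by n - 1 here; the
      -- other part was divided by n in `odd-part`.
      alt₂-vanishes : alt₂ (double (K ℕ.+ K)) y z ≈ 0#
      alt₂-vanishes = begin
        alt₂ (double (K ℕ.+ K)) y z
          ≈⟨ alt₂-even (k ℕ.+ K) y z ⟩
        sand₂ (K ℕ.+ K) y z + (g₁ - g₂ - g₃)
          ≈⟨ +-cong (torsionFree k (sand₂-even (even-good ey) (even-good ez) (λ j → even-good (even-even (even-even ey (even-A^ j)) ez)))) odd-part ⟩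
        0# + 0#
          ≈⟨ +-identityˡ 0# ⟩
        0# ∎

-- Skew derivatives of powers and of alternating sums.

module SkewDerivations {a ℓ v} (B : Ring a ℓ) (X : Ring.Carrier B) {V : Set v}
                       (∂ : V → Ring.Carrier B → Ring.Carrier B) (C : V → Ring.Carrier B) where
  open Ring B
  open RingProperties B
  open RingLemmas B
  open RingSolver B
  open SemiringExp semiring using (_^_)
  open Alternating B X
  open import Relation.Binary.Reasoning.Setoid setoid

  -- Stated without reference to series, so that the same expansions serve the integer matrices and
  -- the matrices over the Grassmann algebra.
  record Laws : Set (a ⊔ ℓ ⊔ v) where
    field
      ∂-cong : ∀ x {f g} → f ≈ g → ∂ x f ≈ ∂ x g
      ∂-+    : ∀ x f g → ∂ x (f + g) ≈ ∂ x f + ∂ x g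
      ∂-1    : ∀ x → ∂ x 1# ≈ 0#
      ∂-X*   : ∀ x f → ∂ x (X * f) ≈ C x * f - X * ∂ x f
      ∂-C*   : ∀ x y f → ∂ x (C y * f) ≈ C y * ∂ x f

  module _ (laws : Laws) where
    open Laws laws

    ∂-0 : ∀ x → ∂ x 0# ≈ 0#
    ∂-0 x = x+x≈x⇒x≈0 _ (trans (sym (∂-+ x 0# 0#)) (∂-cong x (+-identityˡ 0#)))

    ∂-neg : ∀ x f → ∂ x (- f) ≈ - ∂ x f
    ∂-neg x f = x+y≈0⇒x≈-y (trans (sym (∂-+ x (- f) f)) (trans (∂-cong x (-‿inverseˡ f)) (∂-0 x)))

    ∂-minus : ∀ x f g → ∂ x (f - g) ≈ ∂ x f - ∂ x g
    ∂-minus x f g = trans (∂-+ x f (- g)) (+-congˡ (∂-neg x g))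

    ∂-C : ∀ x y → ∂ x (C y) ≈ 0#
    ∂-C x y = begin
      ∂ x (C y)        ≈⟨ ∂-cong x (*-identityʳ (C y)) ⟨
      ∂ x (C y * 1#)   ≈⟨ ∂-C* x y 1# ⟩
      C y * ∂ x 1#     ≈⟨ *-congˡ (∂-1 x) ⟩
      C y * 0#         ≈⟨ zeroʳ _ ⟩
      0#               ∎

    ∂-^ : ∀ x k → ∂ x (X ^ suc k) ≈ alt₁ k (C x)
    ∂-^ x zero    = begin
      ∂ x (X * 1#)              ≈⟨ ∂-X* x 1# ⟩
      C x * 1# - X * ∂ x 1#     ≈⟨ +-cong (*-identityʳ _) (-‿cong (trans (*-congˡ (∂-1 x)) (zeroʳ X))) ⟩
      C x - 0#                  ≈⟨ trans (+-congˡ -0#≈0#) (+-identityʳ _) ⟩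
      C x                       ∎
    ∂-^ x (suc k) = trans (∂-X* x (X ^ suc k)) (+-congˡ (-‿cong (*-congˡ (∂-^ x k))))

    -- The derivative replaces one X by the new mark `C y`, which costs a sign exactly when it lands
    -- to the left of the old mark.
    ∂-alt₁ : ∀ x y m → ∂ y (alt₁ (suc m) (C x)) ≈ alt₂ m (C x) (C y) - alt₂ m (C y) (C x)
    ∂-alt₁ x y m = begin
      ∂ y (C x * X ^ suc m - X * alt₁ m (C x))
        ≈⟨ ∂-minus y _ _ ⟩
      ∂ y (C x * X ^ suc m) - ∂ y (X * alt₁ m (C x))
        ≈⟨ +-cong (trans (∂-C* y x _) (*-congˡ (∂-^ y m))) (-‿cong (∂-X* y _)) ⟩
      C x * alt₁ m (C y) - (C y * alt₁ m (C x) - X * ∂ y (alt₁ m (C x)))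
        ≈⟨ rest m ⟩
      alt₂ m (C x) (C y) - alt₂ m (C y) (C x) ∎
      where
      rest : ∀ m → C x * alt₁ m (C y) - (C y * alt₁ m (C x) - X * ∂ y (alt₁ m (C x))) ≈ alt₂ m (C x) (C y) - alt₂ m (C y) (C x)
      rest zero    = begin
        C x * C y - (C y * C x - X * ∂ y (C x))   ≈⟨ +-congˡ (-‿cong (+-congˡ (-‿cong (trans (*-congˡ (∂-C y x)) (zeroʳ X))))) ⟩
        C x * C y - (C y * C x - 0#)              ≈⟨ +-congˡ (-‿cong (trans (+-congˡ -0#≈0#) (+-identityʳ _))) ⟩
        C x * C y - C y * C x                     ∎
      rest (suc m) = begin
        C x * alt₁ (suc m) (C y) - (C y * alt₁ (suc m) (C x) - X * ∂ y (alt₁ (suc m) (C x)))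
          ≈⟨ +-congˡ (-‿cong (+-congˡ (-‿cong (*-congˡ (∂-alt₁ x y m))))) ⟩
        C x * alt₁ (suc m) (C y) - (C y * alt₁ (suc m) (C x) - X * (alt₂ m (C x) (C y) - alt₂ m (C y) (C x)))
          ≈⟨ solve 5 (λ p q t u v → p :- (q :- t :* (u :- v)) := (t :* u :+ p) :- (t :* v :+ q)) refl
               (C x * alt₁ (suc m) (C y)) (C y * alt₁ (suc m) (C x)) X _ _ ⟩
        alt₂ (suc m) (C x) (C y) - alt₂ (suc m) (C y) (C x) ∎

    -- The sign is the parity of the number of old marks to the right of the new mark `C z`.
    ∂-alt₂ : ∀ x y z m → ∂ z (alt₂ (suc m) (C x) (C y)) ≈
             alt₃ m (C x) (C y) (C z) - alt₃ m (C x) (C z) (C y) + alt₃ m (C z) (C x) (C y)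
    ∂-alt₂ x y z m = begin
      ∂ z (X * alt₂ m (C x) (C y) + C x * alt₁ (suc m) (C y))
        ≈⟨ ∂-+ z _ _ ⟩
      ∂ z (X * alt₂ m (C x) (C y)) + ∂ z (C x * alt₁ (suc m) (C y))
        ≈⟨ +-cong (∂-X* z _) (trans (∂-C* z x _) (*-congˡ (∂-alt₁ y z m))) ⟩
      (C z * alt₂ m (C x) (C y) - X * ∂ z (alt₂ m (C x) (C y))) + C x * (alt₂ m (C y) (C z) - alt₂ m (C z) (C y))
        ≈⟨ rest m ⟩
      alt₃ m (C x) (C y) (C z) - alt₃ m (C x) (C z) (C y) + alt₃ m (C z) (C x) (C y) ∎
      where
      rest : ∀ m → (C z * alt₂ m (C x) (C y) - X * ∂ z (alt₂ m (C x) (C y))) + C x * (alt₂ m (C y) (C z) - alt₂ m (C z) (C y)) ≈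
             alt₃ m (C x) (C y) (C z) - alt₃ m (C x) (C z) (C y) + alt₃ m (C z) (C x) (C y)
      rest zero    = begin
        (C z * (C x * C y) - X * ∂ z (C x * C y)) + C x * (C y * C z - C z * C y)
          ≈⟨ +-congʳ (+-congˡ (-‿cong (trans (*-congˡ (trans (∂-C* z x _) (trans (*-congˡ (∂-C z y)) (zeroʳ _)))) (zeroʳ X)))) ⟩
        (C z * (C x * C y) - 0#) + C x * (C y * C z - C z * C y)
          ≈⟨ solve 3 (λ x y z → (z :* (x :* y) :- :0) :+ x :* (y :* z :- z :* y) :=
                                x :* (y :* z) :- x :* (z :* y) :+ z :* (x :* y)) refl (C x) (C y) (C z) ⟩
        C x * (C y * C z) - C x * (C z * C y) + C z * (C x * C y) ∎
      rest (suc m) = begin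
        (C z * alt₂ (suc m) (C x) (C y) - X * ∂ z (alt₂ (suc m) (C x) (C y))) + C x * (alt₂ (suc m) (C y) (C z) - alt₂ (suc m) (C z) (C y))
          ≈⟨ +-congʳ (+-congˡ (-‿cong (*-congˡ (∂-alt₂ x y z m)))) ⟩
        (C z * alt₂ (suc m) (C x) (C y) - X * (a₁ - a₂ + a₃)) + C x * (alt₂ (suc m) (C y) (C z) - alt₂ (suc m) (C z) (C y))
          ≈⟨ solve 8 (λ p t a₁ a₂ a₃ c u v →
                (p :- t :* (a₁ :- a₂ :+ a₃)) :+ c :* (u :- v) :=
                (c :* u :- t :* a₁) :- (c :* v :- t :* a₂) :+ (p :- t :* a₃))
               refl (C z * alt₂ (suc m) (C x) (C y)) X a₁ a₂ a₃ (C x) _ _ ⟩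
        alt₃ (suc m) (C x) (C y) (C z) - alt₃ (suc m) (C x) (C z) (C y) + alt₃ (suc m) (C z) (C x) (C y) ∎
        where
        a₁ = alt₃ m (C x) (C y) (C z)
        a₂ = alt₃ m (C x) (C z) (C y)
        a₃ = alt₃ m (C z) (C x) (C y)

-- Supercommutativity of series over a commutative ring.

module SuperCommutative {a ℓ} (A : CommutativeRing a ℓ) {v} (V : Set v) where
  private module A = CommutativeRing A
  open Shuffle A.ring V
  private module S = Ring ring
  open RingProperties A.ring using (-‿involutive; -0#≈0#; -‿+-comm)
  open import Relation.Binary.Reasoning.Setoid A.setoid

  -- Parity is an eigenvalue condition for the grading automorphism, which is the form in which it
  -- enters the skew Leibniz rule.
  Even Odd : Series → Set (ℓ ⊔ v)
  Even f = σ f ≐ f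
  Odd  f = σ f ≐ ⊟ f

  even-∂ : ∀ {f} → Even f → ∀ x → Odd (∂ x f)
  even-∂ {f} e x L = A.trans (A.sym (-‿involutive _)) (A.-‿cong (e (x ∷ L)))

  odd-∂ : ∀ {f} → Odd f → ∀ x → Even (∂ x f)
  odd-∂ {f} o x L = A.trans (A.sym (-‿involutive _)) (A.trans (A.-‿cong (o (x ∷ L))) (-‿involutive _))

  -- Differentiation exchanges the parities, so the rules for even and odd series are proved by a
  -- joint induction on the word.
  even-comm : ∀ {f} → Even f → ∀ g → f ⊛ g ≐ g ⊛ f
  odd-comm  : ∀ {f} → Odd f → ∀ g → f ⊛ g ≐ σ g ⊛ f

  even-comm {f} e g []      = A.*-comm _ _
  even-comm {f} e g (x ∷ L) = begin
    (∂ x f ⊛ g) L A.+ (σ f ⊛ ∂ x g) L   ≈⟨ A.+-cong (odd-comm (even-∂ e x) g L) (⊛-cong e (λ _ → A.refl) L) ⟩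
    (σ g ⊛ ∂ x f) L A.+ (f ⊛ ∂ x g) L   ≈⟨ A.+-congˡ (even-comm e (∂ x g) L) ⟩
    (σ g ⊛ ∂ x f) L A.+ (∂ x g ⊛ f) L   ≈⟨ A.+-comm _ _ ⟩
    (∂ x g ⊛ f) L A.+ (σ g ⊛ ∂ x f) L   ∎

  odd-comm {f} o g []      = A.*-comm _ _
  odd-comm {f} o g (x ∷ L) = begin
    (∂ x f ⊛ g) L A.+ (σ f ⊛ ∂ x g) L
      ≈⟨ A.+-cong (even-comm (odd-∂ o x) g L) (⊛-cong o (λ _ → A.refl) L) ⟩
    (g ⊛ ∂ x f) L A.+ ((⊟ f) ⊛ ∂ x g) L
      ≈⟨ A.+-congˡ (⊟-⊛ f (∂ x g) L) ⟩
    (g ⊛ ∂ x f) L A.+ A.- (f ⊛ ∂ x g) L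
      ≈⟨ A.+-congˡ (A.-‿cong (odd-comm o (∂ x g) L)) ⟩
    (g ⊛ ∂ x f) L A.+ A.- (σ (∂ x g) ⊛ f) L
      ≈⟨ A.+-comm _ _ ⟩
    A.- (σ (∂ x g) ⊛ f) L A.+ (g ⊛ ∂ x f) L
      ≈⟨ A.+-cong (⊟-⊛ (σ (∂ x g)) f L) (⊛-cong (σ-involutive g) (λ _ → A.refl) L) ⟨
    ((⊟ σ (∂ x g)) ⊛ f) L A.+ (σ (σ g) ⊛ ∂ x f) L ∎

  odd-anticomm : ∀ {f g} → Odd f → Odd g → f ⊛ g ≐ ⊟ (g ⊛ f)
  odd-anticomm {f} {g} o o′ = S.trans (odd-comm o g) (S.trans (S.*-congʳ {f} o′) (⊟-⊛ g f))

  even-⊛-even : ∀ {f g} → Even f → Even g → Even (f ⊛ g)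
  even-⊛-even {f} {g} p q = S.trans (σ-⊛ f g) (⊛-cong p q)

  odd-⊛-odd : ∀ {f g} → Odd f → Odd g → Even (f ⊛ g)
  odd-⊛-odd {f} {g} p q = S.trans (σ-⊛ f g) (S.trans (⊛-cong p q) (RingLemmas.neg-*-neg ring f g))

  even-⊛-odd : ∀ {f g} → Even f → Odd g → Odd (f ⊛ g)
  even-⊛-odd {f} {g} p q = S.trans (σ-⊛ f g) (S.trans (⊛-cong p q) (⊛-⊟ f g))

  odd-⊛-even : ∀ {f g} → Odd f → Even g → Odd (f ⊛ g)
  odd-⊛-even {f} {g} p q = S.trans (σ-⊛ f g) (S.trans (⊛-cong p q) (⊟-⊛ f g))

  even-⊞ : ∀ {f g} → Even f → Even g → Even (f ⊞ g)
  even-⊞ {f} {g} p q = S.trans (σ-⊞ f g) (S.+-cong p q)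

  odd-⊞ : ∀ {f g} → Odd f → Odd g → Odd (f ⊞ g)
  odd-⊞ {f} {g} p q = S.trans (σ-⊞ f g) (S.trans (S.+-cong p q) (λ L → -‿+-comm _ _))

  even-const : ∀ c → Even (const c)
  even-const = σ-const

  even-𝟘 : Even 𝟘
  even-𝟘 = σ-𝟘

  odd-𝟘 : Odd 𝟘
  odd-𝟘 L = A.trans (σ-𝟘 L) (A.sym -0#≈0#)

  odd-single : ∀ c → Odd (single c)
  odd-single = σ-single

-- Matrices of series and the generic matrix.

module MatrixShuffle {a ℓ} (A : Ring a ℓ) {v} (V : Set v) (n : ℕ) where
  private module A = Ring A
  open Shuffle A V
  private module S = Ring ring
  open SemiringSum S.semiring using (sum; ∑-distrib-+)
  private module M = Ring (matrixRing n ring)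

  Mat : Set (a ⊔ v)
  Mat = Matrix n ring

  ∂ₘ : V → Mat → Mat
  ∂ₘ x M i j = ∂ x (M i j)

  σₘ : Mat → Mat
  σₘ M i j = σ (M i j)

  ∂-sum : ∀ x {m} (f : Vector Series m) → ∂ x (sum f) ≐ sum (λ i → ∂ x (f i))
  ∂-sum x {zero}  f L = A.refl
  ∂-sum x {suc m} f L = A.+-congˡ (∂-sum x (λ i → f (suc i)) L)

  ∂ₘ-* : ∀ x M N → ∂ₘ x (M M.* N) M.≈ (∂ₘ x M M.* N) M.+ (σₘ M M.* ∂ₘ x N)
  ∂ₘ-* x M N i j = S.trans (∂-sum x (λ k → M i k ⊛ N k j))
                           (∑-distrib-+ (λ k → ∂ x (M i k) ⊛ N k j) (λ k → σ (M i k) ⊛ ∂ x (N k j)))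

  ∂ₘ-cong : ∀ x {M N} → M M.≈ N → ∂ₘ x M M.≈ ∂ₘ x N
  ∂ₘ-cong x p i j L = p i j (x ∷ L)

  constₘ : Matrix n A → Mat
  constₘ c i j = const (c i j)

  module Generic (val : V → Matrix n A) where

    X : Mat
    X i j = single (λ x → val x i j)

    σₘ-X : σₘ X M.≈ M.- X
    σₘ-X i j = σ-single (λ x → val x i j)

    C : V → Mat
    C x = constₘ (val x)

    open SkewDerivations (matrixRing n ring) X ∂ₘ C

    ∂ₘ-1 : ∀ x → ∂ₘ x M.1# M.≈ M.0#
    ∂ₘ-1 x i j L with i ≟ j
    ... | yes _ = A.refl
    ... | no _  = A.refl

    laws : Laws
    laws = record
      { ∂-cong = ∂ₘ-cong
      ; ∂-+    = λ x f g → M.refl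
      ; ∂-1    = ∂ₘ-1
      ; ∂-X*   = λ x f → M.trans (∂ₘ-* x X f)
                   (M.+-congˡ (M.trans (M.*-congʳ σₘ-X) (RingLemmas.neg-* (matrixRing n ring) X (∂ₘ x f))))
      ; ∂-C*   = λ x y f → M.trans (∂ₘ-* x (C y) f)
                   (M.trans (M.+-cong (M.zeroˡ f) (M.*-congʳ (λ i j → σ-const (val y i j)))) (M.+-identityˡ _))
      }

-- Annihilation by products of anticommuting elements.

module Annihilation {a ℓ} (B : Ring a ℓ) {m : ℕ} (ψ : Fin m → Ring.Carrier B) where
  open Ring B hiding (zero)
  open RingProperties B
  open RingLemmas B
  open SemiringSum semiring using (sum)
  open import Relation.Binary.Reasoning.Setoid setoid

  -- A substitute for degree that involves no basis: when the ψ's anticommute and square to zero,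
  -- every product of more than m - d of them has this property.
  Kill : ℕ → Carrier → Set ℓ
  Kill zero    x = x ≈ 0#
  Kill (suc d) x = ∀ i → Kill d (ψ i * x)

  kill-cong : ∀ d {x y} → x ≈ y → Kill d x → Kill d y
  kill-cong zero    e p   = trans (sym e) p
  kill-cong (suc d) e p i = kill-cong d (*-congˡ e) (p i)

  kill-0 : ∀ d → Kill d 0#
  kill-0 zero      = refl
  kill-0 (suc d) i = kill-cong d (sym (zeroʳ (ψ i))) (kill-0 d)

  kill-+ : ∀ d {x y} → Kill d x → Kill d y → Kill d (x + y)
  kill-+ zero    p q   = trans (+-cong p q) (+-identityˡ 0#)
  kill-+ (suc d) p q i = kill-cong d (sym (distribˡ _ _ _)) (kill-+ d (p i) (q i))

  kill-neg : ∀ d {x} → Kill d x → Kill d (- x)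
  kill-neg zero    p   = trans (-‿cong p) -0#≈0#
  kill-neg (suc d) p i = kill-cong d (-‿distribʳ-* _ _) (kill-neg d (p i))

  kill-sum : ∀ d {k} (f : Vector Carrier k) → (∀ i → Kill d (f i)) → Kill d (sum f)
  kill-sum d {zero}  f p = kill-0 d
  kill-sum d {suc k} f p = kill-+ d (p zero) (kill-sum d (λ i → f (suc i)) (λ i → p (suc i)))

  kill-commuting : ∀ {c} → (∀ i → ψ i * c ≈ c * ψ i) → ∀ d {x} → Kill d x → Kill d (c * x)
  kill-commuting {c} h zero        p   = trans (*-congˡ p) (zeroʳ c)
  kill-commuting {c} h (suc d) {x} p i = kill-cong d (begin
    c * (ψ i * x)   ≈⟨ *-assoc _ _ _ ⟨
    (c * ψ i) * x   ≈⟨ *-congʳ (h i) ⟨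
    (ψ i * c) * x   ≈⟨ *-assoc _ _ _ ⟩
    ψ i * (c * x)   ∎) (kill-commuting h d (p i))

  kill-anticommuting : ∀ {c} → (∀ i → ψ i * c ≈ - (c * ψ i)) → ∀ d {x} → Kill d x → Kill d (c * x)
  kill-anticommuting {c} h zero        p   = trans (*-congˡ p) (zeroʳ c)
  kill-anticommuting {c} h (suc d) {x} p i = kill-cong d (begin
    - (c * (ψ i * x))   ≈⟨ -‿cong (*-assoc _ _ _) ⟨
    - ((c * ψ i) * x)   ≈⟨ -‿distribˡ-* _ _ ⟩
    - (c * ψ i) * x     ≈⟨ *-congʳ (h i) ⟨
    (ψ i * c) * x       ≈⟨ *-assoc _ _ _ ⟩
    ψ i * (c * x)       ∎) (kill-neg d (kill-anticommuting h d (p i)))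

  module _ (square : ∀ i → ψ i * ψ i ≈ 0#) (anti : ∀ i j → ψ i * ψ j ≈ - (ψ j * ψ i)) where

    multiply : ∀ {d} → (Fin d → Fin m) → Carrier → Carrier
    multiply {zero}  w x = x
    multiply {suc d} w x = multiply (λ i → w (suc i)) (ψ (w zero) * x)

    multiply-cong : ∀ {d} (w : Fin d → Fin m) {x y} → x ≈ y → multiply w x ≈ multiply w y
    multiply-cong {zero}  w e = e
    multiply-cong {suc d} w e = multiply-cong (λ i → w (suc i)) (*-congˡ e)

    multiply-0 : ∀ {d} (w : Fin d → Fin m) → multiply w 0# ≈ 0#
    multiply-0 {zero}  w = refl
    multiply-0 {suc d} w = trans (multiply-cong (λ i → w (suc i)) (zeroʳ _)) (multiply-0 (λ i → w (suc i)))

    multiply-neg : ∀ {d} (w : Fin d → Fin m) x → multiply w (- x) ≈ - multiply w x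
    multiply-neg {zero}  w x = refl
    multiply-neg {suc d} w x = trans (multiply-cong (λ i → w (suc i)) (*-neg _ _)) (multiply-neg (λ i → w (suc i)) _)

    -- Anticommute `ψ k` through the later factors until it meets its second copy.
    multiply-repeatˡ : ∀ {d} (w : Fin d → Fin m) k j x → w j ≡ k → multiply w (ψ k * x) ≈ 0#
    multiply-repeatˡ w k zero x ≡.refl = begin
      multiply w′ (ψ k * (ψ k * x))   ≈⟨ multiply-cong w′ (trans (sym (*-assoc _ _ _)) (trans (*-congʳ (square k)) (zeroˡ x))) ⟩
      multiply w′ 0#                  ≈⟨ multiply-0 w′ ⟩
      0#                              ∎
      where w′ = λ i → w (suc i)
    multiply-repeatˡ w k (suc j) x e = begin
      multiply w′ (ψ l * (ψ k * x))     ≈⟨ multiply-cong w′ (trans (sym (*-assoc _ _ _)) (*-congʳ (anti l k))) ⟩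
      multiply w′ (- (ψ k * ψ l) * x)   ≈⟨ multiply-cong w′ (trans (neg-* _ _) (-‿cong (*-assoc _ _ _))) ⟩
      multiply w′ (- (ψ k * (ψ l * x))) ≈⟨ multiply-neg w′ _ ⟩
      - multiply w′ (ψ k * (ψ l * x))   ≈⟨ -‿cong (multiply-repeatˡ w′ k j (ψ l * x) e) ⟩
      - 0#                              ≈⟨ -0#≈0# ⟩
      0#                                ∎
      where
      w′ = λ i → w (suc i)
      l = w zero

    multiply-repeat : ∀ {d} (w : Fin d → Fin m) i j → i Fin.< j → w i ≡ w j → ∀ x → multiply w x ≈ 0#
    multiply-repeat w zero    (suc j) _         e x = multiply-repeatˡ (λ i → w (suc i)) (w zero) j x (≡.sym e)
    multiply-repeat w (suc i) (suc j) (s≤s i<j) e x = multiply-repeat (λ i → w (suc i)) i j i<j e (ψ (w zero) * x)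

    kill-multiply : ∀ d x → (∀ w → multiply {d} w x ≈ 0#) → Kill d x
    kill-multiply zero    x h   = h (λ ())
    kill-multiply (suc d) x h i = kill-multiply d (ψ i * x) λ w → h (λ { zero → i ; (suc j) → w j })

    kill-many : ∀ d x → m ℕ.< d → Kill d x
    kill-many d x m<d = kill-multiply d x λ w →
      let (i , j , i<j , e) = pigeonhole m<d w in multiply-repeat w i j i<j e x

-- Nilpotency from vanishing traces, by contraction in an exterior algebra.

-- The edges carry the generic matrix, psi spans the exterior algebra of the nilpotency argument,
-- and eps, eps′ are infinitesimals used to differentiate.
data Letter (U : Set) (n : ℕ) : Set where
  edge     : U → Letter U n
  psi      : Fin n → Letter U n
  eps eps′ : Letter U n

ℤ-ring : CommutativeRing 0ℓ 0ℓ
ℤ-ring = ℤₚ.+-*-commutativeRing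

module TraceNilpotency (U : Set) (n : ℕ) where
  private module Z = CommutativeRing ℤ-ring
  open Shuffle Z.ring (Letter U n)
  open SuperCommutative ℤ-ring (Letter U n)
  open MatrixShuffle Z.ring (Letter U n) n using (Mat; ∂ₘ; σₘ; ∂ₘ-*)
  private
    module S = Ring ring
    module M = Ring (matrixRing n ring)
  open SemiringSum S.semiring using (sum; sum-cong-≋; ∑-distrib-+; *-distribˡ-sum; *-distribʳ-sum; sum-replicate-zero)
  open SemiringExp M.semiring using (_^_; ^-homo-*)
  open RingProperties ring using (-0#≈0#; -‿+-comm; -‿involutive)
  open import Relation.Binary.Reasoning.Setoid S.setoid

  ∂ψ : Fin n → Series → Series
  ∂ψ k = ∂ (psi k)

  coefficient : Fin n → Letter U n → ℤ
  coefficient l (psi k) = identityMatrix n Z.ring l k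
  coefficient l _       = + 0

  ψ : Fin n → Series
  ψ l = single (coefficient l)

  odd-ψ : ∀ l → Odd (ψ l)
  odd-ψ l = odd-single (coefficient l)

  ψ-square : ∀ l → ψ l ⊛ ψ l ≐ 𝟘
  ψ-square l L = i≡-i⇒i≡0 (odd-anticomm {ψ l} {ψ l} (odd-ψ l) (odd-ψ l) L)
    where
    i≡-i⇒i≡0 : ∀ {i} → i ≡ ℤ.- i → i ≡ + 0
    i≡-i⇒i≡0 {+ zero} _ = ≡.refl

  open Annihilation ring ψ

  Evenₘ Oddₘ : Mat → Set
  Evenₘ M = ∀ i j → Even (M i j)
  Oddₘ  M = ∀ i j → Odd (M i j)

  Constₘ : Letter U n → Mat → Set
  Constₘ x M = ∂ₘ x M M.≈ M.0#

  even-sum : ∀ {m} (f : Vector Series m) → (∀ i → Even (f i)) → Even (sum f)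
  even-sum {zero}  f p = even-𝟘
  even-sum {suc m} f p = even-⊞ {f zero} {sum (λ i → f (suc i))} (p zero) (even-sum (λ i → f (suc i)) (λ i → p (suc i)))

  odd-sum : ∀ {m} (f : Vector Series m) → (∀ i → Odd (f i)) → Odd (sum f)
  odd-sum {zero}  f p = odd-𝟘
  odd-sum {suc m} f p = odd-⊞ {f zero} {sum (λ i → f (suc i))} (p zero) (odd-sum (λ i → f (suc i)) (λ i → p (suc i)))

  evenₘ-1 : Evenₘ M.1#
  evenₘ-1 i j with i ≟ j
  ... | yes _ = even-const (+ 1)
  ... | no _  = even-𝟘

  evenₘ-even : ∀ {M N} → Evenₘ M → Evenₘ N → Evenₘ (M M.* N)
  evenₘ-even {M} {N} p q i j = even-sum (λ k → M i k ⊛ N k j) (λ k → even-⊛-even {M i k} {N k j} (p i k) (q k j))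

  evenₘ-odd : ∀ {M N} → Evenₘ M → Oddₘ N → Oddₘ (M M.* N)
  evenₘ-odd {M} {N} p q i j = odd-sum (λ k → M i k ⊛ N k j) (λ k → even-⊛-odd {M i k} {N k j} (p i k) (q k j))

  oddₘ-even : ∀ {M N} → Oddₘ M → Evenₘ N → Oddₘ (M M.* N)
  oddₘ-even {M} {N} p q i j = odd-sum (λ k → M i k ⊛ N k j) (λ k → odd-⊛-even {M i k} {N k j} (p i k) (q k j))

  oddₘ-odd : ∀ {M N} → Oddₘ M → Oddₘ N → Evenₘ (M M.* N)
  oddₘ-odd {M} {N} p q i j = even-sum (λ k → M i k ⊛ N k j) (λ k → odd-⊛-odd {M i k} {N k j} (p i k) (q k j))

  evenₘ-^ : ∀ {M} → Evenₘ M → ∀ p → Evenₘ (M ^ p)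
  evenₘ-^     e zero    = evenₘ-1
  evenₘ-^ {M} e (suc p) = evenₘ-even {M} {M ^ p} e (evenₘ-^ e p)

  constₘ-1 : ∀ x → Constₘ x M.1#
  constₘ-1 x i j L with i ≟ j
  ... | yes _ = ≡.refl
  ... | no _  = ≡.refl

  constₘ-* : ∀ x {M N} → Constₘ x M → Constₘ x N → Constₘ x (M M.* N)
  constₘ-* x {M} {N} p q = M.trans (∂ₘ-* x M N)
    (M.trans (M.+-cong (M.trans (M.*-congʳ p) (M.zeroˡ N)) (M.trans (M.*-congˡ {σₘ M} q) (M.zeroʳ (σₘ M)))) (M.+-identityˡ M.0#))

  constₘ-^ : ∀ x {M} → Constₘ x M → ∀ p → Constₘ x (M ^ p)
  constₘ-^ x     c zero    = constₘ-1 x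
  constₘ-^ x {M} c (suc p) = constₘ-* x {M} {M ^ p} c (constₘ-^ x c p)

  trace : Mat → Series
  trace M = sum (λ k → M k k)

  sum-neg : ∀ {m} (f : Vector Series m) → sum (λ i → ⊟ f i) ≐ ⊟ sum f
  sum-neg {zero}  f = S.sym -0#≈0#
  sum-neg {suc m} f = S.trans (S.+-congˡ {⊟ f zero} (sum-neg (λ i → f (suc i)))) (-‿+-comm (f zero) _)

  infixr 7 _⊙_
  _⊙_ : ℤ → Series → Series
  (c ⊙ f) L = c ℤ.* f L

  ⊙-torsionFree : ∀ {c} → c ≢ + 0 → ∀ {f} → c ⊙ f ≐ 𝟘 → f ≐ 𝟘
  ⊙-torsionFree {c} c≢0 p L with ℤₚ.i*j≡0⇒i≡0∨j≡0 c (p L)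
  ... | inj₁ c≡0 = contradiction c≡0 c≢0
  ... | inj₂ e   = e

  module _ (A : Mat) (evenA : Evenₘ A) (constA : ∀ k → Constₘ (psi k) A)
           (traceA : ∀ p → trace (A ^ suc p) ≐ 𝟘) (o : Fin n) where

    -- Every column is the vector of the `ψ l`, so that A^p ψ can be computed as a column of a
    -- product of square matrices.
    Ψ : Mat
    Ψ l _ = ψ l

    ρ : ℕ → Fin n → Series
    ρ p k = (A ^ p M.* Ψ) k o

    odd-ρ : ∀ p k → Odd (ρ p k)
    odd-ρ p k = evenₘ-odd {A ^ p} {Ψ} (evenₘ-^ evenA p) (λ l _ → odd-ψ l) k o

    ρ-+ : ∀ q p l → sum (λ k → (A ^ q) l k ⊛ ρ p k) ≐ ρ (q ℕ.+ p) l
    ρ-+ q p l = S.sym (M.trans (M.*-congʳ (^-homo-* A q p)) (M.*-assoc (A ^ q) (A ^ p) Ψ) l o)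

    ∂-ρ : ∀ k p l → ∂ψ k (ρ p l) ≐ (A ^ p) l k
    ∂-ρ k p l = begin
      ∂ψ k (ρ p l)
        ≈⟨ ∂ₘ-* (psi k) (A ^ p) Ψ l o ⟩
      (∂ₘ (psi k) (A ^ p) M.* Ψ) l o ⊞ (σₘ (A ^ p) M.* ∂ₘ (psi k) Ψ) l o
        ≈⟨ S.+-cong (M.trans (M.*-congʳ (constₘ-^ (psi k) (constA k) p)) (M.zeroˡ Ψ) l o)
                    (sum-cong-≋ (λ m → S.*-cong (evenₘ-^ evenA p l m) (const-δ m))) ⟩
      𝟘 ⊞ (A ^ p M.* M.1#) l k
        ≈⟨ S.+-identityˡ _ ⟩
      (A ^ p M.* M.1#) l k
        ≈⟨ M.*-identityʳ (A ^ p) l k ⟩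
      (A ^ p) l k ∎
      where
      const-δ : ∀ m → const (identityMatrix n Z.ring m k) ≐ M.1# m k
      const-δ m with m ≟ k
      ... | yes _ = λ _ → ≡.refl
      ... | no _  = λ { [] → ≡.refl ; (_ ∷ _) → ≡.refl }

    -- The derivation of the exterior algebra that extends ψ ↦ A^p ψ. It is composed of two odd
    -- operations, so its Leibniz rule carries no signs.
    J : ℕ → Series → Series
    J p f = sum (λ k → ρ p k ⊛ ∂ψ k f)

    J-1 : ∀ p → J p S.1# ≐ 𝟘
    J-1 p = S.trans (sum-cong-≋ (λ k → S.zeroʳ (ρ p k))) (sum-replicate-zero n)

    ∂-ρ⊛ : ∀ k p l f → ∂ψ k (ρ p l ⊛ f) ≐ (A ^ p) l k ⊛ f ⊞ ⊟ (ρ p l ⊛ ∂ψ k f)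
    ∂-ρ⊛ k p l f = S.+-cong (S.*-congʳ {f} (∂-ρ k p l)) (S.trans (S.*-congʳ {∂ψ k f} (odd-ρ p l)) (⊟-⊛ (ρ p l) (∂ψ k f)))

    -- The terms where `∂ψ k` hits its own form add up to tr A^(p+1) times f, which is zero. In the
    -- other terms it passes the odd form and reaches f, hence the minus sign.
    contraction : ∀ p f → sum (λ k → ∂ψ k (ρ (suc p) k ⊛ f)) ≐ ⊟ J (suc p) f
    contraction p f = begin
      sum (λ k → ∂ψ k (ρ (suc p) k ⊛ f))
        ≈⟨ sum-cong-≋ (λ k → ∂-ρ⊛ k (suc p) k f) ⟩
      sum (λ k → (A ^ suc p) k k ⊛ f ⊞ ⊟ (ρ (suc p) k ⊛ ∂ψ k f))
        ≈⟨ ∑-distrib-+ (λ k → (A ^ suc p) k k ⊛ f) (λ k → ⊟ (ρ (suc p) k ⊛ ∂ψ k f)) ⟩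
      sum (λ k → (A ^ suc p) k k ⊛ f) ⊞ sum (λ k → ⊟ (ρ (suc p) k ⊛ ∂ψ k f))
        ≈⟨ S.+-cong (S.trans (S.sym (*-distribʳ-sum f (λ k → (A ^ suc p) k k))) (S.trans (S.*-congʳ {f} (traceA p)) (S.zeroˡ f)))
                    (sum-neg (λ k → ρ (suc p) k ⊛ ∂ψ k f)) ⟩
      𝟘 ⊞ ⊟ J (suc p) f
        ≈⟨ S.+-identityˡ _ ⟩
      ⊟ J (suc p) f ∎

    J-ρ⊛ : ∀ p q l f → J p (ρ q l ⊛ f) ≐ ρ (q ℕ.+ p) l ⊛ f ⊞ ρ q l ⊛ J p f
    J-ρ⊛ p q l f = begin
      sum (λ k → ρ p k ⊛ ∂ψ k (ρ q l ⊛ f))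
        ≈⟨ sum-cong-≋ step ⟩
      sum (λ k → ((A ^ q) l k ⊛ ρ p k) ⊛ f ⊞ ρ q l ⊛ (ρ p k ⊛ ∂ψ k f))
        ≈⟨ ∑-distrib-+ (λ k → ((A ^ q) l k ⊛ ρ p k) ⊛ f) (λ k → ρ q l ⊛ (ρ p k ⊛ ∂ψ k f)) ⟩
      sum (λ k → ((A ^ q) l k ⊛ ρ p k) ⊛ f) ⊞ sum (λ k → ρ q l ⊛ (ρ p k ⊛ ∂ψ k f))
        ≈⟨ S.+-cong (*-distribʳ-sum f (λ k → (A ^ q) l k ⊛ ρ p k)) (*-distribˡ-sum (ρ q l) (λ k → ρ p k ⊛ ∂ψ k f)) ⟨
      sum (λ k → (A ^ q) l k ⊛ ρ p k) ⊛ f ⊞ ρ q l ⊛ J p f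
        ≈⟨ S.+-congʳ {ρ q l ⊛ J p f} (S.*-congʳ {f} (ρ-+ q p l)) ⟩
      ρ (q ℕ.+ p) l ⊛ f ⊞ ρ q l ⊛ J p f ∎
      where
      step : ∀ k → ρ p k ⊛ ∂ψ k (ρ q l ⊛ f) ≐ ((A ^ q) l k ⊛ ρ p k) ⊛ f ⊞ ρ q l ⊛ (ρ p k ⊛ ∂ψ k f)
      step k = begin
        r ⊛ ∂ψ k (ρ q l ⊛ f)
          ≈⟨ S.*-congˡ {r} (∂-ρ⊛ k q l f) ⟩
        r ⊛ (e ⊛ f ⊞ ⊟ (ρ q l ⊛ ∂ψ k f))
          ≈⟨ ⊛-distribˡ r (e ⊛ f) (⊟ (ρ q l ⊛ ∂ψ k f)) ⟩
        r ⊛ (e ⊛ f) ⊞ r ⊛ (⊟ (ρ q l ⊛ ∂ψ k f))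
          ≈⟨ S.+-cong (S.trans (S.sym (⊛-assoc r e f)) (S.*-congʳ {f} (S.sym (even-comm {e} (evenₘ-^ evenA q l k) r))))
                      (S.trans (⊛-⊟ r (ρ q l ⊛ ∂ψ k f)) (S.-‿cong (S.sym (⊛-assoc r (ρ q l) (∂ψ k f))))) ⟩
        (e ⊛ r) ⊛ f ⊞ ⊟ ((r ⊛ ρ q l) ⊛ ∂ψ k f)
          ≈⟨ S.+-congˡ {(e ⊛ r) ⊛ f} (S.trans (S.sym (⊟-⊛ (r ⊛ ρ q l) (∂ψ k f)))
               (S.*-congʳ {∂ψ k f} (S.trans (S.-‿cong (odd-anticomm {r} {ρ q l} (odd-ρ p k) (odd-ρ q l))) (-‿involutive (ρ q l ⊛ r))))) ⟩
        (e ⊛ r) ⊛ f ⊞ (ρ q l ⊛ r) ⊛ ∂ψ k f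
          ≈⟨ S.+-congˡ {(e ⊛ r) ⊛ f} (⊛-assoc (ρ q l) r (∂ψ k f)) ⟩
        (e ⊛ r) ⊛ f ⊞ ρ q l ⊛ (r ⊛ ∂ψ k f) ∎
        where
        r = ρ p k
        e = (A ^ q) l k

    J-ρ : ∀ p q l → J p (ρ q l) ≐ ρ (q ℕ.+ p) l
    J-ρ p q l = begin
      J p (ρ q l)
        ≈⟨ sum-cong-≋ (λ k → S.*-congˡ {ρ p k} (λ L → S.*-identityʳ (ρ q l) (psi k ∷ L))) ⟨
      J p (ρ q l ⊛ S.1#)
        ≈⟨ J-ρ⊛ p q l S.1# ⟩
      ρ (q ℕ.+ p) l ⊛ S.1# ⊞ ρ q l ⊛ J p S.1#
        ≈⟨ S.+-cong (S.*-identityʳ (ρ (q ℕ.+ p) l)) (S.trans (S.*-congˡ {ρ q l} (J-1 p)) (S.zeroʳ (ρ q l))) ⟩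
      ρ (q ℕ.+ p) l ⊞ 𝟘
        ≈⟨ S.+-identityʳ _ ⟩
      ρ (q ℕ.+ p) l ∎

    -- E (p₁ ∷ … ∷ pₘ) L f = ∑ ∂ₖₘ ⋯ ∂ₖ₁ L (ρ^{p₁+1}ₖ₁ ⋯ ρ^{pₘ+1}ₖₘ f), summed over all k₁, …, kₘ.
    E : List ℕ → (Series → Series) → Series → Series
    E []       L f = L f
    E (p ∷ ps) L f = sum (λ k → E ps (λ g → ∂ψ k (L (ρ (suc p) k ⊛ g))) f)

    E-cong : ∀ ps {L L′} f → (∀ g → L g ≐ L′ g) → E ps L f ≐ E ps L′ f
    E-cong []       f h = h f
    E-cong (p ∷ ps) f h = sum-cong-≋ (λ k → E-cong ps f (λ g M → h (ρ (suc p) k ⊛ g) (psi k ∷ M)))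

    E-congʳ : ∀ ps {L} {f f′} → (∀ {g h} → g ≐ h → L g ≐ L h) → f ≐ f′ → E ps L f ≐ E ps L f′
    E-congʳ []       h e = h e
    E-congʳ (p ∷ ps) h e = sum-cong-≋ (λ k → E-congʳ ps (λ {g} {g′} d M → h (S.*-congˡ {ρ (suc p) k} {g} {g′} d) (psi k ∷ M)) e)

    E-+ : ∀ ps L L′ f → E ps (λ g → L g ⊞ L′ g) f ≐ E ps L f ⊞ E ps L′ f
    E-+ []       L L′ f = S.refl
    E-+ (p ∷ ps) L L′ f = S.trans
      (sum-cong-≋ (λ k → E-+ ps (λ g → ∂ψ k (L (ρ (suc p) k ⊛ g))) (λ g → ∂ψ k (L′ (ρ (suc p) k ⊛ g))) f))
      (∑-distrib-+ (λ k → E ps (λ g → ∂ψ k (L (ρ (suc p) k ⊛ g))) f) _)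

    E-0 : ∀ ps f → E ps (λ _ → 𝟘) f ≐ 𝟘
    E-0 []       f = S.refl
    E-0 (p ∷ ps) f = S.trans (sum-cong-≋ {n} (λ _ → E-0 ps f)) (sum-replicate-zero n)

    E-neg : ∀ ps L f → E ps (λ g → ⊟ L g) f ≐ ⊟ E ps L f
    E-neg []       L f = S.refl
    E-neg (p ∷ ps) L f = S.trans (sum-cong-≋ (λ k → E-neg ps (λ g → ∂ψ k (L (ρ (suc p) k ⊛ g))) f))
                                 (sum-neg (λ k → E ps (λ g → ∂ψ k (L (ρ (suc p) k ⊛ g))) f))

    E-sum : ∀ ps {m} (L : Fin m → Series → Series) f → sum (λ k → E ps (L k) f) ≐ E ps (λ g → sum (λ k → L k g)) f
    E-sum ps {zero}  L f = S.sym (E-0 ps f)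
    E-sum ps {suc m} L f = S.trans (S.+-congˡ {E ps (L zero) f} (E-sum ps (λ k → L (suc k)) f))
                                   (S.sym (E-+ ps (L zero) (λ g → sum (λ k → L (suc k) g)) f))

    -- The Leibniz rule on a product of forms: the derivation raises one exponent at a time. An
    -- entry q encodes the exponent q + 1, so adding the exponent p + 1 gives the entry q + p + 1.
    bumps : ℕ → List ℕ → List (List ℕ)
    bumps p []       = []
    bumps p (q ∷ ps) = ((q ℕ.+ suc p) ∷ ps) ∷ map (q ∷_) (bumps p ps)

    sumList : (List ℕ → Series) → List (List ℕ) → Series
    sumList F = foldr (λ ps s → F ps ⊞ s) 𝟘

    sumList-map : ∀ (F : List ℕ → Series) q pss → sumList F (map (q ∷_) pss) ≐ sumList (λ ps → F (q ∷ ps)) pss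
    sumList-map F q []         = S.refl
    sumList-map F q (ps ∷ pss) = S.+-congˡ {F (q ∷ ps)} (sumList-map F q pss)

    sumList-sum : ∀ {m} (F : Fin m → List ℕ → Series) pss →
                  sum (λ k → sumList (F k) pss) ≐ sumList (λ ps → sum (λ k → F k ps)) pss
    sumList-sum {m} F []         = sum-replicate-zero m
    sumList-sum     F (ps ∷ pss) = S.trans (∑-distrib-+ (λ k → F k ps) (λ k → sumList (F k) pss))
                                           (S.+-congˡ {sum (λ k → F k ps)} (sumList-sum F pss))

    record Additive (L : Series → Series) : Set where
      field
        cong : ∀ {g h} → g ≐ h → L g ≐ L h
        plus : ∀ g h → L (g ⊞ h) ≐ L g ⊞ L h

    -- The derivation is moved to the right past all forms until it acts on f. Additivity of `L`
    -- allows the Leibniz rule to be split underneath it.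
    E-J : ∀ ps L → Additive L → ∀ p f →
          E ps (λ g → L (J (suc p) g)) f ≐ sumList (λ ps′ → E ps′ L f) (bumps p ps) ⊞ E ps L (J (suc p) f)
    E-J []       L add p f = S.sym (S.+-identityˡ (L (J (suc p) f)))
    E-J (q ∷ ps) L add p f = begin
      sum (λ k → E ps (λ g → ∂ψ k (L (J (suc p) (ρ (suc q) k ⊛ g)))) f)
        ≈⟨ sum-cong-≋ (λ k → S.trans (E-cong ps f (split k)) (E-+ ps (L₁ k) (λ g → L₂ k (J (suc p) g)) f)) ⟩
      sum (λ k → E ps (L₁ k) f ⊞ E ps (λ g → L₂ k (J (suc p) g)) f)
        ≈⟨ ∑-distrib-+ (λ k → E ps (L₁ k) f) (λ k → E ps (λ g → L₂ k (J (suc p) g)) f) ⟩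
      sum (λ k → E ps (L₁ k) f) ⊞ sum (λ k → E ps (λ g → L₂ k (J (suc p) g)) f)
        ≈⟨ S.+-congˡ {sum (λ k → E ps (L₁ k) f)} (S.trans (sum-cong-≋ (λ k → E-J ps (L₂ k) (additive k) p f))
             (∑-distrib-+ (λ k → sumList (λ ps′ → E ps′ (L₂ k) f) (bumps p ps)) (λ k → E ps (L₂ k) (J (suc p) f)))) ⟩
      sum (λ k → E ps (L₁ k) f) ⊞ (sum (λ k → sumList (λ ps′ → E ps′ (L₂ k) f) (bumps p ps)) ⊞ E (q ∷ ps) L (J (suc p) f))
        ≈⟨ S.+-congˡ {sum (λ k → E ps (L₁ k) f)} (S.+-congʳ {E (q ∷ ps) L (J (suc p) f)}
             (S.trans (sumList-sum (λ k ps′ → E ps′ (L₂ k) f) (bumps p ps)) (S.sym (sumList-map (λ ps′ → E ps′ L f) q (bumps p ps))))) ⟩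
      E ((q ℕ.+ suc p) ∷ ps) L f ⊞ (sumList (λ ps′ → E ps′ L f) (map (q ∷_) (bumps p ps)) ⊞ E (q ∷ ps) L (J (suc p) f))
        ≈⟨ S.+-assoc (E ((q ℕ.+ suc p) ∷ ps) L f) _ _ ⟨
      E ((q ℕ.+ suc p) ∷ ps) L f ⊞ sumList (λ ps′ → E ps′ L f) (map (q ∷_) (bumps p ps)) ⊞ E (q ∷ ps) L (J (suc p) f) ∎
      where
      open Additive add
      L₁ L₂ : Fin n → Series → Series
      L₁ k g = ∂ψ k (L (ρ (suc (q ℕ.+ suc p)) k ⊛ g))
      L₂ k g = ∂ψ k (L (ρ (suc q) k ⊛ g))
      split : ∀ k g → ∂ψ k (L (J (suc p) (ρ (suc q) k ⊛ g))) ≐ L₁ k g ⊞ L₂ k (J (suc p) g)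
      split k g M = S.trans (cong (J-ρ⊛ (suc p) (suc q) k g)) (plus (ρ (suc (q ℕ.+ suc p)) k ⊛ g) (ρ (suc q) k ⊛ J (suc p) g)) (psi k ∷ M)
      additive : ∀ k → Additive (L₂ k)
      additive k .Additive.cong {g} {h} e M = cong (S.*-congˡ {ρ (suc q) k} {g} {h} e) (psi k ∷ M)
      additive k .Additive.plus g h M = S.trans (cong (⊛-distribˡ (ρ (suc q) k) g h)) (plus (ρ (suc q) k ⊛ g) (ρ (suc q) k ⊛ h)) (psi k ∷ M)

    total : List ℕ → ℕ
    total []       = 0
    total (p ∷ ps) = suc p ℕ.+ total ps

    bumps-total : ∀ p ps → All (λ ps′ → length ps′ ≡ length ps × total ps′ ≡ total (p ∷ ps)) (bumps p ps)
    bumps-total p []       = []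
    bumps-total p (q ∷ ps) =
      (≡.refl , swap (total ps)) ∷
      Allₚ.map⁺ (All.map (λ (len , tot) → ≡.cong suc len , ≡.trans (≡.cong (suc q ℕ.+_) tot) (exchange (total ps)))
                         (bumps-total p ps))
      where
      swap : ∀ t → suc (q ℕ.+ suc p) ℕ.+ t ≡ suc p ℕ.+ (suc q ℕ.+ t)
      swap t = ≡.trans (≡.cong (ℕ._+ t) (ℕₚ.+-comm (suc q) (suc p))) (ℕₚ.+-assoc (suc p) (suc q) t)
      exchange : ∀ t → suc q ℕ.+ (suc p ℕ.+ t) ≡ suc p ℕ.+ (suc q ℕ.+ t)
      exchange t = ≡.trans (≡.sym (ℕₚ.+-assoc (suc q) (suc p) t)) (swap t)

    bumps-length : ∀ p ps → length (bumps p ps) ≡ length ps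
    bumps-length p []       = ≡.refl
    bumps-length p (q ∷ ps) = ≡.cong suc (≡.trans (Listₚ.length-map (q ∷_) (bumps p ps)) (bumps-length p ps))

    sumList-const : ∀ {F} v pss → All (λ ps → F ps ≐ v) pss → sumList F pss ≐ (+ length pss) ⊙ v
    sumList-const v []         []       L = ≡.sym (ℤₚ.*-zeroˡ (v L))
    sumList-const v (ps ∷ pss) (e ∷ es) L =
      ≡.trans (≡.cong₂ ℤ._+_ (e L) (sumList-const v pss es L)) (≡.sym (ℤₚ.suc-* (+ length pss) (v L)))

    -- This is (-1)^m m!.
    factor : ℕ → ℤ
    factor zero    = + 1
    factor (suc m) = ℤ.- ((+ suc m) ℤ.* factor m)

    factor≢0 : ∀ m → factor m ≢ + 0
    factor≢0 (suc m) e with ℤₚ.i*j≡0⇒i≡0∨j≡0 (+ suc m) (≡.trans (≡.sym (ℤₚ.neg-involutive _)) (≡.cong ℤ.-_ e))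
    ... | inj₂ e′ = factor≢0 m e′

    -- Contracting the first form gives minus a derivation, which raises the exponent of one of the
    -- m other forms or of the final one. These m + 1 outcomes have the same sum of exponents, so by
    -- induction they have the same value.
    E-value : ∀ m ps → length ps ≡ m → ∀ q → E ps (λ g → g) (ρ q o) ≐ factor m ⊙ ρ (q ℕ.+ total ps) o
    E-value zero    []       _   q L = ≡.sym (≡.trans (ℤₚ.*-identityˡ _) (≡.cong (λ i → ρ i o L) (ℕₚ.+-identityʳ q)))
    E-value (suc m) (p ∷ ps) len q   = begin
      sum (λ k → E ps (λ g → ∂ψ k (ρ (suc p) k ⊛ g)) f)
        ≈⟨ E-sum ps (λ k g → ∂ψ k (ρ (suc p) k ⊛ g)) f ⟩
      E ps (λ g → sum (λ k → ∂ψ k (ρ (suc p) k ⊛ g))) f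
        ≈⟨ E-cong ps f (contraction p) ⟩
      E ps (λ g → ⊟ J (suc p) g) f
        ≈⟨ E-neg ps (J (suc p)) f ⟩
      ⊟ E ps (J (suc p)) f
        ≈⟨ S.-‿cong (E-J ps (λ g → g) (record { cong = λ e → e ; plus = λ _ _ → S.refl }) p f) ⟩
      ⊟ (sumList (λ ps′ → E ps′ (λ g → g) f) (bumps p ps) ⊞ E ps (λ g → g) (J (suc p) f))
        ≈⟨ S.-‿cong (S.+-cong bumped last) ⟩
      ⊟ ((+ m) ⊙ (factor m ⊙ v) ⊞ factor m ⊙ v)
        ≈⟨ (λ L → collect (v L)) ⟩
      factor (suc m) ⊙ v ∎
      where
      f v : Series
      f = ρ q o
      v = ρ (q ℕ.+ total (p ∷ ps)) o
      len′ : length ps ≡ m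
      len′ = ℕₚ.suc-injective len
      bumped : sumList (λ ps′ → E ps′ (λ g → g) f) (bumps p ps) ≐ (+ m) ⊙ (factor m ⊙ v)
      bumped = ≡.subst (λ l → sumList (λ ps′ → E ps′ (λ g → g) f) (bumps p ps) ≐ (+ l) ⊙ (factor m ⊙ v))
        (≡.trans (bumps-length p ps) len′)
        (sumList-const (factor m ⊙ v) (bumps p ps)
          (All.map (λ {ps′} (l , t) → ≡.subst (λ i → E ps′ (λ g → g) f ≐ factor m ⊙ ρ (q ℕ.+ i) o) t
                                        (E-value m ps′ (≡.trans l len′) q))
                   (bumps-total p ps)))
      last : E ps (λ g → g) (J (suc p) f) ≐ factor m ⊙ v
      last = S.trans (E-congʳ ps (λ e → e) (J-ρ (suc p) q o))
        (≡.subst (λ i → E ps (λ g → g) (ρ (q ℕ.+ suc p) o) ≐ factor m ⊙ ρ i o) (ℕₚ.+-assoc q (suc p) (total ps))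
          (E-value m ps len′ (q ℕ.+ suc p)))
      collect : ∀ i → ℤ.- ((+ m) ℤ.* (factor m ℤ.* i) ℤ.+ factor m ℤ.* i) ≡ factor (suc m) ℤ.* i
      collect i = ≡.trans (≡.cong ℤ.-_ (≡.trans (≡.trans (≡.cong (ℤ._+ factor m ℤ.* i) (≡.sym (ℤₚ.*-assoc (+ m) (factor m) i)))
                                                          (≡.sym (ℤₚ.*-distribʳ-+ i ((+ m) ℤ.* factor m) (factor m))))
                                                (≡.cong (ℤ._* i) (≡.trans (ℤₚ.+-comm _ (factor m)) (≡.sym (ℤₚ.suc-* (+ m) (factor m)))))))
                          (ℤₚ.neg-distribˡ-* ((+ suc m) ℤ.* factor m) i)

    kill-ρ : ∀ d p k {f} → Kill (suc d) f → Kill d (ρ p k ⊛ f)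
    kill-ρ d p k {f} h = kill-cong d
      (S.sym (S.trans (*-distribʳ-sum f (λ l → (A ^ p) k l ⊛ ψ l)) (sum-cong-≋ (λ l → ⊛-assoc ((A ^ p) k l) (ψ l) f))))
      (kill-sum d (λ l → (A ^ p) k l ⊛ (ψ l ⊛ f))
        (λ l → kill-commuting (λ i → S.sym (even-comm {(A ^ p) k l} (evenₘ-^ evenA p k l) (ψ i))) d (h l)))

    E-vanishes : ∀ ps d L f → (∀ {g} → Kill d g → L g ≐ 𝟘) → Kill (length ps ℕ.+ d) f → E ps L f ≐ 𝟘
    E-vanishes []       d L f h p = h p
    E-vanishes (q ∷ ps) d L f h p = S.trans
      (sum-cong-≋ (λ k → E-vanishes ps (suc d) (λ g → ∂ψ k (L (ρ (suc q) k ⊛ g))) f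
        (λ {g} u M → h (kill-ρ d (suc q) k {g} u) (psi k ∷ M))
        (≡.subst (λ i → Kill i f) (≡.sym (ℕₚ.+-suc (length ps) d)) p)))
      (sum-replicate-zero n)

    ones : List ℕ
    ones = replicate n 0

    total-ones : ∀ m → total (replicate m 0) ≡ m
    total-ones zero    = ≡.refl
    total-ones (suc m) = ≡.cong suc (total-ones m)

    -- The n forms and `ρ 0 o` are n + 1 factors linear in n anticommuting variables.
    E-ones : E ones (λ g → g) (ρ 0 o) ≐ 𝟘
    E-ones = E-vanishes ones 0 (λ g → g) (ρ 0 o) (λ e → e)
      (≡.subst (λ i → Kill i (ρ 0 o)) (≡.sym (≡.trans (ℕₚ.+-identityʳ _) (Listₚ.length-replicate n)))
        (kill-cong n (S.*-identityʳ (ρ 0 o))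
          (kill-ρ n 0 o {S.1#} (kill-many ψ-square (λ i j → odd-anticomm {ψ i} {ψ j} (odd-ψ i) (odd-ψ j)) (suc n) S.1# (ℕₚ.n<1+n n)))))

    -- The two evaluations of the same contraction are compared, and (-1)^n n! is cancelled.
    ρ-vanishes : ρ n o ≐ 𝟘
    ρ-vanishes = ⊙-torsionFree (factor≢0 n)
      (S.trans (S.sym (≡.subst (λ i → E ones (λ g → g) (ρ 0 o) ≐ factor n ⊙ ρ i o) (total-ones n)
                               (E-value n ones (Listₚ.length-replicate n) 0)))
               E-ones)

    row-vanishes : ∀ k → (A ^ n) o k ≐ 𝟘
    row-vanishes k = S.trans (S.sym (∂-ρ k n o)) (λ L → ρ-vanishes (psi k ∷ L))

  nilpotent : ∀ A → Evenₘ A → (∀ k → Constₘ (psi k) A) → (∀ p → trace (A ^ suc p) ≐ 𝟘) → A ^ n M.≈ M.0#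
  nilpotent A e c t i j = row-vanishes A e c t i j

-- The generic integer matrix and the linearisations of its nilpotency.

-- n is a variable here, although n = k + 2, so that sums over Fin n do not unfold.
module IntegerMatrices (U : Set) (n k : ℕ) (n≡2+k : n ≡ suc (suc k))
                       (value : U → Matrix n (CommutativeRing.ring ℤ-ring)) where

  K : ℕ
  K = suc k

  module Z = CommutativeRing ℤ-ring
  open Shuffle Z.ring (Letter U n) public
  open SuperCommutative ℤ-ring (Letter U n)
  open MatrixShuffle Z.ring (Letter U n) n public using (Mat; ∂ₘ; σₘ; ∂ₘ-*; ∂ₘ-cong; constₘ; module Generic)
  open TraceNilpotency U n
  module M = Ring (matrixRing n ring)
  private
    module S = Ring ring
    module Mₗ = RingLemmas (matrixRing n ring)
  open SemiringSum S.semiring using (sum; sum-cong-≋; ∑-comm; *-distribˡ-sum)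
  open SemiringExp M.semiring using (_^_)
  open SemiringMult M.semiring using () renaming (_×_ to _×ₙ_)
  open RingProperties (matrixRing n ring) using (-0#≈0#)

  ≡-neg⇒≡0 : ∀ {i} → i ≡ ℤ.- i → i ≡ + 0
  ≡-neg⇒≡0 {+ zero} _ = ≡.refl

  -- The usual interchange of the two sums, where each pair of odd entries contributes a sign.
  trace-swap : ∀ {Y Z} → Oddₘ Y → Oddₘ Z → trace (Y M.* Z) ≐ ⊟ trace (Z M.* Y)
  trace-swap {Y} {Z} oY oZ = begin
    sum (λ i → sum (λ j → Y i j ⊛ Z j i))         ≈⟨ ∑-comm (λ i j → Y i j ⊛ Z j i) ⟩
    sum (λ j → sum (λ i → Y i j ⊛ Z j i))         ≈⟨ sum-cong-≋ (λ j → S.trans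
                                                       (sum-cong-≋ (λ i → odd-anticomm {Y i j} {Z j i} (oY i j) (oZ j i)))
                                                       (sum-neg (λ i → Z j i ⊛ Y i j))) ⟩
    sum (λ j → ⊟ sum (λ i → Z j i ⊛ Y i j))       ≈⟨ sum-neg (λ j → sum (λ i → Z j i ⊛ Y i j)) ⟩
    ⊟ sum (λ j → sum (λ i → Z j i ⊛ Y i j))       ∎
    where open import Relation.Binary.Reasoning.Setoid S.setoid

  trace-cong : ∀ {Y Z} → Y M.≈ Z → trace Y ≐ trace Z
  trace-cong e = sum-cong-≋ (λ i → e i i)

  -- A^(p+1) is the product of the odd matrices Y and Y A^p, and Y commutes with A; so its trace is
  -- its own negative. The generality in Y admits X + ε y.
  square-nilpotent : ∀ {Y} → Oddₘ Y → (∀ i → Constₘ (psi i) Y) → (Y M.* Y) ^ n M.≈ M.0#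
  square-nilpotent {Y} oY cY = nilpotent A (oddₘ-odd {Y} {Y} oY oY) (λ i → constₘ-* (psi i) {Y} {Y} (cY i) (cY i)) traceA
    where
    A = Y M.* Y
    open Sandwich (matrixRing n ring) A using (^-commutes)
    open AlternatingSandwich (matrixRing n ring) Y using (X-A)
    traceA : ∀ p → trace (A ^ suc p) ≐ 𝟘
    traceA p L = ≡-neg⇒≡0 (t≐-t L)
      where
      t≐-t : trace (A ^ suc p) ≐ ⊟ trace (A ^ suc p)
      t≐-t = S.trans (trace-cong (M.*-assoc Y Y (A ^ p)))
            (S.trans (trace-swap {Y} {Y M.* A ^ p} oY (oddₘ-even {Y} {A ^ p} oY (evenₘ-^ (oddₘ-odd {Y} {Y} oY oY) p)))
                     (S.-‿cong (trace-cong (M.trans (M.*-assoc Y (A ^ p) Y)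
                       (M.trans (M.*-congˡ {Y} (M.sym (^-commutes X-A p))) (M.sym (M.*-assoc Y Y (A ^ p))))))))

  Aux : Letter U n → Set
  Aux (edge _) = ⊥
  Aux _        = ⊤

  Basic : Mat → Set
  Basic M = ∀ x → Aux x → Constₘ x M

  ε ε′ : Series
  ε  = single λ { eps → + 1 ; _ → + 0 }
  ε′ = single λ { eps′ → + 1 ; _ → + 0 }

  const-0 : const (+ 0) ≐ 𝟘
  const-0 []      = ≡.refl
  const-0 (_ ∷ _) = ≡.refl

  infixr 7 _◁_
  _◁_ : Series → Mat → Mat
  (f ◁ Y) i j = f ⊛ Y i j

  ◁-cong : ∀ f {Y Z} → Y M.≈ Z → f ◁ Y M.≈ f ◁ Z
  ◁-cong f {Y} {Z} e i j = S.*-congˡ {f} {Y i j} {Z i j} (e i j)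

  ◁-+ : ∀ f Y Z → f ◁ (Y M.+ Z) M.≈ f ◁ Y M.+ f ◁ Z
  ◁-+ f Y Z i j = ⊛-distribˡ f (Y i j) (Z i j)

  ◁-neg : ∀ f Y → f ◁ (M.- Y) M.≈ M.- (f ◁ Y)
  ◁-neg f Y i j = ⊛-⊟ f (Y i j)

  ◁-*ˡ : ∀ f Y Z → (f ◁ Y) M.* Z M.≈ f ◁ (Y M.* Z)
  ◁-*ˡ f Y Z i j = S.trans (sum-cong-≋ (λ l → ⊛-assoc f (Y i l) (Z l j))) (S.sym (*-distribˡ-sum f (λ l → Y i l ⊛ Z l j)))

  ◁-*-even : ∀ f {Y} → Evenₘ Y → ∀ Z → Y M.* (f ◁ Z) M.≈ f ◁ (Y M.* Z)
  ◁-*-even f {Y} e Z i j = S.trans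
    (sum-cong-≋ (λ l → S.trans (S.sym (⊛-assoc (Y i l) f (Z l j)))
      (S.trans (S.*-congʳ {Z l j} (even-comm {Y i l} (e i l) f)) (⊛-assoc f (Y i l) (Z l j)))))
    (S.sym (*-distribˡ-sum f (λ l → Y i l ⊛ Z l j)))

  ◁-*-odd : ∀ {f} → Odd f → ∀ {Y} → Oddₘ Y → ∀ Z → Y M.* (f ◁ Z) M.≈ M.- (f ◁ (Y M.* Z))
  ◁-*-odd {f} of {Y} o Z i j = S.trans
    (sum-cong-≋ (λ l → S.trans (S.sym (⊛-assoc (Y i l) f (Z l j)))
      (S.trans (S.*-congʳ {Z l j} (odd-anticomm {Y i l} {f} (o i l) of))
      (S.trans (⊟-⊛ (f ⊛ Y i l) (Z l j)) (S.-‿cong (⊛-assoc f (Y i l) (Z l j)))))))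
    (S.trans (sum-neg (λ l → f ⊛ (Y i l ⊛ Z l j))) (S.-‿cong (S.sym (*-distribˡ-sum f (λ l → Y i l ⊛ Z l j)))))

  ◁-square : ∀ {f} → Odd f → ∀ Y → f ◁ (f ◁ Y) M.≈ M.0#
  ◁-square {f} of Y i j = S.trans (S.sym (⊛-assoc f f (Y i j)))
    (S.trans (S.*-congʳ {Y i j} (λ L → ≡-neg⇒≡0 (odd-anticomm {f} {f} of of L))) (S.zeroˡ (Y i j)))

  constₘ-◁ : ∀ x {f Y} → ∂ x f ≐ 𝟘 → Constₘ x Y → Constₘ x (f ◁ Y)
  constₘ-◁ x {f} {Y} p q i j = S.trans
    (S.+-cong (S.trans (S.*-congʳ {Y i j} p) (S.zeroˡ (Y i j))) (S.trans (S.*-congˡ {σ f} {∂ x (Y i j)} (q i j)) (S.zeroʳ (σ f))))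
    (S.+-identityˡ 𝟘)

  -- Comparison of the coefficients at the infinitesimal letter x: the derivative of f Y in x is Y.
  ◁-cancel : ∀ x {f Y} → ∂ x f ≐ S.1# → Constₘ x Y → f ◁ Y M.≈ M.0# → Y M.≈ M.0#
  ◁-cancel x {f} {Y} p q e i j = S.trans (S.sym (S.trans
    (S.+-cong (S.trans (S.*-congʳ {Y i j} p) (S.*-identityˡ (Y i j))) (S.trans (S.*-congˡ {σ f} {∂ x (Y i j)} (q i j)) (S.zeroʳ (σ f))))
    (S.+-identityʳ (Y i j)))) (λ L → e i j (x ∷ L))

  constₘ-+ : ∀ x {Y Z} → Constₘ x Y → Constₘ x Z → Constₘ x (Y M.+ Z)
  constₘ-+ x p q i j = S.trans (S.+-cong (p i j) (q i j)) (S.+-identityˡ 𝟘)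

  constₘ-neg : ∀ x {Y} → Constₘ x Y → Constₘ x (M.- Y)
  constₘ-neg x p = M.trans (M.-‿cong p) -0#≈0#

  module Exchange (X : Mat) (oddX : Oddₘ X) (basicX : Basic X) where
    open Alternating (matrixRing n ring) X
    open AlternatingSandwich (matrixRing n ring) X
    open Sandwich (matrixRing n ring) (X M.* X)

    evenA : Evenₘ A
    evenA = oddₘ-odd {X} {X} oddX oddX

    A^n≈0 : A ^ suc K M.≈ M.0#
    A^n≈0 = ≡.subst (λ i → A ^ i M.≈ M.0#) n≡2+k (square-nilpotent {X} oddX (λ i → basicX (psi i) tt))

    constₘ-alt₁ : ∀ x → Aux x → ∀ {y} → Constₘ x y → ∀ m → Constₘ x (alt₁ m y)
    constₘ-alt₁ x aux     c zero    = c
    constₘ-alt₁ x aux {y} c (suc m) =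
      constₘ-+ x {y M.* X ^ suc m} {M.- (X M.* alt₁ m y)} (constₘ-* x {y} {X ^ suc m} c (constₘ-^ x {X} (basicX x aux) (suc m)))
        (constₘ-neg x {X M.* alt₁ m y} (constₘ-* x {X} {alt₁ m y} (basicX x aux) (constₘ-alt₁ x aux {y} c m)))

    constₘ-sand₁ : ∀ x → Aux x → ∀ {y} → Constₘ x y → ∀ m → Constₘ x (sand₁ m y)
    constₘ-sand₁ x aux     c zero    = c
    constₘ-sand₁ x aux {y} c (suc m) =
      constₘ-+ x {A M.* sand₁ m y} {y M.* A ^ suc m} (constₘ-* x {A} {sand₁ m y} cA (constₘ-sand₁ x aux {y} c m))
        (constₘ-* x {y} {A ^ suc m} c (constₘ-^ x {A} cA (suc m)))
      where cA = constₘ-* x {X} {X} (basicX x aux) (basicX x aux)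

    odd-ε : Odd ε
    odd-ε = odd-single _

    odd-ε′ : Odd ε′
    odd-ε′ = odd-single _

    -- Exact because ε² = 0.
    power-ε : ∀ {y} → Evenₘ y → ∀ m → (X M.+ ε ◁ y) ^ suc m M.≈ X ^ suc m M.+ ε ◁ alt₁ m y
    power-ε {y} e zero    = begin
      (X M.+ ε ◁ y) M.* M.1#     ≈⟨ M.*-identityʳ _ ⟩
      X M.+ ε ◁ y                ≈⟨ M.+-congʳ {ε ◁ y} (M.*-identityʳ X) ⟨
      X M.* M.1# M.+ ε ◁ y       ∎
      where open import Relation.Binary.Reasoning.Setoid M.setoid
    power-ε {y} e (suc m) = begin
      (X M.+ ε ◁ y) M.* (X M.+ ε ◁ y) ^ suc m
        ≈⟨ M.*-congˡ {X M.+ ε ◁ y} (power-ε e m) ⟩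
      (X M.+ ε ◁ y) M.* (P M.+ ε ◁ a)
        ≈⟨ M.trans (M.distribʳ _ X (ε ◁ y)) (M.+-cong (M.distribˡ X P (ε ◁ a)) (M.distribˡ (ε ◁ y) P (ε ◁ a))) ⟩
      (X M.* P M.+ X M.* (ε ◁ a)) M.+ ((ε ◁ y) M.* P M.+ (ε ◁ y) M.* (ε ◁ a))
        ≈⟨ M.+-cong (M.+-congˡ {X M.* P} (◁-*-odd {ε} odd-ε {X} oddX a)) (M.+-cong (◁-*ˡ ε y P) last) ⟩
      (X M.* P M.+ M.- (ε ◁ (X M.* a))) M.+ (ε ◁ (y M.* P) M.+ M.0#)
        ≈⟨ solve 3 (λ p q r → (p :- q) :+ (r :+ :0) := p :+ (r :- q)) M.refl (X M.* P) (ε ◁ (X M.* a)) (ε ◁ (y M.* P)) ⟩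
      X M.* P M.+ (ε ◁ (y M.* P) M.+ M.- (ε ◁ (X M.* a)))
        ≈⟨ M.+-congˡ {X M.* P} (M.trans (◁-+ ε (y M.* P) (M.- (X M.* a))) (M.+-congˡ {ε ◁ (y M.* P)} (◁-neg ε (X M.* a)))) ⟨
      X M.* P M.+ ε ◁ alt₁ (suc m) y ∎
      where
      open import Relation.Binary.Reasoning.Setoid M.setoid
      open RingSolver (matrixRing n ring)
      P = X ^ suc m
      a = alt₁ m y
      last : (ε ◁ y) M.* (ε ◁ a) M.≈ M.0#
      last = M.trans (◁-*ˡ ε y (ε ◁ a)) (M.trans (◁-cong ε (◁-*-even ε {y} e a)) (◁-square {ε} odd-ε (y M.* a)))

    -- ε y is odd, so X + ε y is an odd matrix and its 2n-th power vanishes. The coefficient of ε in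
    -- that power is the alternating sum of degree 2n - 1 = 2K + 1.
    even-exchange : ∀ {y} → Evenₘ y → (∀ i → Constₘ (psi i) y) → Constₘ eps y → sand₁ K (y M.* X) M.≈ sand₁ K (X M.* y)
    even-exchange {y} e cψ cε = Mₗ.x-y≈0⇒x≈y (M.trans (M.sym (alt₁-odd K y)) alt₁≈0)
      where
      Y : Mat
      Y = X M.+ ε ◁ y
      oddY : Oddₘ Y
      oddY i j = odd-⊞ {X i j} {ε ⊛ y i j} (oddX i j) (odd-⊛-even {ε} {y i j} odd-ε (e i j))
      constY : ∀ i → Constₘ (psi i) Y
      constY i = constₘ-+ (psi i) {X} {ε ◁ y} (basicX (psi i) tt) (constₘ-◁ (psi i) {ε} {y} const-0 (cψ i))
      Y^≈0 : Y ^ double (suc K) M.≈ M.0#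
      Y^≈0 = ≡.subst (λ i → Y ^ double i M.≈ M.0#) n≡2+k
               (M.trans (AlternatingSandwich.^-double (matrixRing n ring) Y n) (square-nilpotent {Y} oddY constY))
      X^≈0 : X ^ double (suc K) M.≈ M.0#
      X^≈0 = M.trans (^-double (suc K)) A^n≈0
      ε-alt₁≈0 : ε ◁ alt₁ (suc (double K)) y M.≈ M.0#
      ε-alt₁≈0 = M.trans (M.sym (M.+-identityˡ _)) (M.trans (M.+-congʳ {ε ◁ alt₁ (suc (double K)) y} (M.sym X^≈0))
                   (M.trans (M.sym (power-ε {y} e (suc (double K)))) Y^≈0))
      alt₁≈0 : alt₁ (suc (double K)) y M.≈ M.0#
      alt₁≈0 = ◁-cancel eps {ε} {alt₁ (suc (double K)) y} S.refl (constₘ-alt₁ eps tt {y} cε (suc (double K))) ε-alt₁≈0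

    ◁-sand₁ : ∀ f m y → sand₁ m (f ◁ y) M.≈ f ◁ sand₁ m y
    ◁-sand₁ f zero    y = M.refl
    ◁-sand₁ f (suc m) y = M.trans
      (M.+-cong (M.trans (M.*-congˡ {A} (◁-sand₁ f m y)) (◁-*-even f {A} evenA (sand₁ m y))) (◁-*ˡ f y (A ^ suc m)))
      (M.sym (◁-+ f (A M.* sand₁ m y) (y M.* A ^ suc m)))

    -- ε′ y is even and satisfies the even rule; pulling ε′ to the left past X changes the sign on
    -- one side only. A second infinitesimal is used because the even rule expects an element free
    -- of ε.
    odd-exchange : ∀ {y} → Oddₘ y → Basic y → sand₁ K (y M.* X) M.≈ M.- sand₁ K (X M.* y)
    odd-exchange {y} o b = Mₗ.x+y≈0⇒x≈-y (◁-cancel eps′ {ε′} {sum₁} S.refl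
      (constₘ-+ eps′ {sand₁ K (y M.* X)} {sand₁ K (X M.* y)}
        (constₘ-sand₁ eps′ tt {y M.* X} (constₘ-* eps′ {y} {X} (b eps′ tt) (basicX eps′ tt)) K)
        (constₘ-sand₁ eps′ tt {X M.* y} (constₘ-* eps′ {X} {y} (basicX eps′ tt) (b eps′ tt)) K)) (begin
      ε′ ◁ sum₁
        ≈⟨ ◁-+ ε′ (sand₁ K (y M.* X)) (sand₁ K (X M.* y)) ⟩
      ε′ ◁ sand₁ K (y M.* X) M.+ ε′ ◁ sand₁ K (X M.* y)
        ≈⟨ M.+-cong (◁-sand₁ ε′ K (y M.* X)) (◁-sand₁ ε′ K (X M.* y)) ⟨
      sand₁ K (ε′ ◁ (y M.* X)) M.+ sand₁ K (ε′ ◁ (X M.* y))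
        ≈⟨ M.+-congʳ {sand₁ K (ε′ ◁ (X M.* y))} (sand₁-cong K (◁-*ˡ ε′ y X)) ⟨
      sand₁ K ((ε′ ◁ y) M.* X) M.+ sand₁ K (ε′ ◁ (X M.* y))
        ≈⟨ M.+-congʳ {sand₁ K (ε′ ◁ (X M.* y))} (even-exchange {ε′ ◁ y} (λ i j → odd-⊛-odd {ε′} {y i j} odd-ε′ (o i j))
             (λ i → constₘ-◁ (psi i) {ε′} {y} const-0 (b (psi i) tt)) (constₘ-◁ eps {ε′} {y} const-0 (b eps tt))) ⟩
      sand₁ K (X M.* (ε′ ◁ y)) M.+ sand₁ K (ε′ ◁ (X M.* y))
        ≈⟨ M.+-congʳ {sand₁ K (ε′ ◁ (X M.* y))} (M.trans (sand₁-cong K (◁-*-odd {ε′} odd-ε′ {X} oddX y)) (sand₁-neg K (ε′ ◁ (X M.* y)))) ⟩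
      M.- sand₁ K (ε′ ◁ (X M.* y)) M.+ sand₁ K (ε′ ◁ (X M.* y))
        ≈⟨ M.-‿inverseˡ (sand₁ K (ε′ ◁ (X M.* y))) ⟩
      M.0# ∎))
      where
      open import Relation.Binary.Reasoning.Setoid M.setoid
      sum₁ = sand₁ K (y M.* X) M.+ sand₁ K (X M.* y)

  ×ₙ-entry : ∀ m Y i j L → (m ×ₙ Y) i j L ≡ (+ m) ℤ.* Y i j L
  ×ₙ-entry zero    Y i j L = ≡.sym (ℤₚ.*-zeroˡ (Y i j L))
  ×ₙ-entry (suc m) Y i j L = ≡.trans (≡.cong (λ z → Y i j L ℤ.+ z) (×ₙ-entry m Y i j L)) (≡.sym (ℤₚ.suc-* (+ m) (Y i j L)))

  torsionFreeₘ : ∀ m {Y} → suc m ×ₙ Y M.≈ M.0# → Y M.≈ M.0#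
  torsionFreeₘ m {Y} e i j L with ℤₚ.i*j≡0⇒i≡0∨j≡0 (+ suc m) (≡.trans (≡.sym (×ₙ-entry (suc m) Y i j L)) (e i j L))
  ... | inj₂ p = p

  -- Zero on the auxiliary letters makes the generic matrix independent of them.
  letterValue : Letter U n → Matrix n Z.ring
  letterValue (edge u) = value u
  letterValue _        = λ _ _ → + 0

  open Generic letterValue public

  oddX : Oddₘ X
  oddX i j = odd-single _

  basicX : Basic X
  basicX (psi _) _ i j = const-0
  basicX eps     _ i j = const-0
  basicX eps′    _ i j = const-0

  open Exchange X oddX basicX using (A^n≈0; even-exchange; odd-exchange)
  open Alternating (matrixRing n ring) X public

  -- The Amitsur-Levitzki identity of degree 2n, in generating form.
  X^≈0 : X ^ double (suc K) M.≈ M.0#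
  X^≈0 = M.trans (AlternatingSandwich.^-double (matrixRing n ring) X (suc K)) A^n≈0

  alt₂≈0 : ∀ x y → alt₂ (double (K ℕ.+ K)) (C x) (C y) M.≈ M.0#
  alt₂≈0 x y = alt₂-vanishes hypotheses {C x} {C y} (evenC x) (evenC y)
    where
    open MarkedPairVanishing (matrixRing n ring) X k
    EvenB OddB : Mat → Set
    EvenB Y = Evenₘ Y × Basic Y
    OddB  Y = Oddₘ Y × Basic Y
    basic-* : ∀ {Y Z} → Basic Y → Basic Z → Basic (Y M.* Z)
    basic-* {Y} {Z} p q x aux = constₘ-* x {Y} {Z} (p x aux) (q x aux)
    evenC : ∀ x → EvenB (C x)
    evenC x = (λ i j → even-const (letterValue x i j)) , (λ z _ i j L → ≡.refl)
    hypotheses : Hypotheses EvenB OddB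
    hypotheses = record
      { torsionFree   = torsionFreeₘ
      ; even-1        = evenₘ-1 , (λ x _ → constₘ-1 x)
      ; even-even     = λ {Y} {Z} (p , b) (q , b′) → evenₘ-even {Y} {Z} p q , basic-* {Y} {Z} b b′
      ; even-odd      = λ {Y} {Z} (p , b) (q , b′) → evenₘ-odd {Y} {Z} p q , basic-* {Y} {Z} b b′
      ; odd-even      = λ {Y} {Z} (p , b) (q , b′) → oddₘ-even {Y} {Z} p q , basic-* {Y} {Z} b b′
      ; odd-odd       = λ {Y} {Z} (p , b) (q , b′) → oddₘ-odd {Y} {Z} p q , basic-* {Y} {Z} b b′
      ; odd-X         = oddX , basicX
      ; A^≈0          = A^n≈0
      ; even-exchange = λ {Y} (e , b) → even-exchange {Y} e (λ i → b (psi i) tt) (b eps tt)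
      ; odd-exchange  = λ {Y} (o , b) → odd-exchange {Y} o b
      }

-- Even and odd parts in the Grassmann algebra.

module Commutation {a ℓ} (B : Ring a ℓ) where
  open Ring B
  open RingProperties B
  open RingLemmas B
  open RingSolver B
  open import Relation.Binary.Reasoning.Setoid setoid

  Comm Anti : Carrier → Carrier → Set ℓ
  Comm x y = x * y ≈ y * x
  Anti x y = x * y ≈ - (y * x)

  anti-sym : ∀ {x y} → Anti x y → Anti y x
  anti-sym e = trans (sym (-‿involutive _)) (-‿cong (sym e))

  comm-0 : ∀ x → Comm x 0#
  comm-0 x = trans (zeroʳ x) (sym (zeroˡ x))

  anti-0 : ∀ x → Anti x 0#
  anti-0 x = trans (zeroʳ x) (sym (trans (-‿cong (zeroˡ x)) -0#≈0#))

  comm-+ : ∀ {x y z} → Comm x y → Comm x z → Comm x (y + z)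
  comm-+ p q = trans (distribˡ _ _ _) (trans (+-cong p q) (sym (distribʳ _ _ _)))

  anti-+ : ∀ {x y z} → Anti x y → Anti x z → Anti x (y + z)
  anti-+ p q = trans (distribˡ _ _ _) (trans (+-cong p q) (trans (sym (neg-+ _ _)) (-‿cong (sym (distribʳ _ _ _)))))

  comm-neg : ∀ {x y} → Comm x y → Comm x (- y)
  comm-neg p = trans (*-neg _ _) (trans (-‿cong p) (sym (neg-* _ _)))

  anti-neg : ∀ {x y} → Anti x y → Anti x (- y)
  anti-neg p = trans (*-neg _ _) (-‿cong (trans p (sym (neg-* _ _))))

  comm-* : ∀ {x y z} → Comm x y → Comm x z → Comm x (y * z)
  comm-* {x} {y} {z} p q = begin
    x * (y * z)     ≈⟨ *-assoc x y z ⟨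
    (x * y) * z     ≈⟨ *-congʳ p ⟩
    (y * x) * z     ≈⟨ *-assoc y x z ⟩
    y * (x * z)     ≈⟨ *-congˡ q ⟩
    y * (z * x)     ≈⟨ *-assoc y z x ⟨
    (y * z) * x     ∎

  comm-*-anti : ∀ {x y z} → Comm x y → Anti x z → Anti x (y * z)
  comm-*-anti {x} {y} {z} p q = begin
    x * (y * z)       ≈⟨ *-assoc x y z ⟨
    (x * y) * z       ≈⟨ *-congʳ p ⟩
    (y * x) * z       ≈⟨ *-assoc y x z ⟩
    y * (x * z)       ≈⟨ *-congˡ q ⟩
    y * (- (z * x))   ≈⟨ solve 3 (λ x y z → y :* (:- (z :* x)) := :- ((y :* z) :* x)) refl x y z ⟩
    - ((y * z) * x)   ∎

  anti-*-comm : ∀ {x y z} → Anti x y → Comm x z → Anti x (y * z)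
  anti-*-comm {x} {y} {z} p q = begin
    x * (y * z)       ≈⟨ *-assoc x y z ⟨
    (x * y) * z       ≈⟨ *-congʳ p ⟩
    - (y * x) * z     ≈⟨ solve 3 (λ x y z → :- (y :* x) :* z := :- (y :* (x :* z))) refl x y z ⟩
    - (y * (x * z))   ≈⟨ -‿cong (*-congˡ q) ⟩
    - (y * (z * x))   ≈⟨ -‿cong (*-assoc y z x) ⟨
    - ((y * z) * x)   ∎

  anti-*-anti : ∀ {x y z} → Anti x y → Anti x z → Comm x (y * z)
  anti-*-anti {x} {y} {z} p q = begin
    x * (y * z)         ≈⟨ *-assoc x y z ⟨
    (x * y) * z         ≈⟨ *-congʳ p ⟩
    - (y * x) * z       ≈⟨ solve 3 (λ x y z → :- (y :* x) :* z := :- (y :* (x :* z))) refl x y z ⟩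
    - (y * (x * z))     ≈⟨ -‿cong (*-congˡ q) ⟩
    - (y * - (z * x))   ≈⟨ solve 3 (λ x y z → :- (y :* (:- (z :* x))) := (y :* z) :* x) refl x y z ⟩
    (y * z) * x         ∎

module GrassmannParity {c ℓ} (R : CommutativeRing c ℓ) (m : ℕ) where
  E : Ring c (c ⊔ ℓ)
  E = Grassmann R m
  open Ring E
  open RingProperties E
  open RingLemmas E
  open RingSolver E
  open Commutation E
  open import Relation.Binary.Reasoning.Setoid setoid

  generator : Fin m → Carrier
  generator = Expr.var

  -- Parity is computed on the representing expression; `parts` shows that the result is a
  -- decomposition of the element.
  ev od : Carrier → Carrier
  ev (Expr.ι r)   = Expr.ι r
  ev (Expr.var i) = 0#
  ev (x Expr.⊕ y) = ev x + ev y
  ev (x Expr.⊗ y) = ev x * ev y + od x * od y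
  ev (Expr.⊖ x)   = - ev x
  od (Expr.ι r)   = 0#
  od (Expr.var i) = Expr.var i
  od (x Expr.⊕ y) = od x + od y
  od (x Expr.⊗ y) = ev x * od y + od x * ev y
  od (Expr.⊖ x)   = - od x

  parts : ∀ x → x ≈ ev x + od x
  parts (Expr.ι r)   = sym (+-identityʳ _)
  parts (Expr.var i) = sym (+-identityˡ _)
  parts (x Expr.⊕ y) = trans (+-cong (parts x) (parts y)) (+-interchange _ _ _ _)
  parts (x Expr.⊗ y) = trans (*-cong (parts x) (parts y))
    (solve 4 (λ a b c d → (a :+ b) :* (c :+ d) := (a :* c :+ b :* d) :+ (a :* d :+ b :* c)) refl (ev x) (od x) (ev y) (od y))
  parts (Expr.⊖ x)   = trans (-‿cong (parts x)) (neg-+ _ _)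

  generators-anti : ∀ i j → Anti (generator i) (generator j)
  generators-anti i j = x+y≈0⇒x≈-y (Equal.relator (GrassmannRelator.anti i j))

  generators-square : ∀ i → generator i * generator i ≈ 0#
  generators-square i = Equal.relator (GrassmannRelator.square i)

  -- Used in two rounds: for a generator, and then for `od x`, whose behaviour against generators is
  -- the outcome of the first round.
  anti-parts : ∀ {x} → (∀ i → Anti x (generator i)) → ∀ y → Comm x (ev y) × Anti x (od y)
  anti-parts {x} h (Expr.ι r)   = sym (Equal.ι-central r x) , anti-0 x
  anti-parts {x} h (Expr.var i) = comm-0 x , h i
  anti-parts {x} h (y Expr.⊕ z) = let (p , q) = anti-parts h y ; (p′ , q′) = anti-parts h z in
    comm-+ p p′ , anti-+ q q′
  anti-parts {x} h (y Expr.⊗ z) = let (p , q) = anti-parts h y ; (p′ , q′) = anti-parts h z in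
    comm-+ (comm-* p p′) (anti-*-anti q q′) , anti-+ (comm-*-anti p q′) (anti-*-comm q p′)
  anti-parts {x} h (Expr.⊖ y)   = let (p , q) = anti-parts h y in comm-neg p , anti-neg q

  comm-all : ∀ {x} → (∀ i → Comm x (generator i)) → ∀ y → Comm x y
  comm-all {x} h (Expr.ι r)   = sym (Equal.ι-central r x)
  comm-all {x} h (Expr.var i) = h i
  comm-all {x} h (y Expr.⊕ z) = comm-+ (comm-all h y) (comm-all h z)
  comm-all {x} h (y Expr.⊗ z) = comm-* (comm-all h y) (comm-all h z)
  comm-all {x} h (Expr.⊖ y)   = comm-neg (comm-all h y)

  generator-ev : ∀ i x → Comm (generator i) (ev x)
  generator-ev i x = proj₁ (anti-parts (generators-anti i) x)

  generator-od : ∀ i x → Anti (generator i) (od x)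
  generator-od i x = proj₂ (anti-parts (generators-anti i) x)

  ev-central : ∀ x y → ev x * y ≈ y * ev x
  ev-central x = comm-all (λ i → sym (generator-ev i x))

  od-anti : ∀ x y → od x * od y ≈ - (od y * od x)
  od-anti x y = proj₂ (anti-parts (λ i → anti-sym (generator-od i x)) y)

  open Annihilation E generator public

  kill-ev : ∀ x d {z} → Kill d z → Kill d (ev x * z)
  kill-ev x = kill-commuting (λ i → generator-ev i x)

  kill-od : ∀ x d {z} → Kill d z → Kill d (od x * z)
  kill-od x = kill-anticommuting (λ i → generator-od i x)

  -- Every monomial of an odd expression contains a generator, and this generator takes up one level
  -- of `Kill`.
  kill-od-suc : ∀ x d {z} → Kill (suc d) z → Kill d (od x * z)
  kill-od-suc (Expr.ι r)   d p = kill-cong d (sym (zeroˡ _)) (kill-0 d)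
  kill-od-suc (Expr.var i) d p = p i
  kill-od-suc (x Expr.⊕ y) d p = kill-cong d (sym (distribʳ _ _ _)) (kill-+ d (kill-od-suc x d p) (kill-od-suc y d p))
  kill-od-suc (x Expr.⊗ y) d {z} p = kill-cong d
    (solve 5 (λ a b c d z → a :* (d :* z) :+ b :* (c :* z) := (a :* d :+ b :* c) :* z) refl (ev x) (od x) (ev y) (od y) z)
    (kill-+ d (kill-ev x d (kill-od-suc y d p)) (kill-od-suc x d (kill-ev y (suc d) p)))
  kill-od-suc (Expr.⊖ x)   d p = kill-cong d (-‿distribˡ-* _ _) (kill-neg d (kill-od-suc x d p))

  kill-anything : ∀ d x → m ℕ.< d → Kill d x
  kill-anything = kill-many generators-square generators-anti

-- Inversions and the Laplace expansion of the standard polynomial.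

module Inversions where
  open SemiringSum ℕₚ.+-*-semiring using (sum; sum-cong-≗; ∑-permute; sum-replicate-zero)

  indicator : ∀ {p} {P : Set p} → Dec P → ℕ
  indicator d = if does d then 1 else 0

  indicator-cong : ∀ {p q} {P : Set p} {Q : Set q} (d : Dec P) (e : Dec Q) → (P → Q) → (Q → P) → indicator d ≡ indicator e
  indicator-cong (yes p) (yes q) f g = ≡.refl
  indicator-cong (yes p) (no ¬q) f g = contradiction (f p) ¬q
  indicator-cong (no ¬p) (yes q) f g = contradiction (g q) ¬p
  indicator-cong (no ¬p) (no ¬q) f g = ≡.refl

  count-tabulate : ∀ {a p} {A : Set a} {P : Pred A p} (P? : Decidable P) {k} (f : Fin k → A) →
                   length (filter P? (tabulate f)) ≡ sum (λ i → indicator (P? (f i)))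
  count-tabulate P? {zero}  f = ≡.refl
  count-tabulate P? {suc k} f with does (P? (f zero))
  ... | true  = ≡.cong suc (count-tabulate P? (f ∘ suc))
  ... | false = count-tabulate P? (f ∘ suc)

  count-product : ∀ {a b p} {A : Set a} {B : Set b} {P : Pred (A × B) p} (P? : Decidable P) {k l} (f : Fin k → A) (g : Fin l → B) →
                  length (filter P? (cartesianProduct (tabulate f) (tabulate g))) ≡
                  sum (λ i → sum (λ j → indicator (P? (f i , g j))))
  count-product P? {zero}  f g = ≡.refl
  count-product P? {suc k} f g = begin
    length (filter P? (map (f zero ,_) (tabulate g) ++ rest))
      ≡⟨ ≡.cong length (Listₚ.filter-++ P? (map (f zero ,_) (tabulate g)) rest) ⟩
    length (filter P? (map (f zero ,_) (tabulate g)) ++ filter P? rest)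
      ≡⟨ Listₚ.length-++ (filter P? (map (f zero ,_) (tabulate g))) ⟩
    length (filter P? (map (f zero ,_) (tabulate g))) ℕ.+ length (filter P? rest)
      ≡⟨ ≡.cong₂ ℕ._+_ (≡.trans (≡.cong (length ∘ filter P?) (Listₚ.map-tabulate g (f zero ,_))) (count-tabulate P? (λ j → f zero , g j)))
                       (count-product P? (f ∘ suc) g) ⟩
    sum (λ j → indicator (P? (f zero , g j))) ℕ.+ sum (λ i → sum (λ j → indicator (P? (f (suc i) , g j)))) ∎
    where
    open ≡.≡-Reasoning
    rest = cartesianProduct (tabulate (f ∘ suc)) (tabulate g)

  isInversion? : ∀ {k} (π : Permutation′ k) i j → Dec ((i Fin.< j) × ((π ⟨$⟩ʳ j) Fin.< (π ⟨$⟩ʳ i)))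
  isInversion? π i j = (i Finₚ.<? j) ×-dec ((π ⟨$⟩ʳ j) Finₚ.<? (π ⟨$⟩ʳ i))

  inversions-sum : ∀ {k} (π : Permutation′ k) → inversions π ≡ sum (λ i → sum (λ j → indicator (isInversion? π i j)))
  inversions-sum π = count-product (λ (i , j) → isInversion? π i j) (λ i → i) (λ j → j)

  count-below : ∀ {k} (i : Fin (suc k)) → sum (λ (j : Fin k) → indicator (toℕ j ℕₚ.<? toℕ i)) ≡ toℕ i
  count-below {k}     zero    = sum-replicate-zero k
  count-below {suc k} (suc i) = ≡.cong suc (≡.trans
    (sum-cong-≗ (λ (j : Fin k) → indicator-cong (suc (toℕ j) ℕₚ.<? suc (toℕ i)) (toℕ j ℕₚ.<? toℕ i) ℕₚ.≤-pred s≤s))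
    (count-below i))

  punchIn<⇒< : ∀ {k} (i : Fin (suc k)) (j : Fin k) → punchIn i j Fin.< i → toℕ j ℕ.< toℕ i
  punchIn<⇒< (suc i) zero    p       = s≤s z≤n
  punchIn<⇒< (suc i) (suc j) (s≤s p) = s≤s (punchIn<⇒< i j p)

  <⇒punchIn< : ∀ {k} (i : Fin (suc k)) (j : Fin k) → toℕ j ℕ.< toℕ i → punchIn i j Fin.< i
  <⇒punchIn< (suc i) zero    p       = s≤s z≤n
  <⇒punchIn< (suc i) (suc j) (s≤s p) = s≤s (<⇒punchIn< i j p)

  punchIn-mono-< : ∀ {k} (i : Fin (suc k)) (a b : Fin k) → a Fin.< b → punchIn i a Fin.< punchIn i b
  punchIn-mono-< zero    a       b       p       = s≤s p
  punchIn-mono-< (suc i) zero    (suc b) p       = s≤s z≤n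
  punchIn-mono-< (suc i) (suc a) (suc b) (s≤s p) = s≤s (punchIn-mono-< i a b p)

  punchIn-cancel-< : ∀ {k} (i : Fin (suc k)) (a b : Fin k) → punchIn i a Fin.< punchIn i b → a Fin.< b
  punchIn-cancel-< zero    a       b       (s≤s p) = p
  punchIn-cancel-< (suc i) zero    (suc b) p       = s≤s z≤n
  punchIn-cancel-< (suc i) (suc a) (suc b) (s≤s p) = s≤s (punchIn-cancel-< i a b p)

  -- The additional inversions involve position 0. They count the positions whose image is below i;
  -- reindexing by π turns this into the number of values below i.
  inversions-insert : ∀ {k} (i : Fin (suc k)) (π : Permutation′ k) → inversions (Perm.insert zero i π) ≡ toℕ i ℕ.+ inversions π
  inversions-insert {k} i π = begin
    inversions ρ
      ≡⟨ inversions-sum ρ ⟩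
    sum (λ b → indicator (isInversion? ρ zero (suc b))) ℕ.+ sum (λ a → sum (λ b → indicator (isInversion? ρ (suc a) (suc b))))
      ≡⟨ ≡.cong₂ ℕ._+_ firstRow (sum-cong-≗ (λ a → sum-cong-≗ (λ b →
           indicator-cong (isInversion? ρ (suc a) (suc b)) (isInversion? π a b)
             (λ (p , q) → ℕₚ.≤-pred p , punchIn-cancel-< i _ _ q) (λ (p , q) → s≤s p , punchIn-mono-< i _ _ q)))) ⟩
    toℕ i ℕ.+ sum (λ a → sum (λ b → indicator (isInversion? π a b)))
      ≡⟨ ≡.cong (toℕ i ℕ.+_) (≡.sym (inversions-sum π)) ⟩
    toℕ i ℕ.+ inversions π ∎
    where
    open ≡.≡-Reasoning
    ρ : Permutation′ (suc k)
    ρ = Perm.insert zero i π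
    firstRow : sum (λ b → indicator (isInversion? ρ zero (suc b))) ≡ toℕ i
    firstRow = begin
      sum (λ b → indicator (isInversion? ρ zero (suc b)))
        ≡⟨ sum-cong-≗ (λ b → indicator-cong (isInversion? ρ zero (suc b)) (toℕ (π ⟨$⟩ʳ b) ℕₚ.<? toℕ i)
             (λ (_ , q) → punchIn<⇒< i (π ⟨$⟩ʳ b) q) (λ q → s≤s z≤n , <⇒punchIn< i (π ⟨$⟩ʳ b) q)) ⟩
      sum (λ b → indicator (toℕ (π ⟨$⟩ʳ b) ℕₚ.<? toℕ i))
        ≡⟨ ∑-permute {k} {k} (λ b → indicator (toℕ b ℕₚ.<? toℕ i)) π ⟨
      sum {k} (λ b → indicator (toℕ b ℕₚ.<? toℕ i))
        ≡⟨ count-below i ⟩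
      toℕ i ∎

module StandardLaplace {a ℓ} (A : Ring a ℓ) where
  open Ring A hiding (zero)
  open RingProperties A
  open RingLemmas A
  open SemiringExp semiring
  open SemiringSum semiring using (sum; sum-cong-≋)
  open Inversions using (inversions-insert)
  open import Relation.Binary.Reasoning.Setoid setoid

  sign : ℕ → Carrier
  sign k = (- 1#) ^ k

  sign-central : ∀ k x → sign k * x ≈ x * sign k
  sign-central zero    x = trans (*-identityˡ x) (sym (*-identityʳ x))
  sign-central (suc k) x = begin
    (- 1# * sign k) * x     ≈⟨ *-congʳ (-1*x≈-x _) ⟩
    - sign k * x            ≈⟨ neg-* _ _ ⟩
    - (sign k * x)          ≈⟨ -‿cong (sign-central k x) ⟩
    - (x * sign k)          ≈⟨ *-neg _ _ ⟨
    x * - sign k            ≈⟨ *-congˡ (-1*x≈-x _) ⟨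
    x * (- 1# * sign k)     ∎

  listSum : ∀ {b} {B : Set b} → (B → Carrier) → List B → Carrier
  listSum f xs = foldr _+_ 0# (map f xs)

  listSum-++ : ∀ {b} {B : Set b} (f : B → Carrier) xs ys → listSum f (xs ++ ys) ≈ listSum f xs + listSum f ys
  listSum-++ f []       ys = sym (+-identityˡ _)
  listSum-++ f (x ∷ xs) ys = trans (+-congˡ (listSum-++ f xs ys)) (sym (+-assoc _ _ _))

  listSum-cong : ∀ {b} {B : Set b} {f g : B → Carrier} → (∀ x → f x ≈ g x) → ∀ xs → listSum f xs ≈ listSum g xs
  listSum-cong e []       = refl
  listSum-cong e (x ∷ xs) = +-cong (e x) (listSum-cong e xs)

  *-listSum : ∀ {b} {B : Set b} c (f : B → Carrier) xs → listSum (λ x → c * f x) xs ≈ c * listSum f xs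
  *-listSum c f []       = sym (zeroʳ c)
  *-listSum c f (x ∷ xs) = trans (+-congˡ (*-listSum c f xs)) (sym (distribˡ _ _ _))

  listSum-map : ∀ {b d} {B : Set b} {D : Set d} (f : D → Carrier) (g : B → D) xs → listSum f (map g xs) ≡ listSum (f ∘ g) xs
  listSum-map f g []       = ≡.refl
  listSum-map f g (x ∷ xs) = ≡.cong (λ s → f (g x) + s) (listSum-map f g xs)

  listSum-product : ∀ {b d e} {B : Set b} {D : Set d} {F : Set e} (f : F → Carrier) (g : B → D → F) {k} (h : Fin k → B) ys →
                    listSum f (cartesianProductWith g (tabulate h) ys) ≈ sum (λ i → listSum (λ y → f (g (h i) y)) ys)
  listSum-product f g {zero}  h ys = refl
  listSum-product f g {suc k} h ys = begin
    listSum f (map (g (h zero)) ys ++ cartesianProductWith g (tabulate (h ∘ suc)) ys)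
      ≈⟨ listSum-++ f (map (g (h zero)) ys) _ ⟩
    listSum f (map (g (h zero)) ys) + listSum f (cartesianProductWith g (tabulate (h ∘ suc)) ys)
      ≈⟨ +-cong (reflexive (listSum-map f (g (h zero)) ys)) (listSum-product f g (h ∘ suc) ys) ⟩
    listSum (λ y → f (g (h zero) y)) ys + sum (λ i → listSum (λ y → f (g (h (suc i)) y)) ys) ∎

  -- `permutations` chooses the image of 0 first, which is the index of the first factor, and that
  -- choice i contributes i inversions.
  laplace : ∀ k (x : Vector Carrier (suc k)) →
            standard A (suc k) x ≈ sum (λ i → sign (toℕ i) * (x i * standard A k (x ∘ punchIn i)))
  laplace k x = begin
    listSum term (permutations (suc k))
      ≈⟨ listSum-product term (Perm.insert zero) (λ i → i) (permutations k) ⟩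
    sum (λ i → listSum (λ π → term (Perm.insert zero i π)) (permutations k))
      ≈⟨ sum-cong-≋ (λ i → trans (listSum-cong (step i) (permutations k))
           (trans (*-listSum (sign (toℕ i)) (λ π → x i * rest i π) (permutations k))
                  (*-congˡ (*-listSum (x i) (rest i) (permutations k))))) ⟩
    sum (λ i → sign (toℕ i) * (x i * standard A k (x ∘ punchIn i))) ∎
    where
    term : Permutation′ (suc k) → Carrier
    term π = sgn A π * product A (λ l → x (π ⟨$⟩ʳ l))
    rest : Fin (suc k) → Permutation′ k → Carrier
    rest i π = sgn A π * product A (λ l → x (punchIn i (π ⟨$⟩ʳ l)))
    step : ∀ i π → term (Perm.insert zero i π) ≈ sign (toℕ i) * (x i * rest i π)
    step i π = begin
      sign (inversions (Perm.insert zero i π)) * (x i * p)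
        ≡⟨ ≡.cong (λ s → sign s * (x i * p)) (inversions-insert i π) ⟩
      sign (toℕ i ℕ.+ inversions π) * (x i * p)
        ≈⟨ *-congʳ (^-homo-* (- 1#) (toℕ i) (inversions π)) ⟩
      (sign (toℕ i) * sgn A π) * (x i * p)
        ≈⟨ *-assoc _ _ _ ⟩
      sign (toℕ i) * (sgn A π * (x i * p))
        ≈⟨ *-congˡ (trans (sym (*-assoc _ _ _)) (trans (*-congʳ (sign-central (inversions π) (x i))) (*-assoc _ _ _))) ⟩
      sign (toℕ i) * (x i * (sgn A π * p)) ∎
      where p = product A (λ l → x (punchIn i (π ⟨$⟩ʳ l)))

-- The standard polynomial as a coefficient of a power of the generic matrix.

module StandardPower {a ℓ} (A : Ring a ℓ) (n : ℕ) where
  private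
    MA = matrixRing n A
    module A = Ring A
    module MA = Ring MA
  open Shuffle A (Matrix n A) public
  open MatrixShuffle A (Matrix n A) n public using (Mat; ∂ₘ; σₘ; constₘ; module Generic)
  open Generic (λ x → x) public
  private
    module S = Ring ring
    module M = Ring (matrixRing n ring)
  open SkewDerivations (matrixRing n ring) X ∂ₘ C public using (module Laws)
  open Laws laws using (∂-X*)
  open SemiringSum A.semiring using () renaming (sum to sumᴬ; sum-cong-≋ to sumᴬ-cong; sum-replicate-zero to sumᴬ-zero)
  open SemiringSum S.semiring using (sum)
  open SemiringSum MA.semiring using () renaming (sum to sumᴹ; sum-cong-≋ to sumᴹ-cong; *-distribˡ-sum to *-distribˡ-sumᴹ)
  open SemiringExp M.semiring using () renaming (_^_ to _^ᴹ_)
  open StandardLaplace MA using (sign; laplace)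
  open RingProperties MA using (-1*x≈-x; -0#≈0#)

  eval : Mat → List (Matrix n A) → Matrix n A
  eval G L i j = G i j L

  sum-eval : ∀ {m} (f : Vector Series m) L → sum f L A.≈ sumᴬ (λ i → f i L)
  sum-eval {zero}  f L = A.refl
  sum-eval {suc m} f L = A.+-congˡ (sum-eval (λ i → f (suc i)) L)

  eval-C* : ∀ x G L → eval (C x M.* G) L MA.≈ x MA.* eval G L
  eval-C* x G L i j = A.trans (sum-eval (λ l → const (x i l) ⊛ G l j) L) (sumᴬ-cong (λ l → const-⊛ (x i l) (G l j) L))

  eval-X*-[] : ∀ G → eval (X M.* G) [] MA.≈ MA.0#
  eval-X*-[] G i j = A.trans (sum-eval (λ l → X i l ⊛ G l j) []) (A.trans (sumᴬ-cong (λ l → A.zeroˡ (G l j []))) (sumᴬ-zero n))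

  eval-X*-∷ : ∀ x G L → eval (X M.* G) (x ∷ L) MA.≈ x MA.* eval G L MA.+ MA.- eval (X M.* ∂ₘ x G) L
  eval-X*-∷ x G L i j = A.trans (∂-X* x G i j L) (A.+-congʳ (eval-C* x G L i j))

  -- X consumes one letter of the word; the letter at position i reaches the front past i others,
  -- with one sign for each.
  eval-laplace : ∀ k (x : Vector (Matrix n A) (suc k)) G →
                 eval (X M.* G) (tabulate x) MA.≈ sumᴹ (λ i → sign (toℕ i) MA.* (x i MA.* eval G (tabulate (x ∘ punchIn i))))
  eval-laplace k x G = begin
    eval (X M.* G) (tabulate x)
      ≈⟨ eval-X*-∷ (x zero) G (tabulate (x ∘ suc)) ⟩
    x zero MA.* eval G (tabulate (x ∘ suc)) MA.+ MA.- eval (X M.* ∂ₘ (x zero) G) (tabulate (x ∘ suc))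
      ≈⟨ MA.+-cong (MA.sym (MA.*-identityˡ (x zero MA.* eval G (tabulate (x ∘ suc))))) (tail k x G) ⟩
    sumᴹ (λ i → sign (toℕ i) MA.* (x i MA.* eval G (tabulate (x ∘ punchIn i)))) ∎
    where
    open import Relation.Binary.Reasoning.Setoid MA.setoid
    tail : ∀ k (x : Vector (Matrix n A) (suc k)) G → MA.- eval (X M.* ∂ₘ (x zero) G) (tabulate (x ∘ suc)) MA.≈
           sumᴹ (λ i → sign (suc (toℕ i)) MA.* (x (suc i) MA.* eval G (tabulate (x ∘ punchIn (suc i)))))
    tail zero    x G = MA.trans (MA.-‿cong (eval-X*-[] (∂ₘ (x zero) G))) -0#≈0#
    tail (suc k) x G = begin
      MA.- eval (X M.* ∂ₘ (x zero) G) (tabulate (x ∘ suc))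
        ≈⟨ MA.-‿cong (eval-laplace k (x ∘ suc) (∂ₘ (x zero) G)) ⟩
      MA.- sumᴹ t
        ≈⟨ -1*x≈-x (sumᴹ t) ⟨
      MA.- MA.1# MA.* sumᴹ t
        ≈⟨ *-distribˡ-sumᴹ (MA.- MA.1#) t ⟩
      sumᴹ (λ i → MA.- MA.1# MA.* t i)
        ≈⟨ sumᴹ-cong {suc k} (λ i → MA.*-assoc (MA.- MA.1#) (sign (toℕ i)) (u i)) ⟨
      sumᴹ (λ i → sign (suc (toℕ i)) MA.* (x (suc i) MA.* eval G (tabulate (x ∘ punchIn (suc i))))) ∎
      where
      t u : Vector (Matrix n A) (suc k)
      u i = x (suc i) MA.* eval G (tabulate (x ∘ punchIn (suc i)))
      t i = sign (toℕ i) MA.* u i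

  -- Every matrix serves as a letter with itself as value, so a substitution is a word. Both sides
  -- have the same expansion along the first factor.
  standard-power : ∀ k x → standard MA k x MA.≈ eval (X ^ᴹ k) (tabulate x)
  standard-power zero    x = MA.trans (MA.+-identityʳ _) (MA.trans (MA.*-identityˡ MA.1#) one)
    where
    one : MA.1# MA.≈ eval M.1# []
    one i j with i Finₚ.≟ j
    ... | yes _ = A.refl
    ... | no _  = A.refl
  standard-power (suc k) x = MA.trans (laplace k x)
    (MA.trans (sumᴹ-cong (λ i → MA.*-congˡ {sign (toℕ i)} (MA.*-congˡ {x i} (standard-power k (x ∘ punchIn i)))))
              (MA.sym (eval-laplace k x (X ^ᴹ k))))

-- Antisymmetry and multilinearity in the letters of a word.

module Antisymmetry {a ℓ} (A : Ring a ℓ) {v} (V : Set v) where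
  private module A = Ring A
  open Shuffle A V
  private module S = Ring ring
  open RingProperties A using (-‿involutive; -0#≈0#; -‿+-comm)
  open RingLemmas A
  open SemiringSum S.semiring using (sum)
  open import Relation.Binary.Reasoning.Setoid A.setoid

  Antisymmetric : Series → Set (ℓ ⊔ v)
  Antisymmetric f = ∀ P x y L → f (P ++ x ∷ y ∷ L) A.+ f (P ++ y ∷ x ∷ L) A.≈ A.0#

  antisymmetric-∂ : ∀ x f → Antisymmetric f → Antisymmetric (∂ x f)
  antisymmetric-∂ x f h P = h (x ∷ P)

  antisymmetric-𝟘 : Antisymmetric 𝟘
  antisymmetric-𝟘 P x y L = A.+-identityˡ A.0#

  antisymmetric-const : ∀ c → Antisymmetric (const c)
  antisymmetric-const c []      x y L = A.+-identityˡ A.0#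
  antisymmetric-const c (_ ∷ P) x y L = A.+-identityˡ A.0#

  antisymmetric-single : ∀ c → Antisymmetric (single c)
  antisymmetric-single c []      x y L = A.+-identityˡ A.0#
  antisymmetric-single c (p ∷ P) x y L = antisymmetric-const (c p) P x y L

  antisymmetric-⊞ : ∀ {f g} → Antisymmetric f → Antisymmetric g → Antisymmetric (f ⊞ g)
  antisymmetric-⊞ p q P x y L = A.trans (+-interchange _ _ _ _) (A.trans (A.+-cong (p P x y L) (q P x y L)) (A.+-identityˡ A.0#))

  antisymmetric-σ : ∀ {f} → Antisymmetric f → Antisymmetric (σ f)
  antisymmetric-σ {f} h [] x y L = begin
    σ f (x ∷ y ∷ L) A.+ σ f (y ∷ x ∷ L)
      ≈⟨ A.+-cong (-‿involutive _) (-‿involutive _) ⟩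
    σ (∂ y (∂ x f)) L A.+ σ (∂ x (∂ y f)) L
      ≈⟨ σ-⊞ (∂ y (∂ x f)) (∂ x (∂ y f)) L ⟨
    σ (∂ y (∂ x f) ⊞ ∂ x (∂ y f)) L
      ≈⟨ σ-cong (h [] x y) L ⟩
    σ 𝟘 L
      ≈⟨ σ-𝟘 L ⟩
    A.0# ∎
  antisymmetric-σ {f} h (p ∷ P) x y L =
    A.trans (-‿+-comm _ _) (A.trans (A.-‿cong (antisymmetric-σ {∂ p f} (antisymmetric-∂ p f h) P x y L)) -0#≈0#)

  antisymmetric-⊛ : ∀ {f g} → Antisymmetric f → Antisymmetric g → Antisymmetric (f ⊛ g)
  antisymmetric-⊛ {f} {g} p q [] x y L = begin
    (((∂ y (∂ x f)) ⊛ g) L A.+ (σ (∂ x f) ⊛ ∂ y g) L A.+ (((⊟ σ (∂ y f)) ⊛ ∂ x g) L A.+ (σ (σ f) ⊛ ∂ y (∂ x g)) L)) A.+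
    (((∂ x (∂ y f)) ⊛ g) L A.+ (σ (∂ y f) ⊛ ∂ x g) L A.+ (((⊟ σ (∂ x f)) ⊛ ∂ y g) L A.+ (σ (σ f) ⊛ ∂ x (∂ y g)) L))
      ≈⟨ A.+-cong (A.+-congˡ (A.+-congʳ (⊟-⊛ (σ (∂ y f)) (∂ x g) L))) (A.+-congˡ (A.+-congʳ (⊟-⊛ (σ (∂ x f)) (∂ y g) L))) ⟩
    (((∂ y (∂ x f)) ⊛ g) L A.+ (σ (∂ x f) ⊛ ∂ y g) L A.+ (A.- (σ (∂ y f) ⊛ ∂ x g) L A.+ (σ (σ f) ⊛ ∂ y (∂ x g)) L)) A.+
    (((∂ x (∂ y f)) ⊛ g) L A.+ (σ (∂ y f) ⊛ ∂ x g) L A.+ (A.- (σ (∂ x f) ⊛ ∂ y g) L A.+ (σ (σ f) ⊛ ∂ x (∂ y g)) L))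
      ≈⟨ solve 6 (λ a b c d e h → (a :+ b :+ (:- c :+ d)) :+ (e :+ c :+ (:- b :+ h)) := (a :+ e) :+ (d :+ h)) A.refl _ _ _ _ _ _ ⟩
    (((∂ y (∂ x f)) ⊛ g) L A.+ ((∂ x (∂ y f)) ⊛ g) L) A.+ ((σ (σ f) ⊛ ∂ y (∂ x g)) L A.+ (σ (σ f) ⊛ ∂ x (∂ y g)) L)
      ≈⟨ A.+-cong (⊛-distribʳ g (∂ y (∂ x f)) (∂ x (∂ y f)) L) (⊛-distribˡ (σ (σ f)) (∂ y (∂ x g)) (∂ x (∂ y g)) L) ⟨
    ((∂ y (∂ x f) ⊞ ∂ x (∂ y f)) ⊛ g) L A.+ (σ (σ f) ⊛ (∂ y (∂ x g) ⊞ ∂ x (∂ y g))) L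
      ≈⟨ A.+-cong (S.trans (S.*-congʳ {g} (p [] x y)) (S.zeroˡ g) L) (S.trans (S.*-congˡ {σ (σ f)} (q [] x y)) (S.zeroʳ (σ (σ f))) L) ⟩
    A.0# A.+ A.0#
      ≈⟨ A.+-identityˡ A.0# ⟩
    A.0# ∎
    where open RingSolver A
  antisymmetric-⊛ {f} {g} p q (z ∷ P) x y L =
    A.trans (+-interchange _ _ _ _)
      (A.trans (A.+-cong (antisymmetric-⊛ {∂ z f} {g} (antisymmetric-∂ z f p) q P x y L)
                         (antisymmetric-⊛ {σ f} {∂ z g} (antisymmetric-σ {f} p) (antisymmetric-∂ z g q) P x y L))
               (A.+-identityˡ A.0#))

  antisymmetric-sum : ∀ {m} (f : Vector Series m) → (∀ i → Antisymmetric (f i)) → Antisymmetric (sum f)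
  antisymmetric-sum {zero}  f h = antisymmetric-𝟘
  antisymmetric-sum {suc m} f h = antisymmetric-⊞ {f zero} {sum (λ i → f (suc i))} (h zero) (antisymmetric-sum (λ i → f (suc i)) (λ i → h (suc i)))

  -- Vanishing is insensitive to the sign of a rearrangement. This permits collecting the odd
  -- letters at the front of a word.
  vanishes-↭ : ∀ {L M} → L ↭ M → ∀ {f} → Antisymmetric f → f M A.≈ A.0# → f L A.≈ A.0#
  vanishes-↭ _↭_.refl            h e = e
  vanishes-↭ (_↭_.prep x p)  {f} h e = vanishes-↭ p {∂ x f} (antisymmetric-∂ x f h) e
  vanishes-↭ (_↭_.swap {xs = L} x y p) {f} h e = begin
    f (x ∷ y ∷ L)                           ≈⟨ A.+-identityʳ _ ⟨
    f (x ∷ y ∷ L) A.+ A.0#                  ≈⟨ A.+-congˡ (vanishes-↭ p {∂ x (∂ y f)} (antisymmetric-∂ x (∂ y f) (antisymmetric-∂ y f h)) e) ⟨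
    f (x ∷ y ∷ L) A.+ f (y ∷ x ∷ L)         ≈⟨ h [] x y L ⟩
    A.0#                                    ∎
  vanishes-↭ (_↭_.trans p q) {f} h e = vanishes-↭ p {f} h (vanishes-↭ q {f} h e)

module Multilinearity {a ℓ v ℓ′} (A : Ring a ℓ) (B : Ring v ℓ′) where
  private
    module A = Ring A
    module B = Ring B
  open Shuffle A B.Carrier
  private module S = Ring ring
  open RingProperties A using (x+x≈x⇒x≈0)
  open RingLemmas A
  open SemiringSum S.semiring using (sum)
  open SemiringSum B.semiring using () renaming (sum to sumᴮ)
  open import Relation.Binary.Reasoning.Setoid A.setoid

  -- Quantifying over all z equal to the sum builds in compatibility with equality of letters, from
  -- which `vanishes-≈` is obtained by taking one summand zero.
  Multiadditive : Series → Set (ℓ ⊔ v ⊔ ℓ′)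
  Multiadditive f = ∀ P x y z L → z B.≈ x B.+ y → f (P ++ z ∷ L) A.≈ f (P ++ x ∷ L) A.+ f (P ++ y ∷ L)

  multiadditive-∂ : ∀ x f → Multiadditive f → Multiadditive (∂ x f)
  multiadditive-∂ x f h P = h (x ∷ P)

  multiadditive-𝟘 : Multiadditive 𝟘
  multiadditive-𝟘 P x y z L e = A.sym (A.+-identityˡ A.0#)

  multiadditive-const : ∀ c → Multiadditive (const c)
  multiadditive-const c []      x y z L e = A.sym (A.+-identityˡ A.0#)
  multiadditive-const c (_ ∷ P) x y z L e = A.sym (A.+-identityˡ A.0#)

  multiadditive-single : ∀ c → (∀ {x y z} → z B.≈ x B.+ y → c z A.≈ c x A.+ c y) → Multiadditive (single c)
  multiadditive-single c h []      x y z []      e = h e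
  multiadditive-single c h []      x y z (_ ∷ _) e = A.sym (A.+-identityˡ A.0#)
  multiadditive-single c h (p ∷ P) x y z L       e = multiadditive-const (c p) P x y z L e

  multiadditive-⊞ : ∀ {f g} → Multiadditive f → Multiadditive g → Multiadditive (f ⊞ g)
  multiadditive-⊞ p q P x y z L e = A.trans (A.+-cong (p P x y z L e) (q P x y z L e)) (+-interchange _ _ _ _)

  multiadditive-σ : ∀ {f} → Multiadditive f → Multiadditive (σ f)
  multiadditive-σ {f} h [] x y z L e = begin
    A.- σ (∂ z f) L                             ≈⟨ A.-‿cong (σ-cong (λ M → h [] x y z M e) L) ⟩
    A.- σ (∂ x f ⊞ ∂ y f) L                     ≈⟨ A.-‿cong (σ-⊞ (∂ x f) (∂ y f) L) ⟩
    A.- (σ (∂ x f) L A.+ σ (∂ y f) L)           ≈⟨ neg-+ _ _ ⟩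
    A.- σ (∂ x f) L A.+ A.- σ (∂ y f) L         ∎
  multiadditive-σ {f} h (p ∷ P) x y z L e =
    A.trans (A.-‿cong (multiadditive-σ {∂ p f} (multiadditive-∂ p f h) P x y z L e)) (neg-+ _ _)

  multiadditive-⊛ : ∀ {f g} → Multiadditive f → Multiadditive g → Multiadditive (f ⊛ g)
  multiadditive-⊛ {f} {g} p q [] x y z L e = begin
    (∂ z f ⊛ g) L A.+ (σ f ⊛ ∂ z g) L
      ≈⟨ A.+-cong (S.*-congʳ {g} (λ M → p [] x y z M e) L) (S.*-congˡ {σ f} {∂ z g} {∂ x g ⊞ ∂ y g} (λ M → q [] x y z M e) L) ⟩
    ((∂ x f ⊞ ∂ y f) ⊛ g) L A.+ (σ f ⊛ (∂ x g ⊞ ∂ y g)) L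
      ≈⟨ A.+-cong (⊛-distribʳ g (∂ x f) (∂ y f) L) (⊛-distribˡ (σ f) (∂ x g) (∂ y g) L) ⟩
    ((∂ x f ⊛ g) L A.+ (∂ y f ⊛ g) L) A.+ ((σ f ⊛ ∂ x g) L A.+ (σ f ⊛ ∂ y g) L)
      ≈⟨ +-interchange _ _ _ _ ⟩
    ((∂ x f ⊛ g) L A.+ (σ f ⊛ ∂ x g) L) A.+ ((∂ y f ⊛ g) L A.+ (σ f ⊛ ∂ y g) L) ∎
  multiadditive-⊛ {f} {g} p q (w ∷ P) x y z L e =
    A.trans (A.+-cong (multiadditive-⊛ {∂ w f} {g} (multiadditive-∂ w f p) q P x y z L e)
                      (multiadditive-⊛ {σ f} {∂ w g} (multiadditive-σ {f} p) (multiadditive-∂ w g q) P x y z L e))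
            (+-interchange _ _ _ _)

  multiadditive-sum : ∀ {m} (f : Vector Series m) → (∀ i → Multiadditive (f i)) → Multiadditive (sum f)
  multiadditive-sum {zero}  f h = multiadditive-𝟘
  multiadditive-sum {suc m} f h = multiadditive-⊞ {f zero} {sum (λ i → f (suc i))} (h zero) (multiadditive-sum (λ i → f (suc i)) (λ i → h (suc i)))

  vanishes-+ : ∀ f → Multiadditive f → ∀ {x y z L} → z B.≈ x B.+ y → f (x ∷ L) A.≈ A.0# → f (y ∷ L) A.≈ A.0# → f (z ∷ L) A.≈ A.0#
  vanishes-+ f h {x} {y} {z} {L} e p q = A.trans (h [] x y z L e) (A.trans (A.+-cong p q) (A.+-identityˡ A.0#))

  vanishes-0 : ∀ f → Multiadditive f → ∀ L → f (B.0# ∷ L) A.≈ A.0#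
  vanishes-0 f h L = x+x≈x⇒x≈0 _ (A.sym (h [] B.0# B.0# B.0# L (B.sym (B.+-identityˡ B.0#))))

  vanishes-≈ : ∀ f → Multiadditive f → ∀ {x y L} → x B.≈ y → f (y ∷ L) A.≈ A.0# → f (x ∷ L) A.≈ A.0#
  vanishes-≈ f h {x} {y} {L} e p = vanishes-+ f h {y} {B.0#} (B.trans e (B.sym (B.+-identityʳ y))) p (vanishes-0 f h L)

  vanishes-sum : ∀ f → Multiadditive f → ∀ {L m} (x : Vector B.Carrier m) → (∀ i → f (x i ∷ L) A.≈ A.0#) → f (sumᴮ x ∷ L) A.≈ A.0#
  vanishes-sum f h {L} {zero}  x p = vanishes-0 f h L
  vanishes-sum f h {L} {suc m} x p = vanishes-+ f h {x zero} {sumᴮ (λ i → x (suc i))} B.refl (p zero) (vanishes-sum f h (λ i → x (suc i)) (λ i → p (suc i)))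

-- Transfer to matrices over the Grassmann algebra, by the number of odd letters.

module MatricesOverGrassmann {c ℓ} (R : CommutativeRing c ℓ) (m : ℕ) (m<4 : m ℕ.< 4)
                             (n k : ℕ) (n≡2+k : n ≡ suc (suc k)) where
  open GrassmannParity R m
  private module Z = CommutativeRing ℤ-ring
  open Ring E hiding (zero)
  open RingProperties E
  open RingLemmas E
  open IntegerImage E
  open SemiringSum semiring using (sum; sum-cong-≋; ∑-comm; *-distribʳ-sum)

  -- The matrix unit with its 1 at position (a, b).
  value : Fin n × Fin n → Matrix n Z.ring
  value (a , b) i j = identityMatrix n Z.ring i a ℤ.* identityMatrix n Z.ring b j

  module I = IntegerMatrices (Fin n × Fin n) n k n≡2+k value
  module P = StandardPower E n
  private
    module MA = Ring (matrixRing n E)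
    module IM = Ring (matrixRing n I.ring)
    module PM = Ring (matrixRing n P.ring)
    module SI = SkewDerivations (matrixRing n I.ring) I.X I.∂ₘ I.C
    module SP = SkewDerivations (matrixRing n P.ring) P.X P.∂ₘ P.C
    module AI = Alternating (matrixRing n I.ring) I.X
    module AP = Alternating (matrixRing n P.ring) P.X
  open SemiringExp IM.semiring using () renaming (_^_ to _^ᴵ_; ^-homo-* to ^ᴵ-homo-*)
  open SemiringExp PM.semiring using () renaming (_^_ to _^ᴾ_)
  open SemiringSum (Ring.semiring I.ring) using () renaming (sum to sumᴵ)
  open SemiringSum (Ring.semiring P.ring) using () renaming (sum to sumᴾ)
  open SemiringSum MA.semiring using () renaming (sum to sumᴹ)

  K : ℕ
  K = suc k

  Atom : Set c
  Atom = (Fin n × Fin n) × Carrier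

  part : Bool → Carrier → Carrier
  part false = ev
  part true  = od

  -- The matrix unit of the given position, times the even or odd part of a Grassmann element.
  matrix : Bool × Atom → Matrix n E
  matrix (s , u , x) i j = fromℤ (value u i j) * part s x

  even odd : Atom → Matrix n E
  even t = matrix (false , t)
  odd  t = matrix (true , t)

  unit : Atom → Letter (Fin n × Fin n) n
  unit (u , x) = edge u

  weight : List Atom → Carrier
  weight []            = 1#
  weight ((_ , x) ∷ D) = ev x * weight D

  -- On words of even atoms, f is an integer series up to Grassmann factors. The parameter γ
  -- collects the coefficients that have left the word: those of odd marks, in their order, and
  -- those of letters removed by `∂`.
  record Transfer (γ : Carrier) (F : I.Series) (f : P.Series) : Set (c ⊔ ℓ) where
    constructor transfer
    field at : ∀ D → f (map even D) ≈ fromℤ (F (map unit D)) * (γ * weight D)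
  open Transfer

  transfer-∂ : ∀ t {γ F f} → Transfer γ F f → Transfer (γ * ev (proj₂ t)) (I.∂ (unit t) F) (P.∂ (even t) f)
  transfer-∂ t T .at D = trans (T .at (t ∷ D)) (*-congˡ (sym (*-assoc _ _ _)))

  transfer-γ : ∀ {γ γ′ F f} → γ ≈ γ′ → Transfer γ F f → Transfer γ′ F f
  transfer-γ e T .at D = trans (T .at D) (*-congˡ (*-congʳ e))

  transfer-⊞ : ∀ {γ F G f g} → Transfer γ F f → Transfer γ G g → Transfer γ (F I.⊞ G) (f P.⊞ g)
  transfer-⊞ {F = F} {G} T U .at D = trans (+-cong (T .at D) (U .at D))
    (trans (sym (distribʳ _ _ _)) (*-congʳ (sym (fromℤ-+ (F (map unit D)) (G (map unit D))))))

  transfer-⊟ : ∀ {γ F f} → Transfer γ F f → Transfer γ (I.⊟ F) (P.⊟ f)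
  transfer-⊟ {F = F} T .at D = trans (-‿cong (T .at D)) (trans (-‿distribˡ-* _ _) (*-congʳ (sym (fromℤ-neg (F (map unit D))))))

  transfer-𝟘 : ∀ γ → Transfer γ I.𝟘 P.𝟘
  transfer-𝟘 γ .at D = sym (zeroˡ _)

  transfer-const : ∀ {i x γ} → x ≈ fromℤ i * γ → Transfer γ (I.const i) (P.const x)
  transfer-const e .at []      = trans e (*-congˡ (sym (*-identityʳ _)))
  transfer-const e .at (_ ∷ D) = sym (zeroˡ _)

  transfer-σ : ∀ {γ F f} → Transfer γ F f → Transfer γ (I.σ F) (P.σ f)
  transfer-σ T .at D = go D T
    where
    go : ∀ D {γ F f} → Transfer γ F f → P.σ f (map even D) ≈ fromℤ (I.σ F (map unit D)) * (γ * weight D)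
    go []      T = T .at []
    go (t ∷ D) {F = F} T = trans (-‿cong (go D (transfer-∂ t T)))
      (trans (-‿distribˡ-* _ _) (*-cong (sym (fromℤ-neg (I.σ (I.∂ (unit t) F) (map unit D)))) (*-assoc _ _ _)))

  transfer-⊛ : ∀ {γ δ F G f g} → Transfer γ F f → Transfer δ G g → Transfer (γ * δ) (F I.⊛ G) (f P.⊛ g)
  transfer-⊛ T U .at D = go D T U
    where
    open import Relation.Binary.Reasoning.Setoid setoid
    open RingSolver E
    go : ∀ D {γ δ F G f g} → Transfer γ F f → Transfer δ G g →
         (f P.⊛ g) (map even D) ≈ fromℤ ((F I.⊛ G) (map unit D)) * ((γ * δ) * weight D)
    go [] {γ} {δ} {F} {G} {f} {g} T U = begin
      f [] * g []
        ≈⟨ *-cong (T .at []) (U .at []) ⟩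
      (p * (γ * 1#)) * (q * (δ * 1#))
        ≈⟨ solve 4 (λ p γ q δ → (p :* (γ :* :1)) :* (q :* (δ :* :1)) := p :* ((γ :* q) :* δ)) refl p γ q δ ⟩
      p * ((γ * q) * δ)
        ≈⟨ *-congˡ (*-congʳ (fromℤ-central (G []) γ)) ⟨
      p * ((q * γ) * δ)
        ≈⟨ solve 4 (λ p γ q δ → p :* ((q :* γ) :* δ) := (p :* q) :* ((γ :* δ) :* :1)) refl p γ q δ ⟩
      (p * q) * ((γ * δ) * 1#)
        ≈⟨ *-congʳ (fromℤ-* (F []) (G [])) ⟨
      fromℤ (F [] ℤ.* G []) * ((γ * δ) * 1#) ∎
      where
      p = fromℤ (F [])
      q = fromℤ (G [])
    go (t@(u , x) ∷ D) {γ} {δ} {F} {G} {f} {g} T U = begin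
      (P.∂ (even t) f P.⊛ g) (map even D) + (P.σ f P.⊛ P.∂ (even t) g) (map even D)
        ≈⟨ +-cong (go D (transfer-∂ t T) U) (go D (transfer-σ T) (transfer-∂ t U)) ⟩
      p * (((γ * ev x) * δ) * w) + q * ((γ * (δ * ev x)) * w)
        ≈⟨ +-cong (*-congˡ first) (*-congˡ (solve 4 (λ γ δ e w → (γ :* (δ :* e)) :* w := (γ :* δ) :* (e :* w)) refl γ δ (ev x) w)) ⟩
      p * ((γ * δ) * (ev x * w)) + q * ((γ * δ) * (ev x * w))
        ≈⟨ distribʳ _ _ _ ⟨
      (p + q) * ((γ * δ) * (ev x * w))
        ≈⟨ *-congʳ (fromℤ-+ ((I.∂ (unit t) F I.⊛ G) (map unit D)) ((I.σ F I.⊛ I.∂ (unit t) G) (map unit D))) ⟨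
      fromℤ ((I.∂ (unit t) F I.⊛ G) (map unit D) ℤ.+ (I.σ F I.⊛ I.∂ (unit t) G) (map unit D)) * ((γ * δ) * (ev x * w)) ∎
      where
      w = weight D
      p = fromℤ ((I.∂ (unit t) F I.⊛ G) (map unit D))
      q = fromℤ ((I.σ F I.⊛ I.∂ (unit t) G) (map unit D))
      -- The letter is even, so its coefficient is central and moves past δ.
      first : ((γ * ev x) * δ) * w ≈ (γ * δ) * (ev x * w)
      first = trans (*-congʳ (trans (*-assoc _ _ _) (*-congˡ (ev-central x δ))))
                    (solve 4 (λ γ δ e w → (γ :* (δ :* e)) :* w := (γ :* δ) :* (e :* w)) refl γ δ (ev x) w)

  transfer-sum : ∀ {γ l} (F : Vector I.Series l) (f : Vector P.Series l) → (∀ i → Transfer γ (F i) (f i)) → Transfer γ (sumᴵ F) (sumᴾ f)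
  transfer-sum {γ} {zero}  F f T = transfer-𝟘 γ
  transfer-sum {γ} {suc l} F f T = transfer-⊞ (T zero) (transfer-sum (λ i → F (suc i)) (λ i → f (suc i)) (λ i → T (suc i)))

  Transferₘ : Carrier → I.Mat → P.Mat → Set (c ⊔ ℓ)
  Transferₘ γ F G = ∀ i j → Transfer γ (F i j) (G i j)

  transferₘ-* : ∀ {γ δ F G F′ G′} → Transferₘ γ F F′ → Transferₘ δ G G′ → Transferₘ (γ * δ) (F IM.* G) (F′ PM.* G′)
  transferₘ-* {F = F} {G} {F′} {G′} T U i j =
    transfer-sum (λ l → F i l I.⊛ G l j) (λ l → F′ i l P.⊛ G′ l j) (λ l → transfer-⊛ (T i l) (U l j))

  transferₘ-γ : ∀ {γ γ′ F G} → γ ≈ γ′ → Transferₘ γ F G → Transferₘ γ′ F G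
  transferₘ-γ e T i j = transfer-γ e (T i j)

  transferₘ-minus : ∀ {γ F G F′ G′} → Transferₘ γ F F′ → Transferₘ γ G G′ → Transferₘ γ (F IM.+ IM.- G) (F′ PM.+ PM.- G′)
  transferₘ-minus T U i j = transfer-⊞ (T i j) (transfer-⊟ (U i j))

  transferₘ-+ : ∀ {γ F G F′ G′} → Transferₘ γ F F′ → Transferₘ γ G G′ → Transferₘ γ (F IM.+ G) (F′ PM.+ G′)
  transferₘ-+ T U i j = transfer-⊞ (T i j) (U i j)

  transferₘ-X : Transferₘ 1# I.X P.X
  transferₘ-X i j .at []                = sym (zeroˡ _)
  transferₘ-X i j .at ((u , x) ∷ [])    = *-congˡ (sym (trans (*-identityˡ _) (*-identityʳ _)))
  transferₘ-X i j .at (_ ∷ _ ∷ _)       = sym (zeroˡ _)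

  transferₘ-1 : Transferₘ 1# IM.1# PM.1#
  transferₘ-1 i j with i ≟ j
  ... | yes _ = transfer-const (sym (trans (*-identityʳ _) fromℤ-1))
  ... | no _  = transfer-𝟘 1#

  transferₘ-C : ∀ t → Transferₘ (od (proj₂ t)) (I.C (unit t)) (P.C (odd t))
  transferₘ-C t i j = transfer-const refl

  transferₘ-^ : ∀ l → Transferₘ 1# (I.X ^ᴵ l) (P.X ^ᴾ l)
  transferₘ-^ zero    = transferₘ-1
  transferₘ-^ (suc l) = transferₘ-γ {F = I.X ^ᴵ suc l} {P.X ^ᴾ suc l} (*-identityˡ 1#)
    (transferₘ-* {F = I.X} {I.X ^ᴵ l} {P.X} {P.X ^ᴾ l} transferₘ-X (transferₘ-^ l))

  module _ {γ Y Y′} (T : Transferₘ γ Y Y′) where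

    transferₘ-X* : Transferₘ γ (I.X IM.* Y) (P.X PM.* Y′)
    transferₘ-X* = transferₘ-γ {F = I.X IM.* Y} {P.X PM.* Y′} (*-identityˡ γ) (transferₘ-* {F = I.X} {Y} {P.X} {Y′} transferₘ-X T)

    transferₘ-*X^ : ∀ l → Transferₘ γ (Y IM.* I.X ^ᴵ l) (Y′ PM.* P.X ^ᴾ l)
    transferₘ-*X^ l = transferₘ-γ {F = Y IM.* I.X ^ᴵ l} {Y′ PM.* P.X ^ᴾ l} (*-identityʳ γ)
      (transferₘ-* {F = Y} {I.X ^ᴵ l} {Y′} {P.X ^ᴾ l} T (transferₘ-^ l))

  transferₘ-alt₁ : ∀ {γ Y Y′} → Transferₘ γ Y Y′ → ∀ l → Transferₘ γ (AI.alt₁ l Y) (AP.alt₁ l Y′)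
  transferₘ-alt₁ T zero = T
  transferₘ-alt₁ {γ} {Y} {Y′} T (suc l) =
    transferₘ-minus {F = Y IM.* I.X ^ᴵ suc l} {I.X IM.* AI.alt₁ l Y} {Y′ PM.* P.X ^ᴾ suc l} {P.X PM.* AP.alt₁ l Y′}
      (transferₘ-*X^ {Y = Y} {Y′} T (suc l)) (transferₘ-X* {Y = AI.alt₁ l Y} {AP.alt₁ l Y′} (transferₘ-alt₁ {Y = Y} {Y′} T l))

  transferₘ-alt₂ : ∀ {γ δ Y Z Y′ Z′} → Transferₘ γ Y Y′ → Transferₘ δ Z Z′ → ∀ l → Transferₘ (γ * δ) (AI.alt₂ l Y Z) (AP.alt₂ l Y′ Z′)
  transferₘ-alt₂ {Y = Y} {Z} {Y′} {Z′} T U zero = transferₘ-* {F = Y} {Z} {Y′} {Z′} T U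
  transferₘ-alt₂ {Y = Y} {Z} {Y′} {Z′} T U (suc l) =
    transferₘ-+ {F = I.X IM.* AI.alt₂ l Y Z} {Y IM.* AI.alt₁ (suc l) Z} {P.X PM.* AP.alt₂ l Y′ Z′} {Y′ PM.* AP.alt₁ (suc l) Z′}
      (transferₘ-X* {Y = AI.alt₂ l Y Z} {AP.alt₂ l Y′ Z′} (transferₘ-alt₂ {Y = Y} {Z} {Y′} {Z′} T U l))
      (transferₘ-* {F = Y} {AI.alt₁ (suc l) Z} {Y′} {AP.alt₁ (suc l) Z′} T (transferₘ-alt₁ {Y = Z} {Z′} U (suc l)))

  transferₘ-alt₃ : ∀ {β γ δ W Y Z W′ Y′ Z′} → Transferₘ β W W′ → Transferₘ γ Y Y′ → Transferₘ δ Z Z′ →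
                   ∀ l → Transferₘ (β * (γ * δ)) (AI.alt₃ l W Y Z) (AP.alt₃ l W′ Y′ Z′)
  transferₘ-alt₃ {W = W} {Y} {Z} {W′} {Y′} {Z′} S T U zero =
    transferₘ-* {F = W} {Y IM.* Z} {W′} {Y′ PM.* Z′} S (transferₘ-* {F = Y} {Z} {Y′} {Z′} T U)
  transferₘ-alt₃ {W = W} {Y} {Z} {W′} {Y′} {Z′} S T U (suc l) =
    transferₘ-minus {F = W IM.* AI.alt₂ (suc l) Y Z} {I.X IM.* AI.alt₃ l W Y Z} {W′ PM.* AP.alt₂ (suc l) Y′ Z′} {P.X PM.* AP.alt₃ l W′ Y′ Z′}
      (transferₘ-* {F = W} {AI.alt₂ (suc l) Y Z} {W′} {AP.alt₂ (suc l) Y′ Z′} S (transferₘ-alt₂ {Y = Y} {Z} {Y′} {Z′} T U (suc l)))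
      (transferₘ-X* {Y = AI.alt₃ l W Y Z} {AP.alt₃ l W′ Y′ Z′} (transferₘ-alt₃ {W = W} {Y} {Z} {W′} {Y′} {Z′} S T U l))

  transfer-vanishes : ∀ {γ F f} → Transfer γ F f → F I.≐ I.𝟘 → ∀ D → f (map even D) ≈ 0#
  transfer-vanishes T e D = trans (T .at D) (trans (*-congʳ (reflexive (≡.cong fromℤ (e (map unit D))))) (zeroˡ _))

  -- This is 4n - 2, as `K` = n - 1, written so as to display two marked factors and 4n - 4 others.
  degree : ℕ
  degree = suc (suc (double (K ℕ.+ K)))

  -- Split 4n - 2 as 2n + (2n - 2).
  X^degree≈0 : I.X ^ᴵ degree IM.≈ IM.0#
  X^degree≈0 = ≡.subst (λ d → I.X ^ᴵ d IM.≈ IM.0#) (double-+ (suc K) K)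
    (IM.trans (^ᴵ-homo-* I.X (double (suc K)) (double K))
      (IM.trans (IM.*-congʳ {I.X ^ᴵ double K} I.X^≈0) (IM.zeroˡ (I.X ^ᴵ double K))))
    where
    double-+ : ∀ a b → double a ℕ.+ double b ≡ double (a ℕ.+ b)
    double-+ zero    b = ≡.refl
    double-+ (suc a) b = ≡.cong (λ d → suc (suc d)) (double-+ a b)

  f : Fin n → Fin n → P.Series
  f = P.X ^ᴾ degree

  no-odd : ∀ i j D → f i j (map even D) ≈ 0#
  no-odd i j = transfer-vanishes (transferₘ-^ degree i j) (X^degree≈0 i j)

  -- The integer series involved is the derivative of X^(4n-2), which is already zero.
  one-odd : ∀ i j y D → f i j (odd y ∷ map even D) ≈ 0#
  one-odd i j y D = trans (SP.∂-^ P.laws (odd y) (suc (double (K ℕ.+ K))) i j (map even D))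
    (transfer-vanishes (transferₘ-alt₁ {Y = I.C (unit y)} {P.C (odd y)} (transferₘ-C y) (suc (double (K ℕ.+ K))) i j)
      (λ L → ≡.trans (≡.sym (SI.∂-^ I.laws (unit y) (suc (double (K ℕ.+ K))) i j L)) (X^degree≈0 i j (unit y ∷ L))) D)

  two-odd-expand : ∀ y z → P.∂ₘ (odd z) (P.∂ₘ (odd y) f) PM.≈
                   AP.alt₂ (double (K ℕ.+ K)) (P.C (odd y)) (P.C (odd z)) PM.+ PM.- AP.alt₂ (double (K ℕ.+ K)) (P.C (odd z)) (P.C (odd y))
  two-odd-expand y z = PM.trans (λ i j L → SP.∂-^ P.laws (odd y) (suc (double (K ℕ.+ K))) i j (odd z ∷ L))
                                (SP.∂-alt₁ P.laws (odd y) (odd z) (double (K ℕ.+ K)))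

  two-odd : ∀ i j y z D → f i j (odd y ∷ odd z ∷ map even D) ≈ 0#
  two-odd i j y z D = trans (two-odd-expand y z i j (map even D))
    (trans (+-cong (vanish y z) (trans (-‿cong (vanish z y)) -0#≈0#)) (+-identityˡ 0#))
    where
    vanish : ∀ y z → AP.alt₂ (double (K ℕ.+ K)) (P.C (odd y)) (P.C (odd z)) i j (map even D) ≈ 0#
    vanish y z = transfer-vanishes
      (transferₘ-alt₂ {Y = I.C (unit y)} {I.C (unit z)} {P.C (odd y)} {P.C (odd z)} (transferₘ-C y) (transferₘ-C z) (double (K ℕ.+ K)) i j)
      (I.alt₂≈0 (unit y) (unit z) i j) D

  -- The derivative of `alt₂≈0` in z: x stays to the left of y while z takes all three positions.
  alt₃-relation : ∀ x y z i j L →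
    I.alt₃ (suc (double (k ℕ.+ K))) (I.C x) (I.C y) (I.C z) i j L ℤ.+
    ℤ.- I.alt₃ (suc (double (k ℕ.+ K))) (I.C x) (I.C z) (I.C y) i j L ℤ.+
    I.alt₃ (suc (double (k ℕ.+ K))) (I.C z) (I.C x) (I.C y) i j L ≡ + 0
  alt₃-relation x y z i j L = ≡.trans (≡.sym (SI.∂-alt₂ I.laws x y z (suc (double (k ℕ.+ K))) i j L)) (I.alt₂≈0 x y i j (z ∷ L))

  alt₃-sum : ∀ x y z i j L → let V = λ x y z → I.alt₃ (suc (double (k ℕ.+ K))) (I.C x) (I.C y) (I.C z) i j L in
             V x y z ℤ.+ V x z y ℤ.+ V z x y ℤ.+ V y x z ℤ.+ V y z x ℤ.+ V z y x ≡ + 0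
  alt₃-sum x y z i j L = begin
    V x y z ℤ.+ V x z y ℤ.+ V z x y ℤ.+ V y x z ℤ.+ V y z x ℤ.+ V z y x
      -- Adding `r` over all six orders gives the sum, since each order is weighted by its sign
      -- times the three cyclic relative signs. Then `r z y x` and `r x z y` are eliminated:
      -- `r x y z` - `r y x z`, `r y z x` - `r z y x` and `r z x y` - `r x z y` are all the signed
      -- sum of the `V`'s.
      ≡⟨ solve 6 (λ xyz xzy zxy yxz yzx zyx →
           let r₁ = xyz :- xzy :+ zxy ; r₂ = yzx :- yxz :+ xyz ; r₃ = zxy :- zyx :+ yzx ; r₄ = yxz :- yzx :+ zyx in
           xyz :+ xzy :+ zxy :+ yxz :+ yzx :+ zyx :=
           :- r₁ :+ (r₂ :+ r₂) :+ (r₃ :+ r₃) :+ (r₄ :+ r₄ :+ r₄))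
           ≡.refl (V x y z) (V x z y) (V z x y) (V y x z) (V y z x) (V z y x) ⟩
    ℤ.- r x y z ℤ.+ (r y z x ℤ.+ r y z x) ℤ.+ (r z x y ℤ.+ r z x y) ℤ.+ (r y x z ℤ.+ r y x z ℤ.+ r y x z)
      ≡⟨ combine (alt₃-relation x y z i j L) (alt₃-relation y z x i j L) (alt₃-relation z x y i j L) (alt₃-relation y x z i j L) ⟩
    + 0 ∎
    where
    open ≡.≡-Reasoning
    open RingSolver Z.ring
    V r : (x y z : Letter (Fin n × Fin n) n) → ℤ
    V x y z = I.alt₃ (suc (double (k ℕ.+ K))) (I.C x) (I.C y) (I.C z) i j L
    r x y z = V x y z ℤ.+ ℤ.- V x z y ℤ.+ V z x y
    combine : ∀ {a b c d} → a ≡ + 0 → b ≡ + 0 → c ≡ + 0 → d ≡ + 0 →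
              ℤ.- a ℤ.+ (b ℤ.+ b) ℤ.+ (c ℤ.+ c) ℤ.+ (d ℤ.+ d ℤ.+ d) ≡ + 0
    combine ≡.refl ≡.refl ≡.refl ≡.refl = ≡.refl

  -- The order of the three odd coefficients contributes the sign of the permutation a second time,
  -- so all six orders occur with the same sign.
  three-odd : ∀ i j x y z D → f i j (odd x ∷ odd y ∷ odd z ∷ map even D) ≈ 0#
  three-odd i j x y z D = begin
    f i j (odd x ∷ odd y ∷ odd z ∷ L)
      ≈⟨ two-odd-expand x y i j (odd z ∷ L) ⟩
    AP.alt₂ (suc m′) (P.C (odd x)) (P.C (odd y)) i j (odd z ∷ L) - AP.alt₂ (suc m′) (P.C (odd y)) (P.C (odd x)) i j (odd z ∷ L)
      ≈⟨ +-cong (SP.∂-alt₂ P.laws (odd x) (odd y) (odd z) m′ i j L) (-‿cong (SP.∂-alt₂ P.laws (odd y) (odd x) (odd z) m′ i j L)) ⟩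
    (v x y z - v x z y + v z x y) - (v y x z - v y z x + v z y x)
      ≈⟨ +-cong (+-cong (+-cong (value₃ x y z refl) (-‿cong (value₃ x z y γ-xzy))) (value₃ z x y γ-zxy))
                (-‿cong (+-cong (+-cong (value₃ y x z γ-yxz) (-‿cong (value₃ y z x γ-yzx))) (value₃ z y x γ-zyx))) ⟩
    (V x y z * (γ * w) - V x z y * (- γ * w) + V z x y * (γ * w)) - (V y x z * (- γ * w) - V y z x * (γ * w) + V z y x * (- γ * w))
      ≈⟨ solve 8 (λ a b c d e h γ w →
           (a :* (γ :* w) :- b :* (:- γ :* w) :+ c :* (γ :* w)) :- (d :* (:- γ :* w) :- e :* (γ :* w) :+ h :* (:- γ :* w)) :=
           (a :+ b :+ c :+ d :+ e :+ h) :* (γ :* w)) refl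
           (V x y z) (V x z y) (V z x y) (V y x z) (V y z x) (V z y x) γ w ⟩
    (V x y z + V x z y + V z x y + V y x z + V y z x + V z y x) * (γ * w)
      ≈⟨ *-congʳ (trans (sym (fromℤ-sum₆ (U x y z) (U x z y) (U z x y) (U y x z) (U y z x) (U z y x)))
                        (reflexive (≡.cong fromℤ (alt₃-sum (unit x) (unit y) (unit z) i j (map unit D))))) ⟩
    0# * (γ * w)
      ≈⟨ zeroˡ _ ⟩
    0# ∎
    where
    open import Relation.Binary.Reasoning.Setoid setoid
    open RingSolver E
    m′ = suc (double (k ℕ.+ K))
    L = map even D
    w = weight D
    g : Atom → Carrier
    g t = od (proj₂ t)
    γ = g x * (g y * g z)
    v V : Atom → Atom → Atom → Carrier
    v x y z = AP.alt₃ m′ (P.C (odd x)) (P.C (odd y)) (P.C (odd z)) i j L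
    U : Atom → Atom → Atom → ℤ
    U x y z = AI.alt₃ m′ (I.C (unit x)) (I.C (unit y)) (I.C (unit z)) i j (map unit D)
    V x y z = fromℤ (U x y z)
    value₃ : ∀ x y z {δ} → g x * (g y * g z) ≈ δ → v x y z ≈ V x y z * (δ * w)
    value₃ x y z e = trans (transferₘ-alt₃ {W = I.C (unit x)} {I.C (unit y)} {I.C (unit z)} {P.C (odd x)} {P.C (odd y)} {P.C (odd z)}
                              (transferₘ-C x) (transferₘ-C y) (transferₘ-C z) m′ i j .at D) (*-congˡ (*-congʳ e))
    swap₁₂ : ∀ x y z → g x * (g y * g z) ≈ - (g y * (g x * g z))
    swap₁₂ x y z = trans (sym (*-assoc _ _ _)) (trans (*-congʳ (od-anti (proj₂ x) (proj₂ y))) (trans (neg-* _ _) (-‿cong (*-assoc _ _ _))))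
    swap₂₃ : ∀ x y z → g x * (g y * g z) ≈ - (g x * (g z * g y))
    swap₂₃ x y z = trans (*-congˡ (od-anti (proj₂ y) (proj₂ z))) (*-neg _ _)
    γ-xzy : g x * (g z * g y) ≈ - γ
    γ-xzy = swap₂₃ x z y
    γ-yxz : g y * (g x * g z) ≈ - γ
    γ-yxz = swap₁₂ y x z
    γ-zxy : g z * (g x * g y) ≈ γ
    γ-zxy = trans (swap₁₂ z x y) (trans (-‿cong γ-xzy) (-‿involutive γ))
    γ-yzx : g y * (g z * g x) ≈ γ
    γ-yzx = trans (swap₂₃ y z x) (trans (-‿cong γ-yxz) (-‿involutive γ))
    γ-zyx : g z * (g y * g x) ≈ - γ
    γ-zyx = trans (swap₂₃ z y x) (-‿cong γ-zxy)
    fromℤ-sum₆ : ∀ a b c d e h → fromℤ (a ℤ.+ b ℤ.+ c ℤ.+ d ℤ.+ e ℤ.+ h) ≈ fromℤ a + fromℤ b + fromℤ c + fromℤ d + fromℤ e + fromℤ h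
    fromℤ-sum₆ a b c d e h = trans (fromℤ-+ (a ℤ.+ b ℤ.+ c ℤ.+ d ℤ.+ e) h) (+-congʳ
      (trans (fromℤ-+ (a ℤ.+ b ℤ.+ c ℤ.+ d) e) (+-congʳ (trans (fromℤ-+ (a ℤ.+ b ℤ.+ c) d)
      (+-congʳ (trans (fromℤ-+ (a ℤ.+ b) c) (+-congʳ (fromℤ-+ a b))))))))

  odds : List (Bool × Atom) → ℕ
  odds []              = 0
  odds ((false , _) ∷ D) = odds D
  odds ((true , _) ∷ D)  = suc (odds D)

  -- Each odd letter of the word takes up one level, so four odd letters bring level four down to
  -- zero.
  KillSeries : ℕ → P.Mat → Set (c ⊔ ℓ)
  KillSeries d G = ∀ D i j → Kill (d ℕ.∸ odds D) (G i j (map matrix D))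

  -- At level zero an odd factor stays at level zero, in agreement with truncated subtraction.
  kill-od-pred : ∀ x e {z} → Kill e z → Kill (ℕ.pred e) (od x * z)
  kill-od-pred x zero    p = kill-od x 0 p
  kill-od-pred x (suc e) p = kill-od-suc x e p

  kill-matrix : ∀ t d D i l {z} → Kill (d ℕ.∸ odds D) z → Kill (d ℕ.∸ odds (t ∷ D)) (matrix t i l * z)
  kill-matrix (s , u , x) d D i l {z} p = kill-cong (d ℕ.∸ odds ((s , u , x) ∷ D)) (sym (*-assoc _ _ _))
    (kill-commuting (λ r → sym (fromℤ-central (value u i l) (generator r))) (d ℕ.∸ odds ((s , u , x) ∷ D)) (go s))
    where
    go : ∀ s → Kill (d ℕ.∸ odds ((s , u , x) ∷ D)) (part s x * z)
    go false = kill-ev x (d ℕ.∸ odds D) p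
    go true  = ≡.subst (λ e → Kill e (od x * z)) (ℕₚ.pred[m∸n]≡m∸[1+n] d (odds D)) (kill-od-pred x (d ℕ.∸ odds D) p)

  killSeries-∂ : ∀ t d {G} → KillSeries d G → KillSeries (d ℕ.∸ odds (t ∷ [])) (P.∂ₘ (matrix t) G)
  killSeries-∂ t@(false , _) d p D i j = p (t ∷ D) i j
  killSeries-∂ t@(true , _)  d {G} p D i j =
    ≡.subst (λ e → Kill e (G i j (matrix t ∷ map matrix D))) (≡.sym (ℕₚ.∸-+-assoc d 1 (odds D))) (p (t ∷ D) i j)

  killSeries-X* : ∀ d {G} → KillSeries d G → KillSeries d (P.X PM.* G)
  killSeries-X* d {G} p []      i j = kill-cong d (sym (P.eval-X*-[] G i j)) (kill-0 d)
  killSeries-X* d {G} p (t ∷ D) i j = kill-cong e (sym (P.eval-X*-∷ (matrix t) G (map matrix D) i j))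
    (kill-+ e (kill-sum e (λ l → matrix t i l * G l j (map matrix D)) (λ l → kill-matrix t d D i l (p D l j)))
              (kill-neg e (≡.subst (λ e → Kill e ((P.X PM.* P.∂ₘ (matrix t) G) i j (map matrix D))) (shift-odds t)
                (killSeries-X* (d ℕ.∸ odds (t ∷ [])) (killSeries-∂ t d {G} p) D i j))))
    where
    e = d ℕ.∸ odds (t ∷ D)
    shift-odds : ∀ t → d ℕ.∸ odds (t ∷ []) ℕ.∸ odds D ≡ d ℕ.∸ odds (t ∷ D)
    shift-odds (false , _) = ≡.refl
    shift-odds (true , _)  = ℕₚ.∸-+-assoc d 1 (odds D)

  killSeries-^ : ∀ l → KillSeries 4 (P.X ^ᴾ l)
  killSeries-^ zero []      i j = kill-anything 4 _ m<4
  killSeries-^ zero (t ∷ D) i j with i ≟ j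
  ... | yes _ = kill-0 (4 ℕ.∸ odds (t ∷ D))
  ... | no _  = kill-0 (4 ℕ.∸ odds (t ∷ D))
  killSeries-^ (suc l) = killSeries-X* 4 {P.X ^ᴾ l} (killSeries-^ l)

  separate : ∀ (D : List (Bool × Atom)) → Σ (List Atom × List Atom) λ (os , es) → D ↭ map (true ,_) os ++ map (false ,_) es
  separate []              = ([] , []) , ↭-refl
  separate ((true , t) ∷ D)  = let ((os , es) , p) = separate D in (t ∷ os , es) , ↭-prep (true , t) p
  separate ((false , t) ∷ D) = let ((os , es) , p) = separate D in
    (os , t ∷ es) , ↭-trans (↭-prep (false , t) p) (↭-sym (shift (false , t) (map (true ,_) os) (map (false ,_) es)))

  open Antisymmetry E (Matrix n E) using (Antisymmetric; antisymmetric-const; antisymmetric-𝟘; antisymmetric-single; antisymmetric-⊛; antisymmetric-sum; vanishes-↭)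
  open Multilinearity E (matrixRing n E) using (Multiadditive; multiadditive-const; multiadditive-𝟘; multiadditive-single; multiadditive-⊛; multiadditive-sum; multiadditive-∂; vanishes-+; vanishes-≈; vanishes-sum)

  antisymmetric-^ : ∀ l i j → Antisymmetric ((P.X ^ᴾ l) i j)
  antisymmetric-^ zero i j with i ≟ j
  ... | yes _ = antisymmetric-const 1#
  ... | no _  = antisymmetric-𝟘
  antisymmetric-^ (suc l) i j = antisymmetric-sum (λ h → P.X i h P.⊛ (P.X ^ᴾ l) h j)
    (λ h → antisymmetric-⊛ {P.X i h} {(P.X ^ᴾ l) h j} (antisymmetric-single (λ x → x i h)) (antisymmetric-^ l h j))

  multiadditive-^ : ∀ l i j → Multiadditive ((P.X ^ᴾ l) i j)
  multiadditive-^ zero i j with i ≟ j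
  ... | yes _ = multiadditive-const 1#
  ... | no _  = multiadditive-𝟘
  multiadditive-^ (suc l) i j = multiadditive-sum (λ h → P.X i h P.⊛ (P.X ^ᴾ l) h j)
    (λ h → multiadditive-⊛ {P.X i h} {(P.X ^ᴾ l) h j} (multiadditive-single (λ x → x i h) (λ e → e i h)) (multiadditive-^ l h j))

  separated-vanishes : ∀ os es i j → f i j (map matrix (map (true ,_) os ++ map (false ,_) es)) ≈ 0#
  separated-vanishes []               es i j = ≡.subst (λ L → f i j L ≈ 0#) (Listₚ.map-∘ es) (no-odd i j es)
  separated-vanishes (x ∷ [])         es i j = ≡.subst (λ L → f i j (odd x ∷ L) ≈ 0#) (Listₚ.map-∘ es) (one-odd i j x es)
  separated-vanishes (x ∷ y ∷ [])     es i j = ≡.subst (λ L → f i j (odd x ∷ odd y ∷ L) ≈ 0#) (Listₚ.map-∘ es) (two-odd i j x y es)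
  separated-vanishes (x ∷ y ∷ z ∷ []) es i j = ≡.subst (λ L → f i j (odd x ∷ odd y ∷ odd z ∷ L) ≈ 0#) (Listₚ.map-∘ es) (three-odd i j x y z es)
  separated-vanishes (w ∷ x ∷ y ∷ z ∷ os) es i j =
    ≡.subst (λ e → Kill e (f i j (map matrix D))) (ℕₚ.m≤n⇒m∸n≡0 {4} {odds D} (s≤s (s≤s (s≤s (s≤s z≤n))))) (killSeries-^ degree D i j)
    where D = map (true ,_) (w ∷ x ∷ y ∷ z ∷ os) ++ map (false ,_) es

  atoms-vanish : ∀ D i j → f i j (map matrix D) ≈ 0#
  atoms-vanish D i j = let ((os , es) , p) = separate D in
    vanishes-↭ (map⁺ matrix p) {f i j} (antisymmetric-^ degree i j) (separated-vanishes os es i j)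

  fromℤ-identity : ∀ i j → fromℤ (identityMatrix n Z.ring i j) ≈ MA.1# i j
  fromℤ-identity i j with i ≟ j
  ... | yes _ = fromℤ-1
  ... | no _  = refl

  sumᴹ-entry : ∀ {l} (x : Vector (Matrix n E) l) i j → sumᴹ x i j ≈ sum (λ h → x h i j)
  sumᴹ-entry {zero}  x i j = refl
  sumᴹ-entry {suc l} x i j = +-congˡ (sumᴹ-entry (λ h → x (suc h)) i j)

  matrix-expansion : ∀ x → x MA.≈ sumᴹ (λ a → sumᴹ (λ b → even ((a , b) , x a b) MA.+ odd ((a , b) , x a b)))
  matrix-expansion x i j = sym (begin
    sumᴹ (λ a → sumᴹ (t a)) i j
      ≈⟨ trans (sumᴹ-entry (λ a → sumᴹ (t a)) i j) (sum-cong-≋ (λ a → sumᴹ-entry (t a) i j)) ⟩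
    sum (λ a → sum (λ b → t a b i j))
      ≈⟨ sum-cong-≋ (λ a → sum-cong-≋ (λ b → entry a b)) ⟩
    sum (λ a → sum (λ b → (MA.1# i a * x a b) * MA.1# b j))
      -- The expansion into matrix units is x = (1 x) 1 written out, where the inner sum runs over
      -- a.
      ≈⟨ ∑-comm (λ a b → (MA.1# i a * x a b) * MA.1# b j) ⟩
    sum (λ b → sum (λ a → (MA.1# i a * x a b) * MA.1# b j))
      ≈⟨ sum-cong-≋ (λ b → *-distribʳ-sum (MA.1# b j) (λ a → MA.1# i a * x a b)) ⟨
    ((MA.1# MA.* x) MA.* MA.1#) i j
      ≈⟨ MA.trans (MA.*-identityʳ (MA.1# MA.* x)) (MA.*-identityˡ x) i j ⟩
    x i j ∎)
    where
    open import Relation.Binary.Reasoning.Setoid setoid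
    t : Fin n → Fin n → Matrix n E
    t a b = even ((a , b) , x a b) MA.+ odd ((a , b) , x a b)
    entry : ∀ a b → t a b i j ≈ (MA.1# i a * x a b) * MA.1# b j
    entry a b = begin
      fromℤ (p ℤ.* q) * ev (x a b) + fromℤ (p ℤ.* q) * od (x a b)   ≈⟨ distribˡ _ _ _ ⟨
      fromℤ (p ℤ.* q) * (ev (x a b) + od (x a b))                   ≈⟨ *-cong (fromℤ-* p q) (sym (parts (x a b))) ⟩
      (fromℤ p * fromℤ q) * x a b                                   ≈⟨ *-assoc _ _ _ ⟩
      fromℤ p * (fromℤ q * x a b)                                   ≈⟨ *-congˡ (fromℤ-central q (x a b)) ⟩
      fromℤ p * (x a b * fromℤ q)                                   ≈⟨ *-assoc _ _ _ ⟨
      (fromℤ p * x a b) * fromℤ q                                   ≈⟨ *-cong (*-congʳ (fromℤ-identity i a)) (fromℤ-identity b j) ⟩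
      (MA.1# i a * x a b) * MA.1# b j                               ∎
      where
      p = identityMatrix n Z.ring i a
      q = identityMatrix n Z.ring b j

  -- Letters are expanded into atoms one at a time; g is arbitrary so that the induction can pass to
  -- its derivative at an atom.
  vanishes-on-all : ∀ L g → Multiadditive g → (∀ D → g (map matrix D) ≈ 0#) → g L ≈ 0#
  vanishes-on-all []      g h v = v []
  vanishes-on-all (x ∷ L) g h v = vanishes-≈ g h (matrix-expansion x)
    (vanishes-sum g h (λ a → sumᴹ (t a)) (λ a → vanishes-sum g h (t a) (λ b →
      vanishes-+ g h {even ((a , b) , x a b)} {odd ((a , b) , x a b)} MA.refl
        (atom (false , (a , b) , x a b)) (atom (true , (a , b) , x a b)))))
    where
    t : Fin n → Fin n → Matrix n E
    t a b = even ((a , b) , x a b) MA.+ odd ((a , b) , x a b)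
    atom : ∀ s → g (matrix s ∷ L) ≈ 0#
    atom s = vanishes-on-all L (P.∂ (matrix s) g) (multiadditive-∂ (matrix s) g h) (λ D → v (s ∷ D))

  standardIdentity : StandardIdentity (matrixRing n E) degree
  standardIdentity x = MA.trans (P.standard-power degree x)
    (λ i j → vanishes-on-all (tabulate x) (f i j) (multiadditive-^ degree i j) (λ D → atoms-vanish D i j))

-- The standard identity of degree 4n - 2.

-- The bound on m says that four generators always multiply to zero, so at most three odd elements
-- can occur.
standardIdentity-Grassmann : ∀ {c ℓ} (R : CommutativeRing c ℓ) m → m ℕ.< 4 → ∀ n → 2 ℕ.≤ n → StandardIdentity (matrixRing n (Grassmann R m)) (4 ℕ.* n ℕ.∸ 2)
standardIdentity-Grassmann R m m<4 n@(suc (suc k)) (s≤s (s≤s _)) =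
  ≡.subst (StandardIdentity (matrixRing n (Grassmann R m))) degree≡ standardIdentity
  where
  open MatricesOverGrassmann R m m<4 n k ≡.refl using (degree; standardIdentity)
  double≡ : ∀ l → double l ≡ l ℕ.+ l
  double≡ zero    = ≡.refl
  double≡ (suc l) = ≡.cong suc (≡.trans (≡.cong suc (double≡ l)) (≡.sym (ℕₚ.+-suc l l)))
  degree≡ : degree ≡ 4 ℕ.* n ℕ.∸ 2
  degree≡ = ≡.trans (≡.cong (λ d → suc (suc d)) (double≡ (suc k ℕ.+ suc k)))
    (ℕ-solve 1 (λ k → let K = con 1 :+ k ; n = con 1 :+ K in
       con 2 :+ ((K :+ K) :+ (K :+ K)) := k :+ (n :+ (n :+ (n :+ con 0)))) ≡.refl k)
    where open +-*-Solver using (con; _:+_; _:=_) renaming (solve to ℕ-solve)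

open import Data.Nat.Base using (_≤_; _*_; _∸_)

theorem1p2 : ∀ {c ℓ} (R : CommutativeRing c ℓ) (n : ℕ) → 2 ≤ n →
    StandardIdentity (matrixRing n (Grassmann R 2)) (4 * n ∸ 2) ×
    StandardIdentity (matrixRing n (Grassmann R 3)) (4 * n ∸ 2)
theorem1p2 R n 2≤n =
  standardIdentity-Grassmann R 2 (s≤s (s≤s (s≤s z≤n))) n 2≤n ,
  standardIdentity-Grassmann R 3 (s≤s (s≤s (s≤s (s≤s z≤n)))) n 2≤n
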